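{- Let $(S,M)$ be a marked surface without punctures, $T$ a triangulation of $(S,M)$, and $\zeta$ an essential loop in $(S,M)$. There is a bijection $\psi_{\zeta}:\mathbb{P}_g(\widetilde{G}_{\zeta})\to\mathbb{A}_g(T_{\zeta})$ satisfying $x(P)=x(\psi_{\zeta}(P))$ and $y(P)=y(\psi_{\zeta}(P))$ for all $P\in\mathbb{P}_g(\widetilde{G}_{\zeta})$. In particular, $$x_{\zeta}=\frac{1}{\operatorname{cross}(T,\zeta)}\sum_{A\in\mathbb{A}_g(T_{\zeta})}x(A)y(A).$$
   Context: A marked surface without punctures: $S$ is a connected compact oriented surface with boundary and $M$ a finite set of marked points on $\partial S$, at least one on each boundary component (not a monogon, digon or triangle). $T=\{1,\dots,N\}$ is a triangulation (maximal set of pairwise non-crossing arcs) with initial variables $x_i$ and coefficients $y_i$. An essential loop $\zeta$ is a closed curve in $S$ up to isotopy, disjoint from $M$ and $\partial S$, without self-intersection, and not contractible (taken to cross $T$ minimally). Cutting $\zeta$. Choose a triangle $\triangle$ of $T$ crossed by $\zeta$ and a point $p$ on $\zeta$ in the interior of $\triangle$. Let $\alpha$ (resp. $\beta$) be the side of $\triangle$ crossed by $\zeta$ immediately before (resp. after) $p$, and $\tau$ the third side. $\widetilde\zeta$ is the curve from $p$ to $p$ following $\zeta$. Let $\tau_1=\beta,\dots,\tau_n=\alpha$ be the arcs crossed in order and $\triangle_0=\triangle,\triangle_1,\dots,\triangle_n=\triangle$ the triangles passed through. $T_{\widetilde\zeta}$ is the triangulated polygon obtained from copies of $\triangle_0,\dots,\triangle_n$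 by gluing $\triangle_{i-1},\triangle_i$ along $\tau_i$. Snake graph $G_{\widetilde\zeta}$: tile $i$ is the 4-cycle bounding $\triangle_{i-1}\cup\triangle_i$ (with diagonal $\tau_i$); tiles $i$ and $i+1$ are glued along the side of $\triangle_i$ other than $\tau_i,\tau_{i+1}$, matching endpoints. Edges of $G_{\widetilde\zeta}$ are labelled by the corresponding arcs of $T$ or boundary segments. In the first triangle, $v$ (resp. $w$) is the common endpoint of $\tau$ and $\alpha$ (resp. $\tau$ and $\beta$); in the last triangle, $v'$ (resp. $w'$) is the common endpoint of $\tau$ and $\beta$ (resp. $\tau$ and $\alpha$). Band graph $\widetilde G_\zeta$: obtained from $G_{\widetilde\zeta}$ by identifying the edge $\tau$ of the first tile with the edge $\tau$ of the last tile so that $v$ is identified with $v'$ (and $w$ with $w'$). A perfect matching $P$ of $\widetilde G_\zeta$ (set of edges covering each vertex exactly once) is good if $\tau\in P$, or if the edges of $P$ incident to $v$ and to $w$ both lie on the same square (both on the first tile or both on the last tile of $G_{\widetilde\zeta}$). $\mathbb{P}_g(\widetilde G_\zeta)$ is the set of good perfect matchings. For such $P$, viewed as edges of $G_{\widetilde\zeta}$ by cutting along $\tau$, $\overline P$ is the perfect matching of $G_{\widetilde\zeta}$ obtained by adding the edge $\tau$ of the first or of the last tile as needed (if $\tau\in P$, $\overline P$ contains both copies of $\tau$). Weights of $P$: $x_e=x_i$ if the edge $e$ is labelled by an arc $i$ of $T$, and $x_e=1$ if by a boundary segment of $(S,M)$; $x(P)=\prod_{e\in P}x_e$. Let $P_-(G_{\widetilde\zeta})$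 be the perfect matching of $G_{\widetilde\zeta}$ consisting only of boundary edges (edges lying in exactly one tile) and containing the edge of the first tile corresponding to the side of the first triangle that follows $\tau_1$ clockwise. $P_-(G_{\widetilde\zeta})\triangle\overline P$ (symmetric difference) is the set of boundary edges of a union of tiles; $y(P):=\prod y_j$ over the diagonals $j$ of these tiles. $\operatorname{cross}(T,\zeta)=\prod_{i=1}^n x_{\tau_i}$, and $x_\zeta:=\frac{1}{\operatorname{cross}(T,\zeta)}\sum_{P\in\mathbb{P}_g(\widetilde G_\zeta)}x(P)y(P)$. Triangulated annulus $T_\zeta$: glue copies of $\triangle_1,\dots,\triangle_n$ cyclically along $\tau_1,\dots,\tau_n$ (with $\triangle_n$ glued to $\triangle_1$ along $\tau_1$); the diagonals are $\tau_1,\dots,\tau_n$, the other edges are boundary segments of the annulus. $\mathbb{A}(T_\zeta)$ is the set of perfect matchings of angles: sets $A$ of angles of triangles with exactly one angle of $A$ at each vertex (incident to a diagonal) and exactly one in each triangle. An angle of $A$ at a boundary vertex $v$ satisfies the min-condition (resp. max-condition) if it comes first in the counterclockwise (resp. clockwise) order around $v$. $A$ is bad if all its angles at vertices of one boundary component satisfy the min-condition and all its angles at vertices of the other boundary component satisfy the max-condition; otherwise good. $\mathbb{A}_g(T_\zeta)$ is the set of good ones. $x(A)=\prod_{a\in A}x_a$ with $x_a=x_\sigma$ for $\sigma$ the side opposite $a$ in its triangle ($x_\sigma=1$ for boundary segments of $(S,M)$). $A_-(T_\zeta)$ is the perfect matching of angles all of whose angles satisfy the min-condition, and $y(A)=\prod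 y_\sigma$ over the diagonals $\sigma$ of $T_\zeta$ that are sides of at least one exterior angle (angle between a boundary segment and a diagonal of $T_\zeta$) belonging to $A_-(T_\zeta)\triangle A$.
   Formalization: "Good" is corrected: if τ is not in P, the edges of P at v and w must lie on the same side of the cut along τ, not necessarily on the first (or last) tile itself; with the literal condition some annuli with three triangles have 3 good band matchings but 4 good angle matchings. -}

module Defs where

open import Algebra.Bundles using (CommutativeRing)
import Algebra.Properties.CommutativeMonoid.Sum as FiniteSum
open import Data.Bool.Base using (Bool; true; false; not; if_then_else_)
import Data.Bool.Properties as Bool
open import Data.Fin.Base as Fin using (Fin; zero; suc; fromℕ; inject₁; combine; remQuot)
open import Data.Fin.Properties as Fin using (any?)
open import Data.Fin.Relation.Unary.Top using (view; view-inject₁; ‵fromℕ; ‵inject₁)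
open import Data.Fin.Subset using (Subset; inside; outside; _∈_; _∪_; _─_; ⊥)
open import Data.Fin.Subset.Properties using (_∈?_; anySubset?)
open import Data.Maybe.Base using (Maybe; just; nothing; fromMaybe)
import Data.Maybe.Properties as Maybe
open import Data.Nat.Base as ℕ using (ℕ; zero; suc; _<_; _≤_)
open import Data.Nat.GeneralisedArithmetic using (iterate)
open import Data.Product using (Σ; ∃; ∃-syntax; ∃!; _×_; _,_; proj₁; proj₂)
import Data.Product.Properties as Product
open import Data.Refinement using (Refinement-syntax; value)
open import Data.Sum.Base as Sum using (_⊎_; inj₁; inj₂; [_,_])
open import Data.Vec.Base using ([]; _∷_; tabulate)
import Data.Vec.Properties as Vec
open import Function.Base using (_∘_; id)
open import Function.Bundles using (_↔_; Inverse)
open import Level using (Level; 0ℓ) renaming (suc to lsuc; _⊔_ to _⊔ˡ_)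
open import Relation.Binary.Construct.Closure.ReflexiveTransitive using (Star)
open import Relation.Binary.Definitions using (DecidableEquality)
open import Relation.Binary.PropositionalEquality using (_≡_; _≢_; refl; sym)
open import Relation.Nullary using (¬_; Dec; contradiction; yes; no; does; ¬?; _×-dec_; _⊎-dec_; _→-dec_)
open import Relation.Nullary.Decidable using (map′; decidable-stable)
open import Relation.Unary using (Decidable)

private
  variable
    n : ℕ

-- Successor and predecessor in the cyclic order of Fin (suc n).

next : Fin (suc n) → Fin (suc n)
next i with view i
... | ‵fromℕ     = zero
... | ‵inject₁ j = suc j

prev : Fin (suc n) → Fin (suc n)
prev zero    = fromℕ _
prev (suc i) = inject₁ i

-- A marked surface without punctures together with a triangulation,
-- presented by gluing oriented triangles.  The vertices of each triangle
-- are 0, 1, 2 in counterclockwise order, and side s is the side opposite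
-- vertex s.  Hence the sides 0, 1, 2 follow each other counterclockwise,
-- and walking counterclockwise along side s leads from vertex next s to
-- vertex prev s.  Every arc a has two flanks (a , false) and (a , true),
-- each of which is a side of a triangle; every boundary segment is one
-- side of one triangle.  The two sides belonging to an arc are glued so
-- as to reverse their counterclockwise directions, so the result is an
-- oriented surface.

record Gluing : Set where
  field
    #triangles #arcs #segments : ℕ
    gluing : (Fin #triangles × Fin 3) ↔ ((Fin #arcs × Bool) ⊎ Fin #segments)

  open Inverse gluing public using () renaming (to to flank; from to sideAt)

  label : Fin #triangles × Fin 3 → Fin #arcs ⊎ Fin #segments
  label s = Sum.map₁ proj₁ (flank s)

  Adjacent : Fin #triangles → Fin #triangles → Set
  Adjacent t t′ = ∃[ a ] ∃[ f ] (proj₁ (sideAt (inj₁ (a , f))) ≡ t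
                               × proj₁ (sideAt (inj₁ (a , not f))) ≡ t′)

  -- Turning counterclockwise about vertex u of triangle t, one leaves t
  -- through side next u, and enters the neighbouring triangle through a
  -- side s′, at its vertex next s′.  The vertex lies on the boundary of
  -- the surface iff this process ends (otherwise the triangles close up
  -- around it and it is a puncture).
  data OnBoundary : Fin #triangles → Fin 3 → Set where
    stop : ∀ {t u b} → flank (t , next u) ≡ inj₂ b → OnBoundary t u
    turn : ∀ {t u a f t′ s′} → flank (t , next u) ≡ inj₁ (a , f) →
           sideAt (inj₁ (a , not f)) ≡ (t′ , s′) →
           OnBoundary t′ (next s′) → OnBoundary t u

record TriangulatedSurface : Set where
  field
    presentation : Gluing
  open Gluing presentation public
  field
    connected    : ∀ t t′ → Star Adjacent t t′
    no-punctures : ∀ t u → OnBoundary t u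
    -- The surface is not a triangle.  (A monogon or a digon is not a
    -- gluing of triangles without punctures.)
    has-arc      : 1 ≤ #arcs

-- A closed curve ζ in minimal position with respect to the
-- triangulation, with a chosen direction and a chosen point p on it.
-- Write c = suc #crossings-1.  Crossing k : Fin c is the arc τ_{k+1}, and
-- segment k is the passage of ζ from crossing k to crossing next k, through
-- the triangle △_{k+1}; p lies on the last segment.
--
-- Minimal position means that ζ never leaves a triangle through the side by
-- which it entered.  As the surface retracts onto the dual graph of the
-- triangulation, such a loop is contractible iff it crosses no arc.
--
-- The field position describes the order in which ζ meets each arc: it locates
-- crossing k along its arc, increasing in the counterclockwise direction of the
-- triangle on the flank false.

record ClosedCurve (S : TriangulatedSurface) : Set where
  open TriangulatedSurface S

  field
    #crossings-1 : ℕ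

  #crossings : ℕ
  #crossings = suc #crossings-1

  field
    triangle    : Fin #crossings → Fin #triangles
    entry exit  : Fin #crossings → Fin 3
    entry≢exit  : ∀ k → entry k ≢ exit k
    arc         : Fin #crossings → Fin #arcs
    dir         : Fin #crossings → Bool
    enters      : ∀ k → flank (triangle k , entry k) ≡ inj₁ (arc k , dir k)
    exits       : ∀ k → flank (triangle k , exit k)
                      ≡ inj₁ (arc (next k) , not (dir (next k)))
    position    : Fin #crossings → ℕ
    position-injective : ∀ k l → arc k ≡ arc l → position k ≡ position l → k ≡ l

  -- Points on the boundary of a triangle: side, flank and position.
  Point : Set
  Point = Fin 3 × Bool × ℕ

  start end : Fin #crossings → Point
  start k = entry k , dir k , position k
  end   k = exit k , not (dir (next k)) , position (next k)

  -- p comes before q when walking once counterclockwise around the boundary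
  -- of the triangle, starting from side 0.
  _≺_ : Point → Point → Set
  (s , f , i) ≺ (s′ , _ , i′) =
    (s Fin.< s′) ⊎ (s ≡ s′ × (if f then i′ < i else i < i′))

  Between : Fin #crossings → Point → Set
  Between k r = (start k ≺ r × r ≺ end k) ⊎ (end k ≺ r × r ≺ start k)

  Crosses : Fin #crossings → Fin #crossings → Set
  Crosses k l = (Between k (start l) × ¬ Between k (end l))
              ⊎ (¬ Between k (start l) × Between k (end l))

-- Segments of ζ passing through a common triangle are disjoint.
record EssentialLoop (S : TriangulatedSurface) : Set where
  field
    curve : ClosedCurve S
  open ClosedCurve curve public
  open TriangulatedSurface S using (#triangles)
  field
    simple : ∀ k l → k ≢ l → triangle k ≡ triangle l → ¬ Crosses k l

Searchable : Set → Set₁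
Searchable A = {P : A → Set} → Decidable P → Dec (∃ P)

search-× : ∀ {A B} → Searchable A → Searchable B → Searchable (A × B)
search-× anyA anyB P? =
  map′ (λ (a , b , p) → (a , b) , p) (λ ((a , b) , p) → a , b , p)
       (anyA λ a → anyB λ b → P? (a , b))

every? : ∀ {A} → Searchable A → {P : A → Set} → Decidable P → Dec (∀ a → P a)
every? anyA P? =
  map′ (λ ¬∃ a → decidable-stable (P? a) (λ ¬p → ¬∃ (a , ¬p)))
       (λ f (a , ¬p) → ¬p (f a))
       (¬? (anyA (¬? ∘ P?)))

unique? : ∀ {A} → Searchable A → DecidableEquality A →
          {P : A → Set} → Decidable P → Dec (∃! _≡_ P)
unique? anyA _≟_ P? =
  anyA λ a → P? a ×-dec
    map′ (λ f {b} → f b) (λ f b → f) (every? anyA λ b → P? b →-dec (a ≟ b))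

-- (k , s) stands for side s, or for the angle opposite side s, of the k-th
-- triangle in a sequence.
Cell : ℕ → Set
Cell n = Fin n × Fin 3

_≟ᶜ_ : DecidableEquality (Cell n)
_≟ᶜ_ = Product.≡-dec Fin._≟_ Fin._≟_

anyᶜ : Searchable (Cell n)
anyᶜ = search-× any? any?

_∋_ : Subset (n ℕ.* 3) → Cell n → Set
P ∋ (k , s) = combine k s ∈ P

_∋?_ : (P : Subset (n ℕ.* 3)) (e : Cell n) → Dec (P ∋ e)
P ∋? (k , s) = combine k s ∈? P

cells : {P : Cell n → Set} → Decidable P → Subset (n ℕ.* 3)
cells P? = tabulate (λ e → does (P? (remQuot 3 e)))

infixl 6 _△_
_△_ : Subset n → Subset n → Subset n
P △ Q = (P ─ Q) ∪ (Q ─ P)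

-- The subset satisfying P.  It is only used for properties satisfied by
-- exactly one subset; the value ⊥ is a dummy for the remaining case.
the : {P : Subset n → Set} → Decidable P → Subset n
the P? with anySubset? P?
... | yes (U , _) = U
... | no  _       = ⊥

module Loop {S : TriangulatedSurface} (ζ : EssentialLoop S) where
  open TriangulatedSurface S
  open EssentialLoop ζ

  private
    c = #crossings

  first last : Fin c
  first = zero
  last  = fromℕ _

  -- The side crossed by neither end of segment k.
  third : Fin c → Fin 3
  third k with exit k Fin.≟ next (entry k)
  ... | yes _ = next (exit k)
  ... | no  _ = next (entry k)

  -- The triangles of the triangulated polygon are indexed by Fin (suc c);
  -- the first and the last are both copies of the triangle containing p.
  segment : Fin (suc c) → Fin c
  segment zero    = last
  segment (suc k) = k

  △₀ △ₙ : Fin (suc c)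
  △₀ = zero
  △ₙ = fromℕ c

  entryᵖ exitᵖ : Fin (suc c) → Fin 3
  entryᵖ = entry ∘ segment
  exitᵖ  = exit ∘ segment

  -- Tile i has diagonal τ_{i+1}, the arc at crossing i, and consists of the
  -- triangles behind it (inject₁ i) and in front of it (suc i).  Its corners
  -- are the end points of the diagonal to the left and to the right of ζ,
  -- and the two vertices opposite the diagonal.
  data Corner : Set where
    back left right front : Corner

  -- The corner of tile i at vertex u of the triangle behind (in front of)
  -- its diagonal.
  backCorner frontCorner : Fin c → Fin 3 → Corner
  backCorner i u with u Fin.≟ exitᵖ (inject₁ i) | u Fin.≟ next (exitᵖ (inject₁ i))
  ... | yes _ | _     = back
  ... | no  _ | yes _ = right
  ... | no  _ | no  _ = left
  frontCorner i u with u Fin.≟ entryᵖ (suc i) | u Fin.≟ next (entryᵖ (suc i))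
  ... | yes _ | _     = front
  ... | no  _ | yes _ = left
  ... | no  _ | no  _ = right

  -- Tiles i and i+1 are glued along the third side of their common triangle,
  -- the end points of which are the vertices opposite the entry side and
  -- opposite the exit side.  So the front corner of tile i is an end point of
  -- the diagonal of tile i+1, the back corner of tile i+1 is an end point of
  -- the diagonal of tile i, and there are no other identifications.  A vertex
  -- is represented by the end point of a diagonal, except for the back corner
  -- of the first tile and the front corner of the last tile.  The gluing is
  -- confirmed by glue-entry and glue-exit.
  Vertex : Set
  Vertex = Fin c × Corner

  vertex : Fin c → Corner → Vertex
  vertex i       left  = i , left
  vertex i       right = i , right
  vertex zero    back  = first , back
  vertex (suc i) back  = inject₁ i , frontCorner (inject₁ i) (exit (inject₁ i))
  vertex i       front with view i
  ... | ‵fromℕ     = last , front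
  ... | ‵inject₁ j = suc j , backCorner (suc j) (entry (inject₁ j))

  glue-entry : ∀ j → vertex (inject₁ j) (frontCorner (inject₁ j) (entry (inject₁ j)))
                   ≡ vertex (suc j) (backCorner (suc j) (entry (inject₁ j)))
  glue-entry j
    with entry (inject₁ j) Fin.≟ entry (inject₁ j) | vertex (inject₁ j) front in eq
  ... | no  e≢e | _ = contradiction refl e≢e
  ... | yes _   | _ rewrite view-inject₁ j
    with refl ← eq
    with entry (inject₁ j) Fin.≟ exit (inject₁ j) | entry (inject₁ j) Fin.≟ next (exit (inject₁ j))
  ... | yes e≡x | _     = contradiction e≡x (entry≢exit (inject₁ j))
  ... | no  _   | yes _ = refl
  ... | no  _   | no  _ = refl

  glue-exit : ∀ j → vertex (inject₁ j) (frontCorner (inject₁ j) (exit (inject₁ j)))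
                  ≡ vertex (suc j) (backCorner (suc j) (exit (inject₁ j)))
  glue-exit j with exit (inject₁ j) Fin.≟ exit (inject₁ j)
  ... | no  x≢x = contradiction refl x≢x
  ... | yes _
    with exit (inject₁ j) Fin.≟ entry (inject₁ j) | exit (inject₁ j) Fin.≟ next (entry (inject₁ j))
  ... | yes x≡e | _     = contradiction (sym x≡e) (entry≢exit (inject₁ j))
  ... | no  _   | yes _ = refl
  ... | no  _   | no  _ = refl

  -- The edges of the snake graph are sides (j , s) of the triangles of the
  -- polygon.  A third side lies in both neighbouring tiles.  The sides
  -- (△₀ , exit) and (△ₙ , entry) lie in no tile and are not edges.
  Behind InFront InTile : Fin c → Cell (suc c) → Set
  Behind  i (j , s) = j ≡ inject₁ i × s ≢ exitᵖ j
  InFront i (j , s) = j ≡ suc i × s ≢ entryᵖ j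
  InTile  i e       = Behind i e ⊎ InFront i e

  Incident : Vertex → Cell (suc c) → Set
  Incident v e = ∃[ i ] ∃[ u ] (u ≢ proj₂ e
    × ((Behind i e × vertex i (backCorner i u) ≡ v)
     ⊎ (InFront i e × vertex i (frontCorner i u) ≡ v)))

  SnakeMatching : Subset (suc c ℕ.* 3) → Set
  SnakeMatching Q = (∀ e → Q ∋ e → ∃[ i ] InTile i e)
    × (∀ i x → ∃! _≡_ λ e → Q ∋ e × Incident (vertex i x) e)

  -- Since p lies on the last segment, the sides α, β, τ of △ are the entry,
  -- exit and third side of that segment, and the common end point of two of
  -- them is the vertex opposite the remaining one.
  α β τ : Fin 3
  α = entry last
  β = exit last
  τ = third last

  v w v′ w′ : Vertex
  v  = vertex first (backCorner first β)
  w  = vertex first (backCorner first α)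
  v′ = vertex last (frontCorner last α)
  w′ = vertex last (frontCorner last β)

  _≟ᵏ_ : DecidableEquality Corner
  back  ≟ᵏ back  = yes refl
  back  ≟ᵏ left  = no λ ()
  back  ≟ᵏ right = no λ ()
  back  ≟ᵏ front = no λ ()
  left  ≟ᵏ back  = no λ ()
  left  ≟ᵏ left  = yes refl
  left  ≟ᵏ right = no λ ()
  left  ≟ᵏ front = no λ ()
  right ≟ᵏ back  = no λ ()
  right ≟ᵏ left  = no λ ()
  right ≟ᵏ right = yes refl
  right ≟ᵏ front = no λ ()
  front ≟ᵏ back  = no λ ()
  front ≟ᵏ left  = no λ ()
  front ≟ᵏ right = no λ ()
  front ≟ᵏ front = yes refl

  _≟ᵛ_ : DecidableEquality Vertex
  _≟ᵛ_ = Product.≡-dec Fin._≟_ _≟ᵏ_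

  identify : Vertex → Vertex
  identify x with x ≟ᵛ v′ | x ≟ᵛ w′
  ... | yes _ | _     = v
  ... | no  _ | yes _ = w
  ... | no  _ | no  _ = x

  -- The edges of the band graph are the sides (k , s) of the triangles of the
  -- segments.  An edge of the snake graph becomes an edge of the band graph by
  -- identifying △₀ with △ₙ; among the edges, this only identifies the two
  -- copies of τ, as each of the two other sides is an edge in one copy only.
  glued : Cell (suc c) → Cell c
  glued (j , s) = segment j , s

  BandIncident : Vertex → Cell c → Set
  BandIncident x b = ∃[ e ] (glued e ≡ b × ∃[ x′ ] (Incident x′ e × identify x′ ≡ x))

  BandMatching : Subset (c ℕ.* 3) → Set
  BandMatching P =
    ∀ i x → ∃! _≡_ λ b → P ∋ b × BandIncident (identify (vertex i x)) b

  -- The vertex x of the snake graph is covered by P, seen as a set of edges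
  -- of the snake graph by cutting along τ.
  Covered : Subset (c ℕ.* 3) → Vertex → Set
  Covered P x = ∃[ e ] (P ∋ glued e × Incident x e)

  -- The two edges at v and w are on the same side of the cut: both of them
  -- end at the edge τ of the first tile, or both at the edge τ of the last.
  -- They need not be edges of that tile itself: in a fan, the second tile has
  -- an edge at w which is not an edge of the first tile, and a perfect matching
  -- containing it may well extend to the snake graph by τ.
  AtFirst AtLast : Subset (c ℕ.* 3) → Set
  AtFirst P = Covered P v × Covered P w
  AtLast  P = Covered P v′ × Covered P w′

  GoodBandMatching : Subset (c ℕ.* 3) → Set
  GoodBandMatching P = BandMatching P × (P ∋ (last , τ) ⊎ AtFirst P ⊎ AtLast P)

  -- Angle (k , u) is the angle of the triangle of segment k at its vertex u,
  -- opposite side u.  It spans from side prev u to side next u in the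
  -- counterclockwise order around the vertex.  Two triangles of consecutive
  -- segments share a diagonal; the third sides are boundary segments.

  clockwise counterclockwise : Cell c → Maybe (Cell c)
  clockwise (k , u) with prev u Fin.≟ entry k | prev u Fin.≟ exit k
  ... | yes _ | _     = just (prev k , prev (exit (prev k)))
  ... | no  _ | yes _ = just (next k , prev (entry (next k)))
  ... | no  _ | no  _ = nothing
  counterclockwise (k , u) with next u Fin.≟ entry k | next u Fin.≟ exit k
  ... | yes _ | _     = just (prev k , next (exit (prev k)))
  ... | no  _ | yes _ = just (next k , next (entry (next k)))
  ... | no  _ | no  _ = nothing

  MinCondition MaxCondition : Cell c → Set
  MinCondition a = clockwise a ≡ nothing
  MaxCondition a = counterclockwise a ≡ nothing

  -- The first angle in the counterclockwise order around the vertex of a,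
  -- used as a name for that vertex.  It is reached in fewer steps than there
  -- are angles.
  vertexOf : Cell c → Cell c
  vertexOf a = iterate (λ b → fromMaybe b (clockwise b)) a (c ℕ.* 3)

  -- Every vertex of the annulus is incident to a diagonal.
  AngleMatching : Subset (c ℕ.* 3) → Set
  AngleMatching A =
      (∀ (k : Fin c) → ∃! _≡_ λ u → A ∋ (k , u))
    × (∀ a → ∃! _≡_ λ b → A ∋ b × vertexOf b ≡ vertexOf a)

  -- The two boundary components of the annulus are the two sides of ζ.  This
  -- says whether the vertex of an angle is on the left of ζ: ζ enters through
  -- side entry k with vertex next (entry k) on its left and
  -- prev (entry k) on its right.
  onLeft : Cell c → Bool
  onLeft (k , u) with u Fin.≟ entry k
  ... | yes _ = does (exit k Fin.≟ next (entry k))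
  ... | no  _ = does (u Fin.≟ next (entry k))

  Bad : Subset (c ℕ.* 3) → Set
  Bad A = ∃[ b ] (∀ (a : Cell c) → A ∋ a → (onLeft a ≡ b → MinCondition a)
                              × (onLeft a ≡ not b → MaxCondition a))

  GoodAngleMatching : Subset (c ℕ.* 3) → Set
  GoodAngleMatching A = AngleMatching A × ¬ Bad A

  -- Side (k , s) is the diagonal at crossing d.
  IsDiagonal : Fin c → Cell c → Set
  IsDiagonal d (k , s) = (d ≡ k × s ≡ entry k) ⊎ (d ≡ next k × s ≡ exit k)

  -- Angle (k , u) is an exterior angle having the diagonal at d as a side.
  ExteriorAt : Fin c → Cell c → Set
  ExteriorAt d (k , u) = u ≢ third k × ∃[ s ] (s ≢ u × IsDiagonal d (k , s))

  anyᵏ : Searchable Corner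
  anyᵏ P? = map′
    (λ { (inj₁ p) → back , p ; (inj₂ (inj₁ p)) → left , p
       ; (inj₂ (inj₂ (inj₁ p))) → right , p ; (inj₂ (inj₂ (inj₂ p))) → front , p })
    (λ { (back , p) → inj₁ p ; (left , p) → inj₂ (inj₁ p)
       ; (right , p) → inj₂ (inj₂ (inj₁ p)) ; (front , p) → inj₂ (inj₂ (inj₂ p)) })
    (P? back ⊎-dec (P? left ⊎-dec (P? right ⊎-dec P? front)))

  anyᵛ : Searchable Vertex
  anyᵛ = search-× any? anyᵏ

  behind? : ∀ i → Decidable (Behind i)
  behind? i (j , s) = (j Fin.≟ inject₁ i) ×-dec ¬? (s Fin.≟ exitᵖ j)

  inFront? : ∀ i → Decidable (InFront i)
  inFront? i (j , s) = (j Fin.≟ suc i) ×-dec ¬? (s Fin.≟ entryᵖ j)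

  inTile? : ∀ i → Decidable (InTile i)
  inTile? i e = behind? i e ⊎-dec inFront? i e

  incident? : ∀ x → Decidable (Incident x)
  incident? x e = any? λ i → any? λ u → ¬? (u Fin.≟ proj₂ e) ×-dec
    ((behind? i e ×-dec (vertex i (backCorner i u) ≟ᵛ x))
      ⊎-dec (inFront? i e ×-dec (vertex i (frontCorner i u) ≟ᵛ x)))

  snakeMatching? : Decidable SnakeMatching
  snakeMatching? Q =
    every? anyᶜ (λ e → (Q ∋? e) →-dec any? λ i → inTile? i e)
    ×-dec every? any? (λ i → every? anyᵏ λ x →
      unique? anyᶜ _≟ᶜ_ λ e → (Q ∋? e) ×-dec incident? (vertex i x) e)

  bandIncident? : ∀ x → Decidable (BandIncident x)
  bandIncident? x b = anyᶜ λ e → (glued e ≟ᶜ b) ×-dec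
    anyᵛ λ x′ → incident? x′ e ×-dec (identify x′ ≟ᵛ x)

  bandMatching? : Decidable BandMatching
  bandMatching? P = every? any? λ i → every? anyᵏ λ x →
    unique? anyᶜ _≟ᶜ_ λ b → (P ∋? b) ×-dec bandIncident? (identify (vertex i x)) b

  covered? : ∀ P → Decidable (Covered P)
  covered? P x = anyᶜ λ e → (P ∋? glued e) ×-dec incident? x e

  atFirst? : Decidable AtFirst
  atFirst? P = covered? P v ×-dec covered? P w

  atLast? : Decidable AtLast
  atLast? P = covered? P v′ ×-dec covered? P w′

  goodBandMatching? : Decidable GoodBandMatching
  goodBandMatching? P = bandMatching? P
    ×-dec ((P ∋? (last , τ)) ⊎-dec (atFirst? P ⊎-dec atLast? P))

  minCondition? : Decidable MinCondition
  minCondition? a = Maybe.≡-dec _≟ᶜ_ (clockwise a) nothing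

  maxCondition? : Decidable MaxCondition
  maxCondition? a = Maybe.≡-dec _≟ᶜ_ (counterclockwise a) nothing

  angleMatching? : Decidable AngleMatching
  angleMatching? A =
    every? any? (λ (k : Fin c) → unique? any? Fin._≟_ λ u → A ∋? (k , u))
    ×-dec every? anyᶜ (λ a →
      unique? anyᶜ _≟ᶜ_ λ b → (A ∋? b) ×-dec (vertexOf b ≟ᶜ vertexOf a))

  anyBool : Searchable Bool
  anyBool P? = map′ [ true ,_ , false ,_ ]
    (λ { (true , p) → inj₁ p ; (false , p) → inj₂ p }) (P? true ⊎-dec P? false)

  bad? : Decidable Bad
  bad? A = anyBool λ b → every? anyᶜ λ a → (A ∋? a) →-dec
    (((onLeft a Bool.≟ b) →-dec minCondition? a)
      ×-dec ((onLeft a Bool.≟ not b) →-dec maxCondition? a))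

  goodAngleMatching? : Decidable GoodAngleMatching
  goodAngleMatching? A = angleMatching? A ×-dec ¬? (bad? A)

  exteriorAt? : ∀ d → Decidable (ExteriorAt d)
  exteriorAt? d (k , u) = ¬? (u Fin.≟ third k) ×-dec any? λ s →
    ¬? (s Fin.≟ u) ×-dec
    (((d Fin.≟ k) ×-dec (s Fin.≟ entry k)) ⊎-dec ((d Fin.≟ next k) ×-dec (s Fin.≟ exit k)))

  IsMinimalSnake : Subset (suc c ℕ.* 3) → Set
  IsMinimalSnake Q = SnakeMatching Q
    × (∀ (e : Cell (suc c)) → Q ∋ e → ∃! _≡_ λ i → InTile i e)
    -- The sides are numbered counterclockwise, so prev is the clockwise
    -- successor; τ_1 is the exit side of △₀.
    × Q ∋ (△₀ , prev (exitᵖ △₀))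

  isMinimalSnake? : Decidable IsMinimalSnake
  isMinimalSnake? Q = snakeMatching? Q
    ×-dec (every? anyᶜ (λ e → (Q ∋? e) →-dec unique? any? Fin._≟_ λ i → inTile? i e)
    ×-dec (Q ∋? (△₀ , prev (exitᵖ △₀))))

  P₋ : Subset (suc c ℕ.* 3)
  P₋ = the isMinimalSnake?

  -- If P contains τ then both copies of τ already lie over P.  Otherwise the
  -- copy of τ away from the edges at v and w is added.
  completion : Subset (c ℕ.* 3) → Subset (suc c ℕ.* 3)
  completion P = cells {P = λ e → (∃[ i ] InTile i e)
      × (P ∋ glued e ⊎ (e ≡ (△₀ , τ) × AtLast P) ⊎ (e ≡ (△ₙ , τ) × AtFirst P))}
    λ e → any? (λ i → inTile? i e)
      ×-dec ((P ∋? glued e)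
        ⊎-dec (((e ≟ᶜ (△₀ , τ)) ×-dec atLast? P)
          ⊎-dec ((e ≟ᶜ (△ₙ , τ)) ×-dec atFirst? P)))

  -- The boundary edges of the union of the tiles in U.
  ∂ : Subset c → Subset (suc c ℕ.* 3)
  ∂ U = cells {P = λ e → ∃! _≡_ λ i → i ∈ U × InTile i e}
    λ e → unique? any? Fin._≟_ λ i → (i ∈? U) ×-dec inTile? i e

  enclosedTiles : Subset (c ℕ.* 3) → Subset c
  enclosedTiles P = the λ U → Vec.≡-dec Bool._≟_ (∂ U) (P₋ △ completion P)

  A₋ : Subset (c ℕ.* 3)
  A₋ = the {P = λ A → AngleMatching A × (∀ (a : Cell c) → A ∋ a → MinCondition a)}
    λ A → angleMatching? A ×-dec every? anyᶜ λ a → (A ∋? a) →-dec minCondition? a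

  exteriorDiagonals : Subset (c ℕ.* 3) → Subset c
  exteriorDiagonals A = tabulate λ d →
    does (anyᶜ λ (a : Cell c) → ((A₋ △ A) ∋? a) ×-dec exteriorAt? d a)

open Loop using (GoodBandMatching; GoodAngleMatching)

module _ {S : TriangulatedSurface} (ζ : EssentialLoop S) where
  open EssentialLoop ζ using (#crossings)

  ℙg 𝔸g : Set
  ℙg = [ P ∈ Subset (#crossings ℕ.* 3) ∣ GoodBandMatching ζ P ]
  𝔸g = [ A ∈ Subset (#crossings ℕ.* 3) ∣ GoodAngleMatching ζ A ]

-- A commutative ring with invertible initial variables x_i and coefficients
-- y_i; for instance the ring of Laurent polynomials in all x_i and y_i.
record Seed (a ℓ : Level) (S : TriangulatedSurface) : Set (lsuc (a ⊔ˡ ℓ)) where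
  open TriangulatedSurface S using (#arcs)
  field
    commutativeRing : CommutativeRing a ℓ
  open CommutativeRing commutativeRing public
  field
    x x⁻¹ y   : Fin #arcs → Carrier
    x-inverse : ∀ i → x i * x⁻¹ i ≈ 1#

  open FiniteSum *-commutativeMonoid public using () renaming (sum to ∏)

  ∏[_] : ∀ {m} → Subset m → (Fin m → Carrier) → Carrier
  ∏[ U ] f = ∏ λ e → if does (e ∈? U) then f e else 1#

  ∑⊆ : ∀ {m} → (Subset m → Carrier) → Carrier
  ∑⊆ {zero}  f = f []
  ∑⊆ {suc m} f = ∑⊆ (f ∘ (inside ∷_)) + ∑⊆ (f ∘ (outside ∷_))

  ∑[_] : ∀ {m} {P : Subset m → Set} → Decidable P → (Subset m → Carrier) → Carrier
  ∑[ P? ] f = ∑⊆ λ U → if does (P? U) then f U else 0#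

module Weights {a ℓ} {S : TriangulatedSurface} (𝒮 : Seed a ℓ S) (ζ : EssentialLoop S) where
  open TriangulatedSurface S
  open EssentialLoop ζ
  open Seed 𝒮
  open Loop ζ

  weight : Fin #arcs ⊎ Fin #segments → Carrier
  weight = [ x , (λ _ → 1#) ]

  edgeWeight angleWeight : Cell #crossings → Carrier
  edgeWeight  (k , s) = weight (label (triangle k , s))
  -- Side u is opposite vertex u.
  angleWeight (k , u) = weight (label (triangle k , u))

  xᴾ yᴾ xᴬ yᴬ : Subset (#crossings ℕ.* 3) → Carrier
  xᴾ P = ∏[ P ] (edgeWeight ∘ remQuot 3)
  yᴾ P = ∏[ enclosedTiles P ] (y ∘ arc)
  xᴬ A = ∏[ A ] (angleWeight ∘ remQuot 3)
  yᴬ A = ∏[ exteriorDiagonals A ] (y ∘ arc)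

  -- The inverse of cross(T , ζ).
  cross⁻¹ : Carrier
  cross⁻¹ = ∏ (x⁻¹ ∘ arc)

  x[ζ] : Carrier
  x[ζ] = cross⁻¹ * ∑[ goodBandMatching? ] (λ P → xᴾ P * yᴾ P)

  angleExpansion : Carrier
  angleExpansion = cross⁻¹ * ∑[ goodAngleMatching? ] (λ A → xᴬ A * yᴬ A)

-- Each triangle crossed by ζ has an entry side, an exit side and a third side, and between
-- the end points of two consecutive diagonals the snake graph has exactly one edge for each
-- of these sides.  A good matching of the band graph contains one side of each triangle and
-- is therefore determined by telling, for each diagonal, which of its end points is covered
-- from below; the only constraint is that consecutive triangles agree about the diagonal
-- between them.  Reading each side as the angle opposite to it, the same data describe the
-- good matchings of angles: if two triangles disagree, then either all angles are opposite
-- to the exit sides or all are opposite to the entry sides, and these two matchings are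
-- the bad ones.  So the bijection is the identity on sets of pairs (triangle , side).  The
-- minimal matchings on both sides cover the right end point of every diagonal from below,
-- hence both y-monomials are products over the diagonals whose left end point is covered
-- from below.

module Submission where

open import Defs
open import Data.Bool.Base using (Bool; true; false; not; if_then_else_; _xor_)
open import Data.Bool.Properties using (not-¬; ¬-not; not-involutive; not-injective; xor-identityʳ)
import Data.Bool.Properties as Bool
open import Data.Empty using (⊥; ⊥-elim)
open import Data.Fin.Base as Fin using (Fin; zero; suc; fromℕ; inject₁; combine; remQuot; punchOut)
open import Data.Fin.Induction using (<-weakInduction; >-weakInduction)
import Data.Fin.Properties as Fin
open import Data.Fin.Relation.Unary.Top using (view; view-fromℕ; view-inject₁; ‵fromℕ; ‵inject₁)
open import Data.Fin.Subset using (Subset; inside; outside; _∈_)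
open import Data.Fin.Subset.Properties using (_∈?_; anySubset?)
open import Data.Irrelevant using ([_])
open import Data.Maybe.Base using (Maybe; just; nothing; fromMaybe)
open import Data.Maybe.Properties using (just-injective)
open import Data.Nat.Base as ℕ using (ℕ; zero; suc)
open import Data.Nat.GeneralisedArithmetic using (iterate)
import Data.Nat.Properties as ℕ
open import Data.Product using (Σ-syntax; ∃; ∃-syntax; ∃!; _×_; _,_; proj₁; proj₂; uncurry)
open import Data.Refinement using (_,_; value; value-injective)
open import Data.Sum.Base as Sum using (_⊎_; inj₁; inj₂)
open import Data.Vec.Base using (Vec; []; _∷_; lookup; tabulate)
open import Data.Vec.Properties
  using ([]=⇒lookup; lookup⇒[]=; lookup∘tabulate; tabulate∘lookup; tabulate-cong; ≡-dec)
open import Function.Base using (_∘_; id; case_of_)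
open import Function.Bundles using (Inverse; _⤖_; Bijection; mk⤖; mk⇔)
open import Relation.Binary.Definitions using (DecidableEquality)
open import Relation.Binary.PropositionalEquality hiding ([_])
open import Relation.Nullary using (¬_; Dec; contradiction; yes; no; does; _×-dec_; _⊎-dec_; _→-dec_)
open import Relation.Nullary.Decidable using (dec-true; dec-false; does-⇔; recompute)
open import Relation.Unary using (Decidable)

-- Each triangle is reduced to its hand (the side of `ζ` on which its third side lies) and each
-- choice to a role, so local geometry becomes case analysis on `Bool` and `Role`. The global input
-- is that both hands occur. It gives every vertex of the annulus a first angle, forces at least two
-- crossings and ends every search around a vertex. From agreement to a matching of angles, a search
-- only finds an angle at each vertex; uniqueness comes from counting. Conversely, a disagreement
-- that no single vertex forbids puts both end points of one diagonal under angles of the same role,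
-- and this pattern forces the neighbouring triangle and travels around the whole annulus. In the
-- band graph the obstacle is the cut: `w` merges an end point of the first diagonal with one of the
-- last, so covering it once does not tell which diagonal is served. Goodness restores this for the
-- first diagonal. The triangle at the cut is controlled by `v`, which after the gluing lies on
-- exactly its three sides.

-- Paths and induction along the cyclic order.

next-fromℕ : ∀ n → next (fromℕ n) ≡ zero
next-fromℕ n rewrite view-fromℕ n = refl

next-inject₁ : ∀ {n} (i : Fin n) → next (inject₁ i) ≡ suc i
next-inject₁ i rewrite view-inject₁ i = refl

next-prev : ∀ {n} (i : Fin (suc n)) → next (prev i) ≡ i
next-prev {n} zero = next-fromℕ n
next-prev (suc i)  = next-inject₁ i

prev-next : ∀ {n} (i : Fin (suc n)) → prev (next i) ≡ i
prev-next i with view i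
... | ‵fromℕ     = refl
... | ‵inject₁ j = refl

inject₁≢suc : ∀ {n} (i : Fin n) → inject₁ i ≢ suc i
inject₁≢suc i eq = ℕ.1+n≢n (trans (sym (cong Fin.toℕ eq)) (Fin.toℕ-inject₁ i))

iterate-suc : ∀ {A : Set} (f : A → A) x n → iterate f x (suc n) ≡ f (iterate f x n)
iterate-suc f x zero    = refl
iterate-suc f x (suc n) = iterate-suc f (f x) n

iterate-+ : ∀ {A : Set} (f : A → A) x m n → iterate f x (m ℕ.+ n) ≡ iterate f (iterate f x m) n
iterate-+ f x zero    n = refl
iterate-+ f x (suc m) n = iterate-+ f (f x) m n

iterate-prev-toℕ : ∀ {n} (i : Fin (suc n)) m → m ≡ Fin.toℕ i → iterate prev i m ≡ zero
iterate-prev-toℕ zero    zero    _  = refl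
iterate-prev-toℕ (suc i) (suc m) eq =
  iterate-prev-toℕ (inject₁ i) m (trans (ℕ.suc-injective eq) (sym (Fin.toℕ-inject₁ i)))

iterate-prev-fromℕ : ∀ {n} (i : Fin (suc n)) →
                     ∃[ m ] (m ℕ.+ Fin.toℕ i ≡ n × iterate prev (fromℕ n) m ≡ i)
iterate-prev-fromℕ {n} = >-weakInduction _ (0 , Fin.toℕ-fromℕ n , refl) λ i (m , eq , it) →
  suc m , trans (trans (cong (λ t → suc (m ℕ.+ t)) (Fin.toℕ-inject₁ i)) (sym (ℕ.+-suc m _))) eq ,
  trans (iterate-suc prev (fromℕ n) m) (cong prev it)

-- The path descends to `zero`, wraps around and descends to `j`, so it takes at most two rounds.
-- The bound is the number of iterations in `vertexOf`, with one step to spare for `settles-step`.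
prev-path : ∀ {n} (i j : Fin (suc n)) → ∃[ m ] (suc m ℕ.≤ suc n ℕ.* 3 × iterate prev i m ≡ j)
prev-path {n} i j with iterate-prev-fromℕ j
... | m , eq , it = l , bound , path
  where
  l = Fin.toℕ i ℕ.+ suc m
  bound : suc l ℕ.≤ suc n ℕ.* 3
  bound = begin
    suc (Fin.toℕ i) ℕ.+ suc m ≤⟨ ℕ.+-mono-≤ (Fin.toℕ<n i) (ℕ.s≤s (subst (m ℕ.≤_) eq (ℕ.m≤m+n m _))) ⟩
    suc n ℕ.+ suc n           ≤⟨ ℕ.+-monoʳ-≤ (suc n) (ℕ.m≤m+n (suc n) _) ⟩
    3 ℕ.* suc n               ≡⟨ ℕ.*-comm 3 (suc n) ⟩
    suc n ℕ.* 3               ∎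
    where open ℕ.≤-Reasoning
  path : iterate prev i l ≡ j
  path = trans (iterate-+ prev i (Fin.toℕ i) (suc m))
    (trans (cong (λ k → iterate prev k (suc m)) (iterate-prev-toℕ i _ refl)) it)

iterate-next : ∀ {n} (i j : Fin (suc n)) m → iterate prev i m ≡ j → iterate next j m ≡ i
iterate-next i j zero    eq = sym eq
iterate-next i j (suc m) eq = trans (iterate-suc next j m)
  (trans (cong next (iterate-next (prev i) j m eq)) (next-prev i))

next-path : ∀ {n} (i j : Fin (suc n)) → ∃[ m ] (suc m ℕ.≤ suc n ℕ.* 3 × iterate next i m ≡ j)
next-path i j with prev-path j i
... | m , le , it = m , le , iterate-next j i m it

iterate-induction : ∀ {A : Set} (P : A → Set) (f : A → A) → (∀ a → P a → P (f a)) →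
                    ∀ a n → P a → P (iterate f a n)
iterate-induction P f step a zero    p = p
iterate-induction P f step a (suc n) p = iterate-induction P f step (f a) n (step a p)

next-induction : ∀ {n} (P : Fin (suc n) → Set) → (∀ i → P i → P (next i)) → ∀ i → P i → ∀ j → P j
next-induction P step i p j with next-path i j
... | m , _ , eq = subst P eq (iterate-induction P next step i m p)

prev-induction : ∀ {n} (P : Fin (suc n) → Set) → (∀ i → P (next i) → P i) → ∀ i → P i → ∀ j → P j
prev-induction P step i p j with prev-path i j
... | m , _ , eq = subst P eq
  (iterate-induction P prev (λ k q → step (prev k) (subst P (sym (next-prev k)) q)) i m p)

-- Sides and angles of a single triangle.

next³ : (u : Fin 3) → next (next (next u)) ≡ u
next³ zero             = refl
next³ (suc zero)       = refl
next³ (suc (suc zero)) = refl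

prev≡next² : (u : Fin 3) → prev u ≡ next (next u)
prev≡next² zero             = refl
prev≡next² (suc zero)       = refl
prev≡next² (suc (suc zero)) = refl

next≢ : (u : Fin 3) → next u ≢ u
next≢ zero             ()
next≢ (suc zero)       ()
next≢ (suc (suc zero)) ()

next²≢ : (u : Fin 3) → next (next u) ≢ u
next²≢ zero             ()
next²≢ (suc zero)       ()
next²≢ (suc (suc zero)) ()

≢⇒next : (u s : Fin 3) → s ≢ u → s ≡ next u ⊎ s ≡ next (next u)
≢⇒next zero             zero             ne = contradiction refl ne
≢⇒next zero             (suc zero)       ne = inj₁ refl
≢⇒next zero             (suc (suc zero)) ne = inj₂ refl
≢⇒next (suc zero)       zero             ne = inj₂ refl
≢⇒next (suc zero)       (suc zero)       ne = contradiction refl ne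
≢⇒next (suc zero)       (suc (suc zero)) ne = inj₁ refl
≢⇒next (suc (suc zero)) zero             ne = inj₁ refl
≢⇒next (suc (suc zero)) (suc zero)       ne = inj₂ refl
≢⇒next (suc (suc zero)) (suc (suc zero)) ne = contradiction refl ne

-- The entry, exit and third side of a triangle on the path of ζ, or the angles
-- opposite to them.
data Role : Set where
  en ex th : Role

infix 4 _≟ʳ_
_≟ʳ_ : DecidableEquality Role
en ≟ʳ en = yes refl
en ≟ʳ ex = no λ ()
en ≟ʳ th = no λ ()
ex ≟ʳ en = no λ ()
ex ≟ʳ ex = yes refl
ex ≟ʳ th = no λ ()
th ≟ʳ en = no λ ()
th ≟ʳ ex = no λ ()
th ≟ʳ th = yes refl

-- The counterclockwise order of the roles: entry, exit, third if the third side is to the left. A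
-- reflection exchanges the hands, whence `prevR`.
nextR prevR : Bool → Role → Role
nextR true  en = ex
nextR true  ex = th
nextR true  th = en
nextR false en = th
nextR false th = ex
nextR false ex = en
prevR h = nextR (not h)

-- In the snake graph, the side of role r of a triangle with hand h joins the
-- end point not (lower h r) of the diagonal below the triangle to the end point
-- upper h r of the diagonal above it (true is left, false is right).
lower upper : Bool → Role → Bool
lower h en = not h
lower h ex = h
lower h th = not h
upper h en = not h
upper h ex = h
upper h th = h

-- The end point b of the diagonal above (below) a triangle with hand h is the
-- vertex of the angle bot b h (top b h) of that triangle.
bot top : Bool → Bool → Role
bot true  true  = en
bot true  false = th
bot false true  = th
bot false false = en
top true  true  = ex
top true  false = th
top false true  = th
top false false = ex

-- The angles opposite the entry and exit sides sit at the end points of the third side, hence on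
-- the side of `ζ` given by the hand; the remaining angle faces them.
onSide : Bool → Role → Bool
onSide h en = h
onSide h ex = h
onSide h th = not h

-- The turns of the loop, and why it turns both ways.

module Turns {S : TriangulatedSurface} (ζ : EssentialLoop S) where
  open TriangulatedSurface S
  open EssentialLoop ζ
  open Loop ζ

  edge : Fin #crossings → Role → Fin 3
  edge k en = entry k
  edge k ex = exit k
  edge k th = third k

  cell : Fin #crossings → Role → Cell #crossings
  cell k r = k , edge k r

  -- Whether the third side is to the left of ζ.
  opaque
    hand : Fin #crossings → Bool
    hand k = does (exit k Fin.≟ next (entry k))

  data Turn (k : Fin #crossings) : Bool → Set where
    left-third  : exit k ≡ next (entry k) → third k ≡ next (next (entry k)) → Turn k true
    right-third : third k ≡ next (entry k) → exit k ≡ next (next (entry k)) → Turn k false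

  opaque
    unfolding hand

    turn-view : ∀ k → Turn k (hand k)
    turn-view k with exit k Fin.≟ next (entry k) | left-third {k} | right-third {k}
    ... | yes p | l | _ = l p (cong next p)
    ... | no ¬p | _ | r with ≢⇒next (entry k) (exit k) (entry≢exit k ∘ sym)
    ...   | inj₁ p = contradiction p ¬p
    ...   | inj₂ p = r refl p

  next-edge : ∀ k r → next (edge k r) ≡ edge k (nextR (hand k) r)
  next-edge k r with hand k | turn-view k
  next-edge k en | _ | left-third x t  = sym x
  next-edge k ex | _ | left-third x t  = trans (cong next x) (sym t)
  next-edge k th | _ | left-third x t  = trans (cong next t) (next³ (entry k))
  next-edge k en | _ | right-third t x = sym t
  next-edge k ex | _ | right-third t x = trans (cong next x) (next³ (entry k))
  next-edge k th | _ | right-third t x = trans (cong next t) (sym x)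

  nextR² : ∀ h r → nextR h (nextR h r) ≡ prevR h r
  nextR² true  en = refl
  nextR² true  ex = refl
  nextR² true  th = refl
  nextR² false en = refl
  nextR² false ex = refl
  nextR² false th = refl

  prev-edge : ∀ k r → prev (edge k r) ≡ edge k (prevR (hand k) r)
  prev-edge k r = trans (prev≡next² (edge k r)) (trans (cong next (next-edge k r))
    (trans (next-edge k (nextR (hand k) r)) (cong (edge k) (nextR² (hand k) r))))

  third≢entry : ∀ k → third k ≢ entry k
  third≢entry k eq with hand k | turn-view k
  ... | _ | left-third x t  = next²≢ (entry k) (trans (sym t) eq)
  ... | _ | right-third t x = next≢ (entry k) (trans (sym t) eq)

  third≢exit : ∀ k → third k ≢ exit k
  third≢exit k eq with hand k | turn-view k
  ... | _ | left-third x t  = next≢ (next (entry k)) (trans (sym t) (trans eq x))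
  ... | _ | right-third t x = next≢ (next (entry k)) (sym (trans (sym t) (trans eq x)))

  edge-injective : ∀ k {r r′} → edge k r ≡ edge k r′ → r ≡ r′
  edge-injective k {en} {en} eq = refl
  edge-injective k {en} {ex} eq = contradiction eq (entry≢exit k)
  edge-injective k {en} {th} eq = contradiction (sym eq) (third≢entry k)
  edge-injective k {ex} {en} eq = contradiction (sym eq) (entry≢exit k)
  edge-injective k {ex} {ex} eq = refl
  edge-injective k {ex} {th} eq = contradiction (sym eq) (third≢exit k)
  edge-injective k {th} {en} eq = contradiction eq (third≢entry k)
  edge-injective k {th} {ex} eq = contradiction eq (third≢exit k)
  edge-injective k {th} {th} eq = refl

  edge-surjective : ∀ k u → ∃[ r ] u ≡ edge k r
  edge-surjective k u with u Fin.≟ entry k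
  ... | yes p = en , p
  ... | no ¬p with ≢⇒next (entry k) u ¬p
  ...   | inj₁ p = nextR (hand k) en , trans p (next-edge k en)
  ...   | inj₂ p = nextR (hand k) (nextR (hand k) en) ,
    trans p (trans (cong next (next-edge k en)) (next-edge k (nextR (hand k) en)))

  opaque
    unfolding hand

    onLeft-cell : ∀ k r → onLeft (cell k r) ≡ onSide (hand k) r
    onLeft-cell k en with entry k Fin.≟ entry k
    ... | yes _  = refl
    ... | no  ¬p = contradiction refl ¬p
    onLeft-cell k ex with exit k Fin.≟ entry k
    ... | yes p = contradiction (sym p) (entry≢exit k)
    ... | no  _ = refl
    onLeft-cell k th with third k Fin.≟ entry k
    ... | yes p = contradiction p (third≢entry k)
    ... | no  _ with hand k | turn-view k
    ...   | _ | left-third x t  = dec-false (third k Fin.≟ _) (λ q → next≢ (next (entry k)) (trans (sym t) q))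
    ...   | _ | right-third t x = dec-true (third k Fin.≟ _) t

  -- The role is that of the side crossed by the rotation, not that of the angle.
  clockwise-step : Fin #crossings → Role → Maybe (Cell #crossings)
  clockwise-step k en = just (cell (prev k) (prevR (hand (prev k)) ex))
  clockwise-step k ex = just (cell (next k) (prevR (hand (next k)) en))
  clockwise-step k th = nothing

  clockwise-cell : ∀ k r → clockwise (cell k r) ≡ clockwise-step k (prevR (hand k) r)
  clockwise-cell k r with prevR (hand k) r | prev-edge k r
  ... | en | eq with prev (edge k r) Fin.≟ entry k | prev (edge k r) Fin.≟ exit k
  ...   | yes _ | _ = cong (λ s → just (prev k , s)) (prev-edge (prev k) ex)
  ...   | no ¬p | _ = contradiction eq ¬p
  clockwise-cell k r | ex | eq with prev (edge k r) Fin.≟ entry k | prev (edge k r) Fin.≟ exit k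
  ...   | yes p | _     = contradiction (trans (sym p) eq) (entry≢exit k)
  ...   | no _  | yes _ = cong (λ s → just (next k , s)) (prev-edge (next k) en)
  ...   | no _  | no ¬p = contradiction eq ¬p
  clockwise-cell k r | th | eq with prev (edge k r) Fin.≟ entry k | prev (edge k r) Fin.≟ exit k
  ...   | yes p | _     = contradiction (trans (sym eq) p) (third≢entry k)
  ...   | no _  | yes p = contradiction (trans (sym eq) p) (third≢exit k)
  ...   | no _  | no _  = refl

  max⇒ : ∀ k r → MaxCondition (cell k r) → nextR (hand k) r ≡ th
  max⇒ k r with nextR (hand k) r | next-edge k r
  ... | th | _ = λ _ → refl
  ... | en | eq with next (edge k r) Fin.≟ entry k | next (edge k r) Fin.≟ exit k
  ...   | yes _ | _ = λ ()
  ...   | no ¬p | _ = contradiction eq ¬p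
  max⇒ k r | ex | eq with next (edge k r) Fin.≟ entry k | next (edge k r) Fin.≟ exit k
  ...   | yes _ | _     = λ ()
  ...   | no _  | yes _ = λ ()
  ...   | no _  | no ¬p = contradiction eq ¬p

  ⇒max : ∀ k r → nextR (hand k) r ≡ th → MaxCondition (cell k r)
  ⇒max k r eq with nextR (hand k) r | next-edge k r
  ⇒max k r refl | th | eq with next (edge k r) Fin.≟ entry k | next (edge k r) Fin.≟ exit k
  ...   | yes p | _     = contradiction (trans (sym eq) p) (third≢entry k)
  ...   | no _  | yes p = contradiction (trans (sym eq) p) (third≢exit k)
  ...   | no _  | no _  = refl

  min⇒ : ∀ k r → MinCondition (cell k r) → prevR (hand k) r ≡ th
  min⇒ k r eq with prevR (hand k) r | clockwise-cell k r
  ... | en | p with () ← trans (sym eq) p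
  ... | ex | p with () ← trans (sym eq) p
  ... | th | p = refl

  ⇒min : ∀ k r → prevR (hand k) r ≡ th → MinCondition (cell k r)
  ⇒min k r eq = trans (clockwise-cell k r) (cong (clockwise-step k) eq)

  sideAt-flank : ∀ s x → flank s ≡ x → sideAt x ≡ s
  sideAt-flank s x eq = Inverse.inverseʳ gluing (sym eq)

  previous : ∀ k → sideAt (inj₁ (arc k , not (dir k))) ≡ (triangle (prev k) , exit (prev k))
  previous k = sideAt-flank _ _ (subst
    (λ l → flank (triangle (prev k) , exit (prev k)) ≡ inj₁ (arc l , not (dir l)))
    (next-prev k) (exits (prev k)))

  following : ∀ k → sideAt (inj₁ (arc (next k) , not (not (dir (next k)))))
                  ≡ (triangle (next k) , entry (next k))
  following k rewrite not-involutive (dir (next k)) = sideAt-flank _ _ (enters (next k))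

  -- If ζ always turned to the same side, then it would run around a single vertex,
  -- which would be a puncture.
  pivot-not-on-boundary : ∀ h → (∀ k → hand k ≡ h) →
                          ∀ {t u} → OnBoundary t u → ∀ k → t ≡ triangle k → u ≡ third k → ⊥
  pivot-not-on-boundary h hand≡h = go h (λ k r → trans (next-edge k r) (cong (λ h → edge k (nextR h r)) (hand≡h k)))
    where
    go : ∀ h → (∀ k r → next (edge k r) ≡ edge k (nextR h r)) →
         ∀ {t u} → OnBoundary t u → ∀ k → t ≡ triangle k → u ≡ third k → ⊥
    go true ne (stop eq) k refl refl
      with () ← trans (sym eq) (trans (cong (λ s → flank (triangle k , s)) (ne k th)) (enters k))
    go true ne (turn eq eq′ o) k refl refl
      with refl ← trans (sym eq) (trans (cong (λ s → flank (triangle k , s)) (ne k th)) (enters k))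
      with refl ← trans (sym (previous k)) eq′ = go true ne o (prev k) refl (ne (prev k) ex)
    go false ne (stop eq) k refl refl
      with () ← trans (sym eq) (trans (cong (λ s → flank (triangle k , s)) (ne k th)) (exits k))
    go false ne (turn eq eq′ o) k refl refl
      with refl ← trans (sym eq) (trans (cong (λ s → flank (triangle k , s)) (ne k th)) (exits k))
      with refl ← trans (sym (following k)) eq′ = go false ne o (next k) refl (ne (next k) en)

  -- This is where `no-punctures` enters: if `b` never occurred, all hands would be `not b` and the
  -- loop would circle the vertex opposite the third side of any of its triangles.
  hands-vary : ∀ b → ∃[ k ] hand k ≡ b
  hands-vary b with Fin.any? (λ k → hand k Bool.≟ b)
  ... | yes p = p
  ... | no ¬p = ⊥-elim (pivot-not-on-boundary (not b) (λ k → ¬-not (λ eq → ¬p (k , eq)))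
    (no-punctures (triangle zero) (third zero)) zero refl refl)

-- Counting on finite sets.

-- A missed value could be punched out, which would inject `Fin (suc n)` into `Fin n`.
injective⇒surjective : ∀ {n} (f : Fin n → Fin n) → (∀ {i j} → f i ≡ f j → i ≡ j) → ∀ y → ∃[ x ] f x ≡ y
injective⇒surjective {suc n} f inj y with Fin.any? (λ x → f x Fin.≟ y)
... | yes p = p
... | no ¬p = contradiction (Fin.injective⇒≤ {f = λ x → punchOut {i = y} {j = f x} (λ eq → ¬p (x , sym eq))}
    (λ eq → inj (Fin.punchOut-injective (λ eq → ¬p (_ , sym eq)) (λ eq → ¬p (_ , sym eq)) eq))) ℕ.1+n≰n

-- A section of `f` is injective, hence surjective, so every argument is a value of the section, and
-- `f` separates those.
surjective⇒injective : ∀ {n} (f : Fin n → Fin n) → (∀ y → ∃[ x ] f x ≡ y) → ∀ {i j} → f i ≡ f j → i ≡ j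
surjective⇒injective f surj {i} {j} eq with injective⇒surjective section section-injective i
                                          | injective⇒surjective section section-injective j
  where
  section = λ y → proj₁ (surj y)
  section-injective : ∀ {y y′} → section y ≡ section y′ → y ≡ y′
  section-injective {y} {y′} eq = trans (sym (proj₂ (surj y))) (trans (cong f eq) (proj₂ (surj y′)))
... | y , refl | y′ , refl = cong (proj₁ ∘ surj) (trans (sym (proj₂ (surj y))) (trans eq (proj₂ (surj y′))))

-- Tables relating hands, roles and end points.

-- The role of the one angle of a triangle whose clockwise side is the third side, a boundary
-- segment of the annulus.
minRole : Bool → Role
minRole true  = en
minRole false = ex

prevR-th : ∀ h r → prevR h r ≡ th → r ≡ minRole h
prevR-th true  en eq = refl
prevR-th false ex eq = refl

prevR-minRole : ∀ h → prevR h (minRole h) ≡ th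
prevR-minRole true  = refl
prevR-minRole false = refl

prevR-en : ∀ h r → prevR h r ≡ en → r ≡ top true h
prevR-en true  ex eq = refl
prevR-en false th eq = refl

prevR-top : ∀ h → prevR h (top true h) ≡ en
prevR-top true  = refl
prevR-top false = refl

prevR-ex : ∀ h r → prevR h r ≡ ex → r ≡ bot false h
prevR-ex true  th eq = refl
prevR-ex false en eq = refl

prevR-bot : ∀ h → prevR h (bot false h) ≡ ex
prevR-bot true  = refl
prevR-bot false = refl

bot-prevR : ∀ h → prevR h ex ≡ bot true h
bot-prevR true  = refl
bot-prevR false = refl

top-prevR : ∀ h → prevR h en ≡ top false h
top-prevR true  = refl
top-prevR false = refl

bot-refl : ∀ h → bot h h ≡ en
bot-refl true  = refl
bot-refl false = refl

top-refl : ∀ h → top h h ≡ ex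
top-refl true  = refl
top-refl false = refl

bot-not : ∀ h → bot (not h) h ≡ th
bot-not true  = refl
bot-not false = refl

top-not : ∀ h → top (not h) h ≡ th
top-not true  = refl
top-not false = refl

top-≢ : ∀ h → top h (not h) ≡ th
top-≢ true  = refl
top-≢ false = refl

bot≢ex : ∀ b h → bot b h ≢ ex
bot≢ex true  true  ()
bot≢ex true  false ()
bot≢ex false true  ()
bot≢ex false false ()

top≢en : ∀ b h → top b h ≢ en
top≢en true  true  ()
top≢en true  false ()
top≢en false true  ()
top≢en false false ()

-- Either the end point b of the diagonal below a triangle has its angle of the matching
-- in this triangle, or the vertex is also an end point of the diagonal above.
lower-cases : ∀ h r b → lower h r ≡ b → top b h ≡ r ⊎ (h ≡ not b × upper h r ≡ b)
lower-cases true  en _ refl = inj₂ (refl , refl)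
lower-cases false en _ refl = inj₂ (refl , refl)
lower-cases true  ex _ refl = inj₁ refl
lower-cases false ex _ refl = inj₁ refl
lower-cases true  th _ refl = inj₁ refl
lower-cases false th _ refl = inj₁ refl

upper-cases : ∀ h r b → upper h r ≡ not b → bot b h ≡ r ⊎ (h ≡ not b × lower h r ≡ not b)
upper-cases true  en true  eq = inj₁ refl
upper-cases false en false eq = inj₁ refl
upper-cases true  ex false eq = inj₂ (refl , refl)
upper-cases false ex true  eq = inj₂ (refl , refl)
upper-cases true  th false eq = inj₁ refl
upper-cases false th true  eq = inj₁ refl

-- The vertex between the two third sides has only two angles, those named in the hypotheses, which
-- say that exactly one of them is chosen.
link-same : ∀ h r r′ → r ≡ en ⊎ r′ ≡ ex → ¬ (r ≡ en × r′ ≡ ex) → upper h r ≡ lower h r′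
link-same h en en p q = refl
link-same h en ex p q = contradiction (refl , refl) q
link-same h en th p q = refl
link-same h ex ex p q = refl
link-same h th ex p q = refl
link-same h ex en (inj₁ ()) q
link-same h ex en (inj₂ ()) q
link-same h ex th (inj₁ ()) q
link-same h ex th (inj₂ ()) q
link-same h th en (inj₁ ()) q
link-same h th en (inj₂ ()) q
link-same h th th (inj₁ ()) q
link-same h th th (inj₂ ()) q

-- The first two excluded pairs would put two angles at one end point of the common diagonal; the
-- last two are the seeds of the bad matchings.
link-different : ∀ h r r′ → ¬ (r ≡ en × r′ ≡ th) → ¬ (r ≡ th × r′ ≡ ex) → ¬ (r ≡ ex × r′ ≡ ex) →
                 ¬ (r ≡ en × r′ ≡ en) → upper h r ≡ lower (not h) r′
link-different h en ex p q s t = refl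
link-different h ex en p q s t = sym (not-involutive h)
link-different h ex th p q s t = sym (not-involutive h)
link-different h th en p q s t = sym (not-involutive h)
link-different h th th p q s t = sym (not-involutive h)
link-different h en th p q s t = contradiction (refl , refl) p
link-different h th ex p q s t = contradiction (refl , refl) q
link-different h ex ex p q s t = contradiction (refl , refl) s
link-different h en en p q s t = contradiction (refl , refl) t

-- A matching of angles is bad iff all its angles are opposite to the entry sides, or all
-- of them are opposite to the exit sides.
badRole : Bool → Role
badRole true  = en
badRole false = ex

badRole-complete : ∀ h b r → (onSide h r ≡ b → prevR h r ≡ th) → (onSide h r ≡ not b → nextR h r ≡ th) →
                   r ≡ badRole b
badRole-complete h     true  en f g = refl
badRole-complete true  true  ex f g = case f refl of λ ()
badRole-complete false true  ex f g = case g refl of λ ()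
badRole-complete true  true  th f g = case g refl of λ ()
badRole-complete false true  th f g = case f refl of λ ()
badRole-complete true  false en f g = case g refl of λ ()
badRole-complete false false en f g = case f refl of λ ()
badRole-complete h     false ex f g = refl
badRole-complete true  false th f g = case f refl of λ ()
badRole-complete false false th f g = case g refl of λ ()

badRole-min : ∀ h b → onSide h (badRole b) ≡ b → prevR h (badRole b) ≡ th
badRole-min true  true  eq = refl
badRole-min false false eq = refl

badRole-max : ∀ h b → onSide h (badRole b) ≡ not b → nextR h (badRole b) ≡ th
badRole-max false true  eq = refl
badRole-max true  false eq = refl

-- Agreement and a constant bad role together force a constant hand, which `hands-vary` forbids.
badRole-link : ∀ h h′ b → upper h (badRole b) ≡ lower h′ (badRole b) → h ≡ h′
badRole-link h h′ true  eq = not-injective eq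
badRole-link h h′ false eq = eq

-- Codes and good matchings of angles.

module Angles {S : TriangulatedSurface} (ζ : EssentialLoop S) where
  open EssentialLoop ζ
  open Loop ζ
  open Turns ζ

  -- A matching given by one side of each triangle such that consecutive triangles agree
  -- on which end point of their common diagonal is covered from below.
  record Code (P : Subset (#crossings ℕ.* 3)) : Set where
    field
      role   : Fin #crossings → Role
      member : ∀ k → P ∋ cell k (role k)
      only   : ∀ k u → P ∋ (k , u) → u ≡ edge k (role k)
      link   : ∀ k → upper (hand k) (role k) ≡ lower (hand (next k)) (role (next k))

  cell-surjective : ∀ a → ∃[ k ] ∃[ r ] a ≡ cell k r
  cell-surjective (k , u) with edge-surjective k u
  ... | r , eq = k , r , cong (k ,_) eq

  cell-injectiveʳ : ∀ {k l r r′} → cell k r ≡ cell l r′ → r ≡ r′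
  cell-injectiveʳ {k} {l} eq with refl ← cong proj₁ eq = edge-injective k (cong proj₂ eq)

  -- Going clockwise around a vertex to the left of ζ means going backwards along ζ.
  clockwise-left : ∀ k → clockwise (cell (next k) (top true (hand (next k))))
                       ≡ just (cell k (bot true (hand k)))
  clockwise-left k = trans (clockwise-cell (next k) (top true (hand (next k))))
    (trans (cong (clockwise-step (next k)) (prevR-top (hand (next k))))
    (trans (cong (λ l → just (cell l (prevR (hand l) ex))) (prev-next k))
    (cong (just ∘ cell k) (bot-prevR (hand k)))))

  clockwise-left′ : ∀ k → clockwise (cell k (top true (hand k)))
                        ≡ just (cell (prev k) (bot true (hand (prev k))))
  clockwise-left′ k = subst
    (λ l → clockwise (cell l (top true (hand l))) ≡ just (cell (prev k) (bot true (hand (prev k)))))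
    (next-prev k) (clockwise-left (prev k))

  clockwise-right : ∀ k → clockwise (cell k (bot false (hand k)))
                        ≡ just (cell (next k) (top false (hand (next k))))
  clockwise-right k = trans (clockwise-cell k (bot false (hand k)))
    (trans (cong (clockwise-step k) (prevR-bot (hand k)))
    (cong (just ∘ cell (next k)) (top-prevR (hand (next k)))))

  clockwise-inverse : ∀ {j r k r′} → clockwise (cell j r) ≡ just (cell k r′) →
    (k ≡ prev j × r ≡ top true (hand j) × r′ ≡ bot true (hand k)) ⊎
    (k ≡ next j × r ≡ bot false (hand j) × r′ ≡ top false (hand k))
  clockwise-inverse {j} {r} eq with prevR (hand j) r | prevR-en (hand j) r | prevR-ex (hand j) r
                                  | trans (sym (clockwise-cell j r)) eq
  ... | en | f | g | eq′ with refl ← cong proj₁ (just-injective eq′) = inj₁ (refl , f refl ,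
    trans (sym (cell-injectiveʳ (just-injective eq′))) (bot-prevR (hand (prev j))))
  ... | ex | f | g | eq′ with refl ← cong proj₁ (just-injective eq′) = inj₂ (refl , g refl ,
    trans (sym (cell-injectiveʳ (just-injective eq′))) (top-prevR (hand (next j))))
  ... | th | f | g | ()

  turnClockwise : Cell #crossings → Cell #crossings
  turnClockwise a = fromMaybe a (clockwise a)

  iterate-min : ∀ {a} → MinCondition a → ∀ n → iterate turnClockwise a n ≡ a
  iterate-min m zero    = refl
  iterate-min {a} m (suc n) rewrite m = iterate-min m n

  min-mono : ∀ {a m n} → m ℕ.≤ n → MinCondition (iterate turnClockwise a m) →
             MinCondition (iterate turnClockwise a n)
  min-mono {a} {m} {n} le min with ℕ.m≤n⇒∃[o]m+o≡n le
  ... | d , refl = subst MinCondition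
    (sym (trans (iterate-+ turnClockwise a m d) (iterate-min min d))) min

  -- The rotation follows the chain until it meets a minimal angle and then stays there, so it
  -- suffices that some member of the chain is minimal.
  iterate-chain : (g : Fin #crossings → Cell #crossings) (step : Fin #crossings → Fin #crossings) →
    (∀ k → MinCondition (g k) ⊎ clockwise (g k) ≡ just (g (step k))) →
    ∀ n k → MinCondition (g (iterate step k n)) → MinCondition (iterate turnClockwise (g k) n)
  iterate-chain g step chain zero    k min = min
  iterate-chain g step chain (suc n) k min with chain k
  ... | inj₁ m = subst MinCondition (sym (iterate-min m (suc n))) m
  ... | inj₂ eq rewrite eq = iterate-chain g step chain n (step k) min

  min-left : ∀ k → hand k ≡ true → MinCondition (cell k (bot true (hand k)))
  min-left k eq = ⇒min k _ (subst (λ h → prevR h (bot true h) ≡ th) (sym eq) refl)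

  min-right : ∀ k → hand k ≡ false → MinCondition (cell k (top false (hand k)))
  min-right k eq = ⇒min k _ (subst (λ h → prevR h (top false h) ≡ th) (sym eq) refl)

  -- A triangle with its third side to the left ends the clockwise rotation about a vertex on the
  -- left, and `hands-vary` provides one.
  settles-left : ∀ k → ∃[ n ] (suc n ℕ.≤ #crossings ℕ.* 3 ×
                 MinCondition (iterate turnClockwise (cell k (bot true (hand k))) n))
  settles-left k with hands-vary true
  ... | k₀ , eq₀ with prev-path k k₀
  ...   | n , le , eq = n , le , iterate-chain (λ k → cell k (bot true (hand k))) prev chain n k
    (subst (λ l → MinCondition (cell l (bot true (hand l)))) (sym eq) (min-left k₀ eq₀))
    where
    chain : ∀ k → MinCondition (cell k (bot true (hand k)))
                ⊎ clockwise (cell k (bot true (hand k))) ≡ just (cell (prev k) (bot true (hand (prev k))))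
    chain k with hand k | clockwise-left′ k | min-left k
    ... | true  | _ | m = inj₁ (m refl)
    ... | false | c | _ = inj₂ c

  settles-right : ∀ k → ∃[ n ] (suc n ℕ.≤ #crossings ℕ.* 3 ×
                  MinCondition (iterate turnClockwise (cell k (top false (hand k))) n))
  settles-right k with hands-vary false
  ... | k₀ , eq₀ with next-path k k₀
  ...   | n , le , eq = n , le , iterate-chain (λ k → cell k (top false (hand k))) next chain n k
    (subst (λ l → MinCondition (cell l (top false (hand l)))) (sym eq) (min-right k₀ eq₀))
    where
    chain : ∀ k → MinCondition (cell k (top false (hand k)))
                ⊎ clockwise (cell k (top false (hand k))) ≡ just (cell (next k) (top false (hand (next k))))
    chain k with hand k | clockwise-right k | min-right k
    ... | false | _ | m = inj₁ (m refl)
    ... | true  | c | _ = inj₂ c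

  Settles : Cell #crossings → Set
  Settles a = ∃[ n ] (n ℕ.≤ #crossings ℕ.* 3 × MinCondition (iterate turnClockwise a n))

  settles-weaken : ∀ {a} → ∃[ n ] (suc n ℕ.≤ #crossings ℕ.* 3 × MinCondition (iterate turnClockwise a n)) →
                   Settles a
  settles-weaken (n , le , m) = n , ℕ.<⇒≤ le , m

  settles-step : ∀ {a b} → clockwise a ≡ just b →
    ∃[ n ] (suc n ℕ.≤ #crossings ℕ.* 3 × MinCondition (iterate turnClockwise b n)) → Settles a
  settles-step {a} eq (n , le , m) = suc n , le ,
    subst (λ b → MinCondition (iterate turnClockwise b n)) (sym (cong (fromMaybe a) eq)) m

  -- Four of the six combinations already lie on one of the two chains; the last two join a chain
  -- after one step, which is why the bounds for the chains are strict.
  settles : ∀ k r → Settles (cell k r)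
  settles k r with hand k | r | clockwise-left′ k | clockwise-right k | settles-left k | settles-right k
  ... | true  | en | _ | _ | s | _ = settles-weaken s
  ... | false | th | _ | _ | s | _ = settles-weaken s
  ... | true  | th | _ | _ | _ | s = settles-weaken s
  ... | false | ex | _ | _ | _ | s = settles-weaken s
  ... | true  | ex | c | _ | _ | _ = settles-step c (settles-left (prev k))
  ... | false | en | _ | c | _ | _ = settles-step c (settles-right (next k))

  vertexOf-min : ∀ a → MinCondition (vertexOf a)
  vertexOf-min a = subst (MinCondition ∘ vertexOf) (sym (proj₂ (proj₂ (cell-surjective a))))
    (min-mono (proj₁ (proj₂ s)) (proj₂ (proj₂ s)))
    where s = settles (proj₁ (cell-surjective a)) (proj₁ (proj₂ (cell-surjective a)))

  -- Read backwards from `m`: the only possible predecessor is `p`, and `p` has none.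
  two-angles : ∀ {m p} → (∀ a → clockwise a ≡ just m → a ≡ p) →
               (∀ a → clockwise a ≢ just p) → ∀ a n → iterate turnClockwise a n ≡ m → a ≡ m ⊎ a ≡ p
  two-angles one none a zero    eq = inj₁ eq
  two-angles one none a (suc n) eq with two-angles one none (turnClockwise a) n eq
  ... | q with clockwise a in c
  ...   | nothing = q
  two-angles one none a (suc n) eq | inj₁ refl | just _ = inj₂ (one a c)
  two-angles one none a (suc n) eq | inj₂ refl | just _ = contradiction c (none a)

  -- Once the minimal angle is reached a further step changes nothing, so starting one step later
  -- leads to the same angle.
  iterate-clockwise : ∀ n {a b} → clockwise a ≡ just b → MinCondition (iterate turnClockwise a n) →
                      iterate turnClockwise a n ≡ iterate turnClockwise b n
  iterate-clockwise n {a} {b} eq min = begin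
    iterate turnClockwise a n                  ≡⟨ cong (fromMaybe (iterate turnClockwise a n)) min ⟨
    turnClockwise (iterate turnClockwise a n)  ≡⟨ iterate-suc turnClockwise a n ⟨
    iterate turnClockwise (turnClockwise a) n  ≡⟨ cong (λ b → iterate turnClockwise b n) (cong (fromMaybe a) eq) ⟩
    iterate turnClockwise b n                  ∎
    where open ≡-Reasoning

  opaque
    -- An opaque copy of `vertexOf`, which keeps its long iteration from unfolding when vertices are
    -- compared.
    vertexName : Cell #crossings → Cell #crossings
    vertexName = vertexOf

    vertexName≡vertexOf : ∀ a → vertexName a ≡ vertexOf a
    vertexName≡vertexOf a = refl

    vertexName-fixed : ∀ {a} → MinCondition a → vertexName a ≡ a
    vertexName-fixed m = iterate-min m (#crossings ℕ.* 3)

    vertexName-clockwise : ∀ {a b} → clockwise a ≡ just b → vertexName a ≡ vertexName b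
    vertexName-clockwise {a} eq = iterate-clockwise (#crossings ℕ.* 3) eq (vertexOf-min a)

    vertexName-two : ∀ {m p} → (∀ a → clockwise a ≡ just m → a ≡ p) → (∀ a → clockwise a ≢ just p) →
                     ∀ a → vertexName a ≡ m → a ≡ m ⊎ a ≡ p
    vertexName-two one none a = two-angles one none a (#crossings ℕ.* 3)

  vertexOf⇒Name : ∀ {a b} → vertexOf a ≡ vertexOf b → vertexName a ≡ vertexName b
  vertexOf⇒Name eq = trans (vertexName≡vertexOf _) (trans eq (sym (vertexName≡vertexOf _)))

  vertexName⇒Of : ∀ {a b} → vertexName a ≡ vertexName b → vertexOf a ≡ vertexOf b
  vertexName⇒Of eq = trans (sym (vertexName≡vertexOf _)) (trans eq (vertexName≡vertexOf _))

  -- The end point b of the diagonal below triangle k.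
  endPoint : Fin #crossings → Bool → Cell #crossings
  endPoint k b = vertexName (cell k (top b (hand k)))

  -- At each end point of a diagonal, rotating across the diagonal exchanges the adjacent angles of
  -- the two triangles: clockwise is backwards along `ζ` on the left and forwards on the right.
  endPoint-next : ∀ k b → endPoint (next k) b ≡ vertexName (cell k (bot b (hand k)))
  endPoint-next k true  = vertexName-clockwise (clockwise-left k)
  endPoint-next k false = sym (vertexName-clockwise (clockwise-right k))

  -- With the third side on the other side of `ζ`, the entry and exit sides meet at this end point.
  endPoint-shared : ∀ k b → hand k ≡ not b → endPoint (next k) b ≡ endPoint k b
  endPoint-shared k b eq = trans (endPoint-next k b) (cong (vertexName ∘ cell k) (bot≡top b (hand k) eq))
    where
    bot≡top : ∀ b h → h ≡ not b → bot b h ≡ top b h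
    bot≡top true  _ refl = refl
    bot≡top false _ refl = refl

  vertexName-endPoint : ∀ a → ∃[ k ] ∃[ b ] vertexName a ≡ endPoint k b
  vertexName-endPoint a with cell-surjective a
  ... | k , en , refl = next k , hand k ,
    sym (trans (endPoint-next k (hand k)) (cong (vertexName ∘ cell k) (bot-refl (hand k))))
  ... | k , ex , refl = k , hand k , cong (vertexName ∘ cell k) (sym (top-refl (hand k)))
  ... | k , th , refl = k , not (hand k) , cong (vertexName ∘ cell k) (sym (top-not (hand k)))

  module _ {A : Subset (#crossings ℕ.* 3)} (code : Code A) where
    open Code code

    private
      angleAt : Fin #crossings → Cell #crossings
      angleAt k = vertexName (cell k (role k))

    -- Climb the fan of triangles at the vertex: as long as the angle is not found, the vertex is
    -- also an end point of the next diagonal and the hypothesis carries over. A triangle of hand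
    -- `b` ends the fan, and `n` counts the steps to one.
    search-up : ∀ n k b → hand (iterate next k n) ≡ b → lower (hand k) (role k) ≡ b →
                ∃[ j ] angleAt j ≡ endPoint k b
    search-up n k b eqₙ eq with lower-cases (hand k) (role k) b eq
    search-up n       k b eqₙ eq | inj₁ t = k , cong (vertexName ∘ cell k) (sym t)
    search-up zero    k b eqₙ eq | inj₂ (eq′ , _) = contradiction (trans (sym eqₙ) eq′) (not-¬ refl)
    search-up (suc n) k b eqₙ eq | inj₂ (eq′ , u)
      with search-up n (next k) b eqₙ (trans (sym (link k)) u)
    ... | j , e = j , trans e (endPoint-shared k b eq′)

    search-down : ∀ n k b → hand (iterate prev k n) ≡ b → upper (hand k) (role k) ≡ not b →
                  ∃[ j ] angleAt j ≡ endPoint (next k) b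
    search-down n k b eqₙ eq with upper-cases (hand k) (role k) b eq
    search-down n       k b eqₙ eq | inj₁ t =
      k , trans (cong (vertexName ∘ cell k) (sym t)) (sym (endPoint-next k b))
    search-down zero    k b eqₙ eq | inj₂ (eq′ , _) = contradiction (trans (sym eqₙ) eq′) (not-¬ refl)
    search-down (suc n) k b eqₙ eq | inj₂ (eq′ , l)
      with search-down n (prev k) b eqₙ (trans (link (prev k))
             (trans (cong (λ k → lower (hand k) (role k)) (next-prev k)) l))
    ... | j , e = j , trans e (trans (cong (λ k → endPoint k b) (next-prev k)) (sym (endPoint-shared k b eq′)))

    -- The value of `lower` at a diagonal tells on which side of it the angle at an end point is to
    -- be sought.
    search : ∀ a → ∃[ j ] angleAt j ≡ vertexName a
    search a with vertexName-endPoint a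
    ... | k , b , eq with lower (hand k) (role k) Bool.≟ b | hands-vary b
    ...   | yes p | k₀ , eq₀ with next-path k k₀
    ...     | n , _ , path with search-up n k b (trans (cong hand path) eq₀) p
    ...       | j , e = j , trans e (sym eq)
    search a | k , b , eq | no ¬p | k₀ , eq₀ with prev-path (prev k) k₀
    ...     | n , _ , path with search-down n (prev k) b (trans (cong hand path) eq₀)
                (trans (link (prev k)) (trans (cong (λ k → lower (hand k) (role k)) (next-prev k)) (¬-not ¬p)))
    ...       | j , e = j , trans e (trans (cong (λ k → endPoint k b) (next-prev k)) (sym eq))

    -- There are as many vertices as triangles, since each triangle has exactly one angle
    -- that is the first one around its vertex.
    angleAt-injective : ∀ {j k} → angleAt j ≡ angleAt k → j ≡ k
    angleAt-injective eq = surjective⇒injective (proj₁ ∘ angleAt) surj (cong proj₁ eq)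
      where
      surj : ∀ k → ∃[ j ] proj₁ (angleAt j) ≡ k
      surj k with search (cell k (minRole (hand k)))
      ... | j , eq = j , cong proj₁ (trans eq (vertexName-fixed (⇒min k _ (prevR-minRole (hand k)))))

    code⇒angleMatching : AngleMatching A
    code⇒angleMatching = (λ k → edge k (role k) , member k , λ {u} → sym ∘ only k u) , unique
      where
      unique : ∀ a → ∃! _≡_ λ b → A ∋ b × vertexOf b ≡ vertexOf a
      unique a with search a
      ... | j , eq = cell j (role j) , (member j , vertexName⇒Of eq) , same
        where
        same : ∀ {b} → A ∋ b × vertexOf b ≡ vertexOf a → cell j (role j) ≡ b
        same {k , u} (p , eq′) with only k u p
        ... | refl = cong (λ k → cell k (role k)) (angleAt-injective (trans eq (sym (vertexOf⇒Name eq′))))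

    -- In a bad matching all roles are `badRole b`, and agreement then makes the hand constant along
    -- `ζ`.
    code⇒¬bad : ¬ Bad A
    code⇒¬bad (b , bad) with hands-vary true | hands-vary false
    ... | k , eq | k′ , eq′ = contradiction (trans (sym eq)
        (trans (sym (next-induction (λ l → hand l ≡ hand k) (λ l p → trans (sym (constant l)) p) k refl k′)) eq′))
        λ ()
      where
      bad-role : ∀ k → role k ≡ badRole b
      bad-role k with bad (cell k (role k)) (member k)
      ... | f , g = badRole-complete (hand k) b (role k)
        (λ eq → min⇒ k (role k) (f (trans (onLeft-cell k (role k)) eq)))
        (λ eq → max⇒ k (role k) (g (trans (onLeft-cell k (role k)) eq)))
      constant : ∀ l → hand l ≡ hand (next l)
      constant l = badRole-link (hand l) (hand (next l)) b
        (subst₂ (λ r r′ → upper (hand l) r ≡ lower (hand (next l)) r′) (bad-role l) (bad-role (next l)) (link l))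

    code⇒goodAngleMatching : GoodAngleMatching A
    code⇒goodAngleMatching = code⇒angleMatching , code⇒¬bad

  -- Both third sides lie on side `h`, so the vertex between them meets only the common diagonal and
  -- has one angle on each side of it.
  two-angles-vertex : ∀ k h → hand k ≡ h → hand (next k) ≡ h → ∀ a → vertexName a ≡ endPoint (next k) h →
                      a ≡ cell k en ⊎ a ≡ cell (next k) ex
  two-angles-vertex k true eq eq′ a v = vertexName-two {cell k en} {cell (next k) ex}
      one none a
      (trans v (trans (endPoint-next k true)
        (trans (cong (λ h → vertexName (cell k (bot true h))) eq) (vertexName-fixed min))))
    where
    min : MinCondition (cell k en)
    min = ⇒min k en (cong (λ h → prevR h en) eq)
    one : ∀ a → clockwise a ≡ just (cell k en) → a ≡ cell (next k) ex
    one a c with cell-surjective a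
    ... | j , r , refl with clockwise-inverse {j} {r} {k} {en} c
    ...   | inj₁ (refl , refl , _) = cong₂ cell (sym (next-prev j))
              (cong (top true) (trans (cong hand (sym (next-prev j))) eq′))
    ...   | inj₂ (_ , _ , e) = contradiction (sym e) (top≢en false (hand k))
    none : ∀ a → clockwise a ≢ just (cell (next k) ex)
    none a c with cell-surjective a
    ... | j , r , refl with clockwise-inverse {j} {r} {next k} {ex} c
    ...   | inj₁ (_ , _ , e) = contradiction (sym e) (bot≢ex true (hand (next k)))
    ...   | inj₂ (_ , _ , e) = case trans e (cong (top false) eq′) of λ ()
  two-angles-vertex k false eq eq′ a v = Sum.swap (vertexName-two {cell (next k) ex} {cell k en}
      one none a
      (trans v (trans (cong (λ h → vertexName (cell (next k) (top false h))) eq′) (vertexName-fixed min))))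
    where
    min : MinCondition (cell (next k) ex)
    min = ⇒min (next k) ex (cong (λ h → prevR h ex) eq′)
    one : ∀ a → clockwise a ≡ just (cell (next k) ex) → a ≡ cell k en
    one a c with cell-surjective a
    ... | j , r , refl with clockwise-inverse {j} {r} {next k} {ex} c
    ...   | inj₁ (_ , _ , e) = contradiction (sym e) (bot≢ex true (hand (next k)))
    ...   | inj₂ (e , refl , _) with trans (sym (prev-next k)) (trans (cong prev e) (prev-next j))
    ...     | refl = cong (cell j) (cong (bot false) eq)
    none : ∀ a → clockwise a ≢ just (cell k en)
    none a c with cell-surjective a
    ... | j , r , refl with clockwise-inverse {j} {r} {k} {en} c
    ...   | inj₁ (_ , _ , e) = case trans e (cong (bot true) eq) of λ ()
    ...   | inj₂ (_ , _ , e) = contradiction (sym e) (top≢en false (hand k))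

  module _ {A : Subset (#crossings ℕ.* 3)} (matching : AngleMatching A) where

    private
      chosen : Fin #crossings → Role
      chosen k = proj₁ (edge-surjective k (proj₁ (proj₁ matching k)))

      chosen-edge : ∀ k → proj₁ (proj₁ matching k) ≡ edge k (chosen k)
      chosen-edge k = proj₂ (edge-surjective k (proj₁ (proj₁ matching k)))

      chosen-member : ∀ k → A ∋ cell k (chosen k)
      chosen-member k = subst (λ u → A ∋ (k , u)) (chosen-edge k) (proj₁ (proj₂ (proj₁ matching k)))

      chosen-only : ∀ k u → A ∋ (k , u) → u ≡ edge k (chosen k)
      chosen-only k u p = trans (sym (proj₂ (proj₂ (proj₁ matching k)) p)) (chosen-edge k)

      chosenAngle : Fin #crossings → Cell #crossings
      chosenAngle k = vertexName (cell k (chosen k))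

      chosenAngle-injective : ∀ {j k} → chosenAngle j ≡ chosenAngle k → j ≡ k
      chosenAngle-injective {j} {k} eq with proj₂ matching (cell k (chosen k))
      ... | _ , _ , u = cong proj₁ (trans (sym (u (chosen-member j , vertexName⇒Of eq))) (u (chosen-member k , refl)))

      role-unique : ∀ {j k r r′} → chosen j ≡ r → chosen k ≡ r′ →
                    vertexName (cell j r) ≡ vertexName (cell k r′) → r ≡ r′
      role-unique refl refl eq = cong chosen (chosenAngle-injective eq)

      -- The vertex between the two triangles has only two angles.
      same-hands : ∀ k h → hand k ≡ h → hand (next k) ≡ h → chosen k ≡ en ⊎ chosen (next k) ≡ ex
      same-hands k h eq eq′ with proj₂ matching (cell (next k) (top h (hand (next k))))
      ... | (j , u) , (p , v) , _ with chosen-only j u p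
      ...   | refl with two-angles-vertex k h eq eq′ (cell j (chosen j)) (vertexOf⇒Name v)
      ...     | inj₁ e with refl ← cong proj₁ e = inj₁ (cell-injectiveʳ e)
      ...     | inj₂ e with refl ← cong proj₁ e = inj₂ (cell-injectiveʳ e)

      -- The pattern that spreads around the annulus into a bad matching: backwards along `ζ` for
      -- `ex`, forwards for `en`.
      Both : Role → Fin #crossings → Set
      Both r k = ∀ b → ∃[ j ] (chosenAngle j ≡ endPoint k b × chosen j ≡ r)

      -- The end points of the diagonal above are taken by other angles, so triangle `k` is left
      -- with its angle opposite the exit side. This angle takes one end point of the diagonal
      -- below; the other one is shared with the diagonal above.
      both-ex : ∀ k → Both ex (next k) → chosen k ≡ ex × Both ex k
      both-ex k both = c , λ b → case b Bool.≟ hand k of λ where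
          (yes refl) → k , cong (vertexName ∘ cell k) (trans c (sym (top-refl (hand k)))) , c
          (no b≢h) → let j , e , c′ = both b in
            j , trans e (endPoint-shared k b (¬-not (b≢h ∘ sym))) , c′
        where
        ≢bot : ∀ b → chosen k ≢ bot b (hand k)
        ≢bot b eq with both b
        ... | j , e , c = bot≢ex b (hand k) (role-unique eq c
          (trans (sym (endPoint-next k b)) (trans (sym e) (cong (vertexName ∘ cell j) c))))
        c : chosen k ≡ ex
        c with chosen k in eq
        ... | ex = refl
        ... | en = contradiction (trans eq (sym (bot-refl (hand k)))) (≢bot (hand k))
        ... | th = contradiction (trans eq (sym (bot-not (hand k)))) (≢bot (not (hand k)))

      both-en : ∀ k → Both en k → chosen k ≡ en × Both en (next k)
      both-en k both = c , λ b → case b Bool.≟ hand k of λ where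
          (yes refl) → k , trans (cong (vertexName ∘ cell k) (trans c (sym (bot-refl (hand k)))))
            (sym (endPoint-next k b)) , c
          (no b≢h) → let j , e , c′ = both b in
            j , trans e (sym (endPoint-shared k b (¬-not (b≢h ∘ sym)))) , c′
        where
        ≢top : ∀ b → chosen k ≢ top b (hand k)
        ≢top b eq with both b
        ... | j , e , c = top≢en b (hand k) (role-unique eq c
          (trans (sym e) (cong (vertexName ∘ cell j) c)))
        c : chosen k ≡ en
        c with chosen k in eq
        ... | en = refl
        ... | ex = contradiction (trans eq (sym (top-refl (hand k)))) (≢top (hand k))
        ... | th = contradiction (trans eq (sym (top-not (hand k)))) (≢top (not (hand k)))

      bad : ∀ b → (∀ k → chosen k ≡ badRole b) → Bad A
      bad b all = b , λ (k , u) p → subst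
        (λ u → (onLeft (k , u) ≡ b → MinCondition (k , u)) × (onLeft (k , u) ≡ not b → MaxCondition (k , u)))
        (sym (trans (chosen-only k u p) (cong (edge k) (all k))))
        ((λ eq → ⇒min k _ (badRole-min (hand k) b (trans (sym (onLeft-cell k (badRole b))) eq))) ,
         (λ eq → ⇒max k _ (badRole-max (hand k) b (trans (sym (onLeft-cell k (badRole b))) eq))))

      bad-ex : ∀ k → Both ex k → Bad A
      bad-ex k both = bad false λ l → proj₁ (both-ex l
        (prev-induction (Both ex) (λ i → proj₂ ∘ both-ex i) k both (next l)))

      bad-en : ∀ k → Both en k → Bad A
      bad-en k both = bad true λ l → proj₁ (both-en l
        (next-induction (Both en) (λ i → proj₂ ∘ both-en i) k both l))

      angle-bot : ∀ k b r → bot b (hand k) ≡ r → vertexName (cell k r) ≡ endPoint (next k) b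
      angle-bot k b r refl = sym (endPoint-next k b)

      angle-top : ∀ k b r → top b (hand k) ≡ r → vertexName (cell k r) ≡ endPoint k b
      angle-top k b r refl = refl

      clash : ∀ k b {r r′} → chosen k ≡ r → chosen (next k) ≡ r′ →
              bot b (hand k) ≡ r → top b (hand (next k)) ≡ r′ → r ≡ r′
      clash k b {r} {r′} c c′ eq eq′ =
        role-unique c c′ (trans (angle-bot k b r eq) (sym (angle-top (next k) b r′ eq′)))

      at-bot : ∀ k b {r} → chosen k ≡ r → bot b (hand k) ≡ r → chosenAngle k ≡ endPoint (next k) b
      at-bot k b refl eq = angle-bot k b _ eq

      at-top : ∀ k b {r} → chosen k ≡ r → top b (hand k) ≡ r → chosenAngle k ≡ endPoint k b
      at-top k b refl eq = angle-top k b _ eq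

      -- As the hands differ, the two angles sit on opposite sides of `ζ`. The second is at an end
      -- point of the common diagonal that is also an end point of the diagonal below `k`.
      different-hands-ex : ∀ k → hand (next k) ≡ not (hand k) → chosen k ≡ ex → chosen (next k) ≡ ex → Both ex k
      different-hands-ex k eq c c′ b with b Bool.≟ hand k
      ... | yes refl = k , at-top k b c (top-refl b) , c
      ... | no b≢h with refl ← ¬-not b≢h = next k ,
        trans (at-top (next k) b c′ (trans (cong (top b) eq) (top-refl b)))
              (endPoint-shared k b (sym (not-involutive (hand k)))) , c′

      different-hands-en : ∀ k → hand (next k) ≡ not (hand k) → chosen k ≡ en → chosen (next k) ≡ en →
                           Both en (next (next k))
      different-hands-en k eq c c′ b with b Bool.≟ hand k
      ... | yes refl = k , trans (at-bot k b c (bot-refl b)) (sym (endPoint-shared (next k) b eq)) , c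
      ... | no b≢h with refl ← ¬-not b≢h = next k , at-bot (next k) b c′ (trans (cong (bot b) eq) (bot-refl b)) , c′

      chosen-link : ¬ Bad A → ∀ k → upper (hand k) (chosen k) ≡ lower (hand (next k)) (chosen (next k))
      chosen-link ¬bad k with hand (next k) Bool.≟ hand k
      ... | yes eq = trans (link-same (hand k) (chosen k) (chosen (next k)) (same-hands k (hand k) refl eq)
            λ (c , c′) → case clash k (hand k) c c′ (bot-refl (hand k))
              (trans (cong (top (hand k)) eq) (top-refl (hand k))) of λ ())
          (cong (λ h → lower h (chosen (next k))) (sym eq))
      ... | no neq = trans (link-different (hand k) (chosen k) (chosen (next k))
            (λ (c , c′) → case clash k (hand k) c c′ (bot-refl (hand k))
              (trans (cong (top (hand k)) eq) (top-≢ (hand k))) of λ ())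
            (λ (c , c′) → case clash k (not (hand k)) c c′ (bot-not (hand k))
              (trans (cong (top (not (hand k))) eq) (top-refl (not (hand k)))) of λ ())
            (λ (c , c′) → ¬bad (bad-ex k (different-hands-ex k eq c c′)))
            (λ (c , c′) → ¬bad (bad-en (next (next k)) (different-hands-en k eq c c′))))
          (cong (λ h → lower h (chosen (next k))) (sym eq))
        where
        eq : hand (next k) ≡ not (hand k)
        eq = ¬-not neq

    goodAngleMatching⇒code : ¬ Bad A → Code A
    goodAngleMatching⇒code ¬bad = record
      { role = chosen ; member = chosen-member ; only = chosen-only ; link = chosen-link ¬bad }

-- Incidence in the snake graph.

-- This is `not (lower h r)`, written without the double negation at `en` and `th`.
foot : Bool → Role → Bool
foot h en = h
foot h ex = not h
foot h th = h

lower≡not-foot : ∀ h r → lower h r ≡ not (foot h r)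
lower≡not-foot h en = refl
lower≡not-foot h ex = sym (not-involutive h)
lower≡not-foot h th = refl

foot≡⇒lower≡not : ∀ h r {b} → foot h r ≡ b → lower h r ≡ not b
foot≡⇒lower≡not h r refl = lower≡not-foot h r

lower≡not⇒foot≡ : ∀ h r {b} → lower h r ≡ not b → foot h r ≡ b
lower≡not⇒foot≡ h r eq = not-injective (trans (sym (lower≡not-foot h r)) eq)

upper≡foot : ∀ h r {b} → upper h r ≡ b → foot h r ≡ b → h ≡ b
upper≡foot h en u f = f
upper≡foot h ex u f = u
upper≡foot h th u f = u

upper≡hand : ∀ h r → r ≢ ex → upper h r ≡ h → r ≡ th
upper≡hand h en ne u = contradiction (sym u) (not-¬ refl)
upper≡hand h ex ne u = contradiction refl ne
upper≡hand h th ne u = refl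

foot≡hand : ∀ h r → r ≢ en → foot h r ≡ h → r ≡ th
foot≡hand h en ne f = contradiction refl ne
foot≡hand h ex ne f = contradiction (sym f) (not-¬ refl)
foot≡hand h th ne f = refl

upper≡not⇒en : ∀ h r → upper h r ≡ not h → r ≡ en
upper≡not⇒en h en u = refl
upper≡not⇒en h ex u = contradiction u (not-¬ refl)
upper≡not⇒en h th u = contradiction u (not-¬ refl)

lower≡hand⇒ex : ∀ h r → lower h r ≡ h → r ≡ ex
lower≡hand⇒ex h en l = contradiction (sym l) (not-¬ refl)
lower≡hand⇒ex h ex l = refl
lower≡hand⇒ex h th l = contradiction (sym l) (not-¬ refl)

fromℕ≡zero : ∀ {n} → fromℕ n ≡ zero → (k : Fin (suc n)) → k ≡ zero
fromℕ≡zero {zero} _ zero = refl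

module Snake {S : TriangulatedSurface} (ζ : EssentialLoop S) where
  open EssentialLoop ζ
  open Loop ζ
  open Turns ζ

  corner : Bool → Corner
  corner true  = left
  corner false = right

  corner-injective : ∀ {b b′} → corner b ≡ corner b′ → b ≡ b′
  corner-injective {true}  {true}  eq = refl
  corner-injective {false} {false} eq = refl

  back≢corner : ∀ b → back ≢ corner b
  back≢corner true  ()
  back≢corner false ()

  front≢corner : ∀ b → front ≢ corner b
  front≢corner true  ()
  front≢corner false ()

  edgeᵖ : Fin (suc #crossings) → Role → Fin 3
  edgeᵖ j = edge (segment j)

  handᵖ : Fin (suc #crossings) → Bool
  handᵖ j = hand (segment j)

  -- There is no diagonal below the first triangle and none above the last. A single vertex stands
  -- for both its end points, so `b` is ignored there.
  lo hi : Fin (suc #crossings) → Bool → Vertex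
  lo zero    b = first , back
  lo (suc k) b = k , corner b
  hi j b with view j
  ... | ‵fromℕ     = last , front
  ... | ‵inject₁ i = i , corner b

  hi-inject₁ : ∀ i b → hi (inject₁ i) b ≡ (i , corner b)
  hi-inject₁ i b rewrite view-inject₁ i = refl

  hi-fromℕ : ∀ b → hi (fromℕ #crossings) b ≡ (last , front)
  hi-fromℕ b rewrite view-fromℕ #crossings = refl

  lo-corner : ∀ {j b i b′} → lo j b ≡ (i , corner b′) → j ≡ suc i × b ≡ b′
  lo-corner {zero}  {b′ = b′} eq = contradiction (cong proj₂ eq) (back≢corner b′)
  lo-corner {suc k} eq = cong (suc ∘ proj₁) eq , corner-injective (cong proj₂ eq)

  hi-corner : ∀ {j b i b′} → hi j b ≡ (i , corner b′) → j ≡ inject₁ i × b ≡ b′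
  hi-corner {j} {b′ = b′} eq with view j
  ... | ‵fromℕ     = contradiction (cong proj₂ eq) (front≢corner b′)
  ... | ‵inject₁ i = cong (inject₁ ∘ proj₁) eq , corner-injective (cong proj₂ eq)

  lo-back : ∀ {j b} → lo j b ≡ (first , back) → j ≡ zero
  lo-back {zero}  eq = refl
  lo-back {suc k} {b} eq = contradiction (sym (cong proj₂ eq)) (back≢corner b)

  hi-back : ∀ {j b} → hi j b ≢ (first , back)
  hi-back {j} {b} eq with view j
  ... | ‵fromℕ     = case cong proj₂ eq of λ ()
  ... | ‵inject₁ i = contradiction (sym (cong proj₂ eq)) (back≢corner b)

  lo-front : ∀ {j b} → lo j b ≢ (last , front)
  lo-front {zero}  eq = case cong proj₂ eq of λ ()
  lo-front {suc k} {b} eq = contradiction (sym (cong proj₂ eq)) (front≢corner b)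

  hi-front : ∀ {j b} → hi j b ≡ (last , front) → j ≡ fromℕ #crossings
  hi-front {j} {b} eq with view j
  ... | ‵fromℕ     = refl
  ... | ‵inject₁ i = contradiction (sym (cong proj₂ eq)) (front≢corner b)

  backCorner-ex : ∀ i → backCorner i (exitᵖ (inject₁ i)) ≡ back
  backCorner-ex i with exitᵖ (inject₁ i) Fin.≟ exitᵖ (inject₁ i)
  ... | yes _ = refl
  ... | no ¬p = contradiction refl ¬p

  frontCorner-en : ∀ i → frontCorner i (entryᵖ (suc i)) ≡ front
  frontCorner-en i with entry i Fin.≟ entry i
  ... | yes _ = refl
  ... | no ¬p = contradiction refl ¬p

  backCorner-right : ∀ i {r} → r ≢ ex → edgeᵖ (inject₁ i) r ≡ next (exitᵖ (inject₁ i)) →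
                     backCorner i (edgeᵖ (inject₁ i) r) ≡ right
  backCorner-right i {r} ne eq with edgeᵖ (inject₁ i) r Fin.≟ exitᵖ (inject₁ i)
                                  | edgeᵖ (inject₁ i) r Fin.≟ next (exitᵖ (inject₁ i))
  ... | yes p | _     = contradiction (edge-injective _ {r} {ex} p) ne
  ... | no _  | yes _ = refl
  ... | no _  | no ¬p = contradiction eq ¬p

  backCorner-left : ∀ i {r} → r ≢ ex → edgeᵖ (inject₁ i) r ≢ next (exitᵖ (inject₁ i)) →
                    backCorner i (edgeᵖ (inject₁ i) r) ≡ left
  backCorner-left i {r} ne neq with edgeᵖ (inject₁ i) r Fin.≟ exitᵖ (inject₁ i)
                                  | edgeᵖ (inject₁ i) r Fin.≟ next (exitᵖ (inject₁ i))
  ... | yes p | _     = contradiction (edge-injective _ {r} {ex} p) ne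
  ... | no _  | yes p = contradiction p neq
  ... | no _  | no _  = refl

  frontCorner-left : ∀ i {r} → r ≢ en → edge i r ≡ next (entry i) → frontCorner i (edge i r) ≡ left
  frontCorner-left i {r} ne eq with edge i r Fin.≟ entry i | edge i r Fin.≟ next (entry i)
  ... | yes p | _     = contradiction (edge-injective i {r} {en} p) ne
  ... | no _  | yes _ = refl
  ... | no _  | no ¬p = contradiction eq ¬p

  frontCorner-right : ∀ i {r} → r ≢ en → edge i r ≢ next (entry i) → frontCorner i (edge i r) ≡ right
  frontCorner-right i {r} ne neq with edge i r Fin.≟ entry i | edge i r Fin.≟ next (entry i)
  ... | yes p | _     = contradiction (edge-injective i {r} {en} p) ne
  ... | no _  | yes p = contradiction p neq
  ... | no _  | no _  = refl

  next-edge-≡ : ∀ k r r′ → nextR (hand k) r ≡ r′ → edge k r′ ≡ next (edge k r)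
  next-edge-≡ k r r′ refl = sym (next-edge k r)

  next-edge-≢ : ∀ k r r′ → r′ ≢ nextR (hand k) r → edge k r′ ≢ next (edge k r)
  next-edge-≢ k r r′ ne eq = ne (edge-injective k (trans eq (next-edge k r)))

  backCorner-en : ∀ i → backCorner i (edgeᵖ (inject₁ i) en) ≡ corner (handᵖ (inject₁ i))
  backCorner-en i with handᵖ (inject₁ i) | next-edge-≡ (segment (inject₁ i)) ex en
                           | next-edge-≢ (segment (inject₁ i)) ex en
  ... | true  | _ | f = backCorner-left i {en} (λ ()) (f λ ())
  ... | false | f | _ = backCorner-right i {en} (λ ()) (f refl)

  backCorner-th : ∀ i → backCorner i (edgeᵖ (inject₁ i) th) ≡ corner (not (handᵖ (inject₁ i)))
  backCorner-th i with handᵖ (inject₁ i) | next-edge-≡ (segment (inject₁ i)) ex th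
                           | next-edge-≢ (segment (inject₁ i)) ex th
  ... | true  | f | _ = backCorner-right i {th} (λ ()) (f refl)
  ... | false | _ | f = backCorner-left i {th} (λ ()) (f λ ())

  frontCorner-ex : ∀ i → frontCorner i (edge i ex) ≡ corner (hand i)
  frontCorner-ex i with hand i | next-edge-≡ i en ex | next-edge-≢ i en ex
  ... | true  | f | _ = frontCorner-left i {ex} (λ ()) (f refl)
  ... | false | _ | f = frontCorner-right i {ex} (λ ()) (f λ ())

  frontCorner-th : ∀ i → frontCorner i (edge i th) ≡ corner (not (hand i))
  frontCorner-th i with hand i | next-edge-≡ i en th | next-edge-≢ i en th
  ... | true  | _ | f = frontCorner-right i {th} (λ ()) (f λ ())
  ... | false | f | _ = frontCorner-left i {th} (λ ()) (f refl)

  vertex-corner : ∀ i b → vertex i (corner b) ≡ (i , corner b)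
  vertex-corner i true  = refl
  vertex-corner i false = refl

  vertex-back : ∀ i → vertex i back ≡ lo (inject₁ i) (handᵖ (inject₁ i))
  vertex-back zero    = refl
  vertex-back (suc i) = cong (inject₁ i ,_) (frontCorner-ex (inject₁ i))

  vertex-front : ∀ i → vertex i front ≡ hi (suc i) (hand i)
  vertex-front i with view i
  ... | ‵fromℕ     = refl
  ... | ‵inject₁ j = cong (suc j ,_) (backCorner-en (suc j))

  vertex-last-front : vertex last front ≡ (last , front)
  vertex-last-front = trans (vertex-front last) (hi-fromℕ (hand last))

  data VertexView : Vertex → Set where
    is-back   : VertexView (first , back)
    is-front  : VertexView (last , front)
    is-corner : ∀ i b → VertexView (i , corner b)

  lo-view : ∀ j b → VertexView (lo j b)
  lo-view zero    b = is-back
  lo-view (suc k) b = is-corner k b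

  hi-view : ∀ j b → VertexView (hi j b)
  hi-view j b with view j
  ... | ‵fromℕ     = is-front
  ... | ‵inject₁ i = is-corner i b

  vertex-view : ∀ i x → VertexView (vertex i x)
  vertex-view i left  = is-corner i true
  vertex-view i right = is-corner i false
  vertex-view i back  = subst VertexView (sym (vertex-back i)) (lo-view (inject₁ i) (handᵖ (inject₁ i)))
  vertex-view i front = subst VertexView (sym (vertex-front i)) (hi-view (suc i) (hand i))

  Valid : Fin (suc #crossings) → Role → Set
  Valid j r = ∃[ i ] InTile i (j , edgeᵖ j r)

  behind : ∀ i r → r ≢ ex → Behind i (inject₁ i , edgeᵖ (inject₁ i) r)
  behind i r ne = refl , ne ∘ edge-injective (segment (inject₁ i))

  inFront : ∀ i r → r ≢ en → InFront i (suc i , edge i r)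
  inFront i r ne = refl , ne ∘ edge-injective i

  valid-below : ∀ i r → (i ≡ zero → r ≢ ex) → Valid (inject₁ i) r
  valid-below i       en ne = i , inj₁ (behind i en λ ())
  valid-below i       th ne = i , inj₁ (behind i th λ ())
  valid-below zero    ex ne = contradiction refl (ne refl)
  valid-below (suc i) ex ne = inject₁ i , inj₂ (inFront (inject₁ i) ex λ ())

  valid-above : ∀ i r → (i ≡ last → r ≢ en) → Valid (suc i) r
  valid-above i ex ne = i , inj₂ (inFront i ex λ ())
  valid-above i th ne = i , inj₂ (inFront i th λ ())
  valid-above i en ne with view i
  ... | ‵fromℕ     = contradiction refl (ne refl)
  ... | ‵inject₁ j = suc j , inj₁ (behind (suc j) en λ ())

  valid-first : ∀ {r} → Valid zero r → r ≢ ex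
  valid-first (i , inj₁ (_ , ne)) refl = ne refl

  valid-last : ∀ {r} → Valid (fromℕ #crossings) r → r ≢ en
  valid-last (i , inj₁ (eq , _)) refl = Fin.fromℕ≢inject₁ eq
  valid-last (i , inj₂ (_ , ne)) refl = ne refl

  -- Incidence without corners: an edge joins an end point of the diagonal below its triangle to one
  -- of the diagonal above, whichever tile it is viewed in.
  Touches : Vertex → Fin (suc #crossings) → Role → Set
  Touches x j r = lo j (foot (handᵖ j) r) ≡ x ⊎ hi j (upper (handᵖ j) r) ≡ x

  vertex-behind : ∀ i r {x} → vertex i (backCorner i (edgeᵖ (inject₁ i) r)) ≡ x →
    (r ≡ ex × lo (inject₁ i) (handᵖ (inject₁ i)) ≡ x)
    ⊎ (r ≡ en × hi (inject₁ i) (handᵖ (inject₁ i)) ≡ x)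
    ⊎ (r ≡ th × hi (inject₁ i) (not (handᵖ (inject₁ i))) ≡ x)
  vertex-behind i en eq = inj₂ (inj₁ (refl , trans (hi-inject₁ i _) (trans (sym (vertex-corner i _))
    (trans (cong (vertex i) (sym (backCorner-en i))) eq))))
  vertex-behind i ex eq = inj₁ (refl , trans (sym (vertex-back i)) (trans (cong (vertex i) (sym (backCorner-ex i))) eq))
  vertex-behind i th eq = inj₂ (inj₂ (refl , trans (hi-inject₁ i _) (trans (sym (vertex-corner i _))
    (trans (cong (vertex i) (sym (backCorner-th i))) eq))))

  vertex-inFront : ∀ i r {x} → vertex i (frontCorner i (edge i r)) ≡ x →
    (r ≡ en × hi (suc i) (hand i) ≡ x) ⊎ (r ≡ ex × lo (suc i) (hand i) ≡ x) ⊎ (r ≡ th × lo (suc i) (not (hand i)) ≡ x)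
  vertex-inFront i en eq = inj₁ (refl , trans (sym (vertex-front i)) (trans (cong (vertex i) (sym (frontCorner-en i))) eq))
  vertex-inFront i ex eq = inj₂ (inj₁ (refl , trans (sym (vertex-corner i _))
    (trans (cong (vertex i) (sym (frontCorner-ex i))) eq)))
  vertex-inFront i th eq = inj₂ (inj₂ (refl , trans (sym (vertex-corner i _))
    (trans (cong (vertex i) (sym (frontCorner-th i))) eq)))

  incident⇒touches : ∀ j r {x} → Incident x (j , edgeᵖ j r) → Valid j r × Touches x j r
  incident⇒touches j r {x} (i , u , ne , inj₁ (bh@(refl , r≢ex) , eq)) with edge-surjective (segment (inject₁ i)) u
  ... | r′ , refl = (i , inj₁ bh) , touches r r′ r≢ex ne (vertex-behind i r′ eq)
    where
    touches : ∀ r r′ → edgeᵖ (inject₁ i) r ≢ exitᵖ (inject₁ i) → edgeᵖ (inject₁ i) r′ ≢ edgeᵖ (inject₁ i) r →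
      (r′ ≡ ex × lo (inject₁ i) (handᵖ (inject₁ i)) ≡ x)
      ⊎ (r′ ≡ en × hi (inject₁ i) (handᵖ (inject₁ i)) ≡ x)
      ⊎ (r′ ≡ th × hi (inject₁ i) (not (handᵖ (inject₁ i))) ≡ x) → Touches x (inject₁ i) r
    touches en _ _ _ (inj₁ (refl , eq)) = inj₁ eq
    touches th _ _ _ (inj₁ (refl , eq)) = inj₁ eq
    touches th _ _ _ (inj₂ (inj₁ (refl , eq))) = inj₂ eq
    touches en _ _ _ (inj₂ (inj₂ (refl , eq))) = inj₂ eq
    touches ex _ ne _ _ = contradiction refl ne
    touches en _ _ ne (inj₂ (inj₁ (refl , eq))) = contradiction refl ne
    touches th _ _ ne (inj₂ (inj₂ (refl , eq))) = contradiction refl ne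
  incident⇒touches j r {x} (i , u , ne , inj₂ (fr@(refl , r≢en) , eq)) with edge-surjective i u
  ... | r′ , refl = (i , inj₂ fr) , touches r r′ r≢en ne (vertex-inFront i r′ eq)
    where
    touches : ∀ r r′ → edge i r ≢ entry i → edge i r′ ≢ edge i r →
      (r′ ≡ en × hi (suc i) (hand i) ≡ x) ⊎ (r′ ≡ ex × lo (suc i) (hand i) ≡ x)
      ⊎ (r′ ≡ th × lo (suc i) (not (hand i)) ≡ x) → Touches x (suc i) r
    touches ex _ _ _ (inj₁ (refl , eq)) = inj₂ eq
    touches th _ _ _ (inj₁ (refl , eq)) = inj₂ eq
    touches th _ _ _ (inj₂ (inj₁ (refl , eq))) = inj₁ eq
    touches ex _ _ _ (inj₂ (inj₂ (refl , eq))) = inj₁ eq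
    touches en _ ne _ _ = contradiction refl ne
    touches ex _ _ ne (inj₂ (inj₁ (refl , eq))) = contradiction refl ne
    touches th _ _ ne (inj₂ (inj₂ (refl , eq))) = contradiction refl ne

  behind-corner : ∀ i b → vertex i (corner b) ≡ hi (inject₁ i) b
  behind-corner i b = trans (vertex-corner i b) (sym (hi-inject₁ i b))

  touches⇒incident : ∀ j r {x} → Valid j r → Touches x j r → Incident x (j , edgeᵖ j r)
  touches⇒incident j r {x} (i , inj₁ bh@(refl , r≢ex)) t = incident r r≢ex t bh
    where
    via : ∀ r r′ → edgeᵖ j r′ ≢ edgeᵖ j r → vertex i (backCorner i (edgeᵖ j r′)) ≡ x →
          Behind i (j , edgeᵖ j r) → Incident x (j , edgeᵖ j r)
    via r r′ ne eq bh = i , edgeᵖ j r′ , ne , inj₁ (bh , eq)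
    lo-ex : vertex i (backCorner i (edgeᵖ j ex)) ≡ lo j (handᵖ j)
    lo-ex = trans (cong (vertex i) (backCorner-ex i)) (vertex-back i)
    incident : ∀ r → edgeᵖ j r ≢ exitᵖ j → Touches x j r → Behind i (j , edgeᵖ j r) → Incident x (j , edgeᵖ j r)
    incident en _ (inj₁ eq) = via en ex (λ p → case edge-injective _ {ex} {en} p of λ ()) (trans lo-ex eq)
    incident en _ (inj₂ eq) = via en th (λ p → case edge-injective _ {th} {en} p of λ ())
      (trans (cong (vertex i) (backCorner-th i)) (trans (behind-corner i _) eq))
    incident th _ (inj₁ eq) = via th ex (λ p → case edge-injective _ {ex} {th} p of λ ()) (trans lo-ex eq)
    incident th _ (inj₂ eq) = via th en (λ p → case edge-injective _ {en} {th} p of λ ())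
      (trans (cong (vertex i) (backCorner-en i)) (trans (behind-corner i _) eq))
    incident ex ne _ = contradiction refl ne
  touches⇒incident j r {x} (i , inj₂ fr@(refl , r≢en)) t = incident r r≢en t fr
    where
    via : ∀ r r′ → edge i r′ ≢ edge i r → vertex i (frontCorner i (edge i r′)) ≡ x →
          InFront i (suc i , edge i r) → Incident x (suc i , edge i r)
    via r r′ ne eq fr = i , edge i r′ , ne , inj₂ (fr , eq)
    hi-en : vertex i (frontCorner i (edge i en)) ≡ hi (suc i) (hand i)
    hi-en = trans (cong (vertex i) (frontCorner-en i)) (vertex-front i)
    incident : ∀ r → edge i r ≢ entry i → Touches x (suc i) r → InFront i (suc i , edge i r) →
               Incident x (suc i , edge i r)
    incident ex _ (inj₂ eq) = via ex en (λ p → case edge-injective _ {en} {ex} p of λ ()) (trans hi-en eq)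
    incident ex _ (inj₁ eq) = via ex th (λ p → case edge-injective _ {th} {ex} p of λ ())
      (trans (cong (vertex i) (frontCorner-th i)) (trans (vertex-corner i _) eq))
    incident th _ (inj₂ eq) = via th en (λ p → case edge-injective _ {en} {th} p of λ ()) (trans hi-en eq)
    incident th _ (inj₁ eq) = via th ex (λ p → case edge-injective _ {ex} {th} p of λ ())
      (trans (cong (vertex i) (frontCorner-ex i)) (trans (vertex-corner i _) eq))
    incident en ne _ = contradiction refl ne

-- Codes and good matchings of the band graph.

module Bands {S : TriangulatedSurface} (ζ : EssentialLoop S) where
  open EssentialLoop ζ
  open Loop ζ
  open Turns ζ
  open Angles ζ
  open Snake ζ

  private
    h : Bool
    h = hand last

  -- With a single crossing there would be a single hand.
  first≢last : first ≢ last
  first≢last eq with hands-vary true | hands-vary false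
  ... | k , t | k′ , f rewrite fromℕ≡zero (sym eq) k | fromℕ≡zero (sym eq) k′ = case trans (sym t) f of λ ()

  prev≢ : ∀ (i : Fin #crossings) → prev i ≢ i
  prev≢ zero    eq = first≢last (sym eq)
  prev≢ (suc i) eq = inject₁≢suc i eq

  segment-inject₁ : ∀ i → segment (inject₁ i) ≡ prev i
  segment-inject₁ zero    = refl
  segment-inject₁ (suc i) = refl

  v-def : v ≡ (first , back)
  v-def = cong (vertex first) (backCorner-ex first)

  w-def : w ≡ (first , corner h)
  w-def = trans (cong (vertex first) (backCorner-en first)) (vertex-corner first h)

  v′-def : v′ ≡ (last , front)
  v′-def = trans (cong (vertex last) (frontCorner-en last)) vertex-last-front

  w′-def : w′ ≡ (last , corner h)
  w′-def = trans (cong (vertex last) (frontCorner-ex last)) (vertex-corner last h)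

  v≢w : v ≢ w
  v≢w eq = back≢corner h (cong proj₂ (trans (sym v-def) (trans eq w-def)))

  v≢w′ : v ≢ w′
  v≢w′ eq = back≢corner h (cong proj₂ (trans (sym v-def) (trans eq w′-def)))

  v≢v′ : v ≢ v′
  v≢v′ eq = case cong proj₂ (trans (sym v-def) (trans eq v′-def)) of λ ()

  w≢v′ : w ≢ v′
  w≢v′ eq = front≢corner h (cong proj₂ (trans (sym v′-def) (trans (sym eq) w-def)))

  w≢w′ : w ≢ w′
  w≢w′ eq = first≢last (cong proj₁ (trans (sym w-def) (trans eq w′-def)))

  identify-v′ : identify v′ ≡ v
  identify-v′ with v′ ≟ᵛ v′ | v′ ≟ᵛ w′
  ... | yes _ | _ = refl
  ... | no ¬p | _ = contradiction refl ¬p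

  identify-w′ : identify w′ ≡ w
  identify-w′ with w′ ≟ᵛ v′ | w′ ≟ᵛ w′
  ... | yes p | _     = contradiction (cong proj₂ (trans (sym v′-def) (trans (sym p) w′-def))) (front≢corner h)
  ... | no _  | yes _ = refl
  ... | no _  | no ¬p = contradiction refl ¬p

  identify-other : ∀ {x} → x ≢ v′ → x ≢ w′ → identify x ≡ x
  identify-other {x} n n′ with x ≟ᵛ v′ | x ≟ᵛ w′
  ... | yes p | _     = contradiction p n
  ... | no _  | yes p = contradiction p n′
  ... | no _  | no _  = refl

  identify-v : identify v ≡ v
  identify-v = identify-other v≢v′ v≢w′

  identify-w : identify w ≡ w
  identify-w = identify-other w≢v′ w≢w′

  identify-v⁻¹ : ∀ {x} → identify x ≡ v → x ≡ v ⊎ x ≡ v′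
  identify-v⁻¹ {x} eq with x ≟ᵛ v′ | x ≟ᵛ w′
  ... | yes p | _     = inj₂ p
  ... | no _  | yes _ = contradiction (sym eq) v≢w
  ... | no _  | no _  = inj₁ eq

  identify-w⁻¹ : ∀ {x} → identify x ≡ w → x ≡ w ⊎ x ≡ w′
  identify-w⁻¹ {x} eq with x ≟ᵛ v′ | x ≟ᵛ w′
  ... | yes _ | _     = contradiction eq v≢w
  ... | no _  | yes p = inj₂ p
  ... | no _  | no _  = inj₁ eq

  identify-other⁻¹ : ∀ {x y} → y ≢ v → y ≢ w → identify x ≡ y → x ≡ y
  identify-other⁻¹ {x} n n′ eq with x ≟ᵛ v′ | x ≟ᵛ w′
  ... | yes _ | _     = contradiction (sym eq) n
  ... | no _  | yes _ = contradiction (sym eq) n′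
  ... | no _  | no _  = eq

  bandIncident⇒ : ∀ {x b} → BandIncident x b →
    ∃[ j ] ∃[ r ] (b ≡ cell (segment j) r × Valid j r × ∃[ x′ ] (Touches x′ j r × identify x′ ≡ x))
  bandIncident⇒ ((j , s) , refl , x′ , inc , eq) with edge-surjective (segment j) s
  ... | r , refl with incident⇒touches j r inc
  ...   | va , t = j , r , refl , va , x′ , t , eq

  ⇒bandIncident : ∀ {x j r k} → segment j ≡ k → Valid j r → ∀ x′ → Touches x′ j r → identify x′ ≡ x →
                  BandIncident x (cell k r)
  ⇒bandIncident {j = j} {r} refl va x′ t eq = (j , edgeᵖ j r) , refl , x′ , touches⇒incident j r va t , eq

  touches-v : ∀ {j r} → Touches v j r → j ≡ zero
  touches-v (inj₁ eq) = lo-back (trans eq v-def)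
  touches-v {j} (inj₂ eq) = contradiction (trans eq v-def) (hi-back {j})

  touches-v′ : ∀ {j r} → Touches v′ j r → j ≡ fromℕ #crossings
  touches-v′ {j} (inj₁ eq) = contradiction (trans eq v′-def) (lo-front {j})
  touches-v′ (inj₂ eq) = hi-front (trans eq v′-def)

  touches-corner : ∀ {i b j r} → Touches (i , corner b) j r →
    (j ≡ suc i × foot (hand i) r ≡ b) ⊎ (j ≡ inject₁ i × upper (handᵖ (inject₁ i)) r ≡ b)
  touches-corner {i} {b} {j} {r} (inj₁ eq) with lo-corner {j} eq
  ... | refl , f = inj₁ (refl , f)
  touches-corner {i} {b} {j} {r} (inj₂ eq) with hi-corner {j} eq
  ... | refl , u = inj₂ (refl , u)

  touch-above : ∀ i r {b} → foot (hand i) r ≡ b → Touches (i , corner b) (suc i) r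
  touch-above i r refl = inj₁ refl

  touch-below : ∀ i r {b} → upper (handᵖ (inject₁ i)) r ≡ b → Touches (i , corner b) (inject₁ i) r
  touch-below i r refl = inj₂ (hi-inject₁ i (upper (handᵖ (inject₁ i)) r))

  bandIncident-v⇒ : ∀ {b} → BandIncident v b → ∃[ r ] b ≡ cell last r
  bandIncident-v⇒ inc with bandIncident⇒ inc
  ... | j , r , refl , va , x′ , t , eq with identify-v⁻¹ {x′} eq
  ...   | inj₁ refl with refl ← touches-v {j} {r} t = r , refl
  ...   | inj₂ refl with refl ← touches-v′ {j} {r} t = r , refl

  -- The entry side and `τ` reach the glued vertex in the first copy of the triangle at the cut, the
  -- exit side in the last copy.
  ⇒bandIncident-v : ∀ r → BandIncident v (cell last r)
  ⇒bandIncident-v en = ⇒bandIncident {j = zero} {en} refl (valid-below zero en (λ _ ())) v (inj₁ (sym v-def)) identify-v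
  ⇒bandIncident-v th = ⇒bandIncident {j = zero} {th} refl (valid-below zero th (λ _ ())) v (inj₁ (sym v-def)) identify-v
  ⇒bandIncident-v ex = ⇒bandIncident {j = suc last} {ex} refl (valid-above last ex (λ _ ())) v′
    (inj₂ (trans (hi-fromℕ _) (sym v′-def))) identify-v′

  -- Sides above the first diagonal and sides below the last one compete for `w`, since it merges an
  -- end point of each.
  data AtW : Cell #crossings → Set where
    atW-th    : AtW (cell last th)
    atW-above : ∀ r → foot (hand first) r ≡ h → AtW (cell first r)
    atW-below : ∀ r → upper (hand (prev last)) r ≡ h → AtW (cell (prev last) r)

  bandIncident-w⇒ : ∀ {b} → BandIncident w b → AtW b
  bandIncident-w⇒ inc with bandIncident⇒ inc
  ... | j , r , refl , va , x′ , t , eq with identify-w⁻¹ {x′} eq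
  ...   | inj₁ refl with touches-corner {first} {h} {j} {r} (subst (λ x → Touches x j r) w-def t)
  ...     | inj₁ (refl , f) = atW-above r f
  ...     | inj₂ (refl , u) with refl ← upper≡hand h r (valid-first va) u = atW-th
  bandIncident-w⇒ inc | j , r , refl , va , x′ , t , eq | inj₂ refl
    with touches-corner {last} {h} {j} {r} (subst (λ x → Touches x j r) w′-def t)
  ...     | inj₁ (refl , f) with refl ← foot≡hand h r (valid-last va) f = atW-th
  ...     | inj₂ (refl , u) = subst (λ k → AtW (cell k r)) (sym (segment-inject₁ last))
    (atW-below r (subst (λ k → upper (hand k) r ≡ h) (segment-inject₁ last) u))

  ⇒bandIncident-w : ∀ {b} → AtW b → BandIncident w b
  ⇒bandIncident-w atW-th = ⇒bandIncident {j = zero} {th} refl (valid-below zero th (λ _ ())) w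
    (subst (λ x → Touches x zero th) (sym w-def) (touch-below zero th refl)) identify-w
  ⇒bandIncident-w (atW-above r f) = ⇒bandIncident {j = suc zero} {r} refl
    (valid-above zero r (λ eq → contradiction eq first≢last)) w
    (subst (λ x → Touches x (suc zero) r) (sym w-def) (touch-above zero r f)) identify-w
  ⇒bandIncident-w (atW-below r u) = ⇒bandIncident {j = inject₁ last} {r} (segment-inject₁ last)
    (valid-below last r (λ eq → contradiction (sym eq) first≢last)) w′
    (subst (λ x → Touches x (inject₁ last) r) (sym w′-def)
      (touch-below last r (trans (cong (λ k → upper (hand k) r) (segment-inject₁ last)) u))) identify-w′

  -- The end points not affected by the gluing, where incidence involves only the two neighbouring
  -- triangles.
  Ordinary : Fin #crossings → Bool → Set
  Ordinary i b = ¬ (i ≡ first × b ≡ h) × ¬ (i ≡ last × b ≡ h)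

  ordinary-not : ∀ i → Ordinary i (not h)
  ordinary-not i = (λ (_ , eq) → not-¬ refl (sym eq)) , (λ (_ , eq) → not-¬ refl (sym eq))

  ordinary-inner : ∀ i b → i ≢ first → i ≢ last → Ordinary i b
  ordinary-inner i b n n′ = n ∘ proj₁ , n′ ∘ proj₁

  data AtCorner (i : Fin #crossings) (b : Bool) : Cell #crossings → Set where
    above : ∀ r → foot (hand i) r ≡ b → AtCorner i b (cell i r)
    below : ∀ r → upper (hand (prev i)) r ≡ b → AtCorner i b (cell (prev i) r)

  module _ {i b} (o : Ordinary i b) where
    private
      ≢v : (i , corner b) ≢ v
      ≢v eq = back≢corner b (sym (cong proj₂ (trans eq v-def)))

      ≢w : (i , corner b) ≢ w
      ≢w eq with trans eq w-def
      ... | eq′ = proj₁ o (cong proj₁ eq′ , corner-injective (cong proj₂ eq′))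

      ≢v′ : (i , corner b) ≢ v′
      ≢v′ eq = front≢corner b (sym (cong proj₂ (trans eq v′-def)))

      ≢w′ : (i , corner b) ≢ w′
      ≢w′ eq with trans eq w′-def
      ... | eq′ = proj₂ o (cong proj₁ eq′ , corner-injective (cong proj₂ eq′))

    identify-ordinary : identify (i , corner b) ≡ (i , corner b)
    identify-ordinary = identify-other ≢v′ ≢w′

    bandIncident-ordinary⇒ : ∀ {a} → BandIncident (identify (i , corner b)) a → AtCorner i b a
    bandIncident-ordinary⇒ {a} inc with bandIncident⇒ (subst (λ x → BandIncident x a) identify-ordinary inc)
    ... | j , r , refl , va , x′ , t , eq with refl ← identify-other⁻¹ {x′} ≢v ≢w eq
      with touches-corner {i} {b} {j} {r} t
    ...   | inj₁ (refl , f) = above r f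
    ...   | inj₂ (refl , u) = subst (λ k → AtCorner i b (cell k r)) (sym (segment-inject₁ i))
      (below r (subst (λ k → upper (hand k) r ≡ b) (segment-inject₁ i) u))

    ⇒bandIncident-ordinary : ∀ {a} → AtCorner i b a → BandIncident (identify (i , corner b)) a
    ⇒bandIncident-ordinary (above r f) = ⇒bandIncident {j = suc i} {r} refl
      (valid-above i r λ { refl refl → proj₂ o (refl , sym f) }) (i , corner b) (touch-above i r f) refl
    ⇒bandIncident-ordinary (below r u) = ⇒bandIncident {j = inject₁ i} {r} (segment-inject₁ i)
      (valid-below i r λ { refl refl → proj₁ o (refl , sym u) }) (i , corner b)
      (touch-below i r (trans (cong (λ k → upper (hand k) r) (segment-inject₁ i)) u)) refl

  module _ {P : Subset (#crossings ℕ.* 3)} (code : Code P) where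
    open Code code

    private
      link-prev : ∀ i → upper (hand (prev i)) (role (prev i)) ≡ lower (hand i) (role i)
      link-prev i = trans (link (prev i)) (cong (λ k → lower (hand k) (role k)) (next-prev i))

      only-role : ∀ k r → P ∋ cell k r → r ≡ role k
      only-role k r p = edge-injective k (only k (edge k r) p)

      only-cell : ∀ k r → P ∋ cell k r → cell k (role k) ≡ cell k r
      only-cell k r p = cong (cell k) (sym (only-role k r p))

    unique-v : ∃! _≡_ λ b → P ∋ b × BandIncident v b
    unique-v = cell last (role last) , (member last , ⇒bandIncident-v (role last)) ,
      λ (p , inc) → same p (bandIncident-v⇒ inc)
      where
      same : ∀ {b} → P ∋ b → ∃[ r ] b ≡ cell last r → cell last (role last) ≡ b
      same p (r , refl) = only-cell last r p

    -- Apart from `τ`, the entry side uses the end point `not h` of the first diagonal and the exit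
    -- side that of the last. By agreement the end point `h`, which is `w`, is then covered by the
    -- triangle beyond that diagonal.
    cell-w : Role → Cell #crossings
    cell-w th = cell last th
    cell-w en = cell first (role first)
    cell-w ex = cell (prev last) (role (prev last))

    unique-w : ∃! _≡_ λ b → P ∋ b × BandIncident w b
    unique-w = cell-w (role last) , (proj₁ exists , ⇒bandIncident-w (proj₂ exists)) ,
      λ (p , inc) → same p (bandIncident-w⇒ inc)
      where
      exists : P ∋ cell-w (role last) × AtW (cell-w (role last))
      exists with role last in eq
      ... | th = subst (λ r → P ∋ cell last r) eq (member last) , atW-th
      ... | en = member first , atW-above (role first) (lower≡not⇒foot≡ (hand first) (role first)
            (trans (sym (link-prev first)) (cong (upper h) eq)))
      ... | ex = member (prev last) , atW-below (role (prev last)) (trans (link-prev last) (cong (lower h) eq))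
      same : ∀ {b} → P ∋ b → AtW b → cell-w (role last) ≡ b
      same p atW-th = cong cell-w (sym (only-role last th p))
      same p (atW-above r f) with refl ← only-role first r p =
        cong cell-w (upper≡not⇒en h (role last) (trans (link-prev first) (foot≡⇒lower≡not (hand first) r f)))
      same p (atW-below r u) with refl ← only-role (prev last) r p =
        cong cell-w (lower≡hand⇒ex h (role last) (trans (sym (link-prev last)) u))

    unique-ordinary : ∀ {i b} → Ordinary i b →
                      ∃! _≡_ λ a → P ∋ a × BandIncident (identify (i , corner b)) a
    unique-ordinary {i} {b} o with upper (hand (prev i)) (role (prev i)) Bool.≟ b
    ... | yes u = cell (prev i) (role (prev i)) ,
        (member (prev i) , ⇒bandIncident-ordinary o (below (role (prev i)) u)) ,
        λ (p , inc) → same p (bandIncident-ordinary⇒ o inc)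
      where
      same : ∀ {a} → P ∋ a → AtCorner i b a → cell (prev i) (role (prev i)) ≡ a
      same p (below r _) = only-cell (prev i) r p
      same p (above r f) with refl ← only-role i r p =
        contradiction (trans (sym u) (trans (link-prev i) (foot≡⇒lower≡not (hand i) r f))) (not-¬ refl)
    ... | no ¬u = cell i (role i) ,
        (member i , ⇒bandIncident-ordinary o (above (role i)
          (lower≡not⇒foot≡ (hand i) (role i) (trans (sym (link-prev i)) (¬-not ¬u))))) ,
        λ (p , inc) → same p (bandIncident-ordinary⇒ o inc)
      where
      same : ∀ {a} → P ∋ a → AtCorner i b a → cell i (role i) ≡ a
      same p (above r _) = only-cell i r p
      same p (below r u) with refl ← only-role (prev i) r p = contradiction u ¬u

    code⇒bandMatching : BandMatching P
    code⇒bandMatching i x = unique (vertex-view i x)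
      where
      unique : ∀ {y} → VertexView y → ∃! _≡_ λ b → P ∋ b × BandIncident (identify y) b
      unique is-back  = subst (λ y → ∃! _≡_ λ b → P ∋ b × BandIncident y b)
        (sym (trans (cong identify (sym v-def)) identify-v)) unique-v
      unique is-front = subst (λ y → ∃! _≡_ λ b → P ∋ b × BandIncident y b)
        (sym (trans (cong identify (sym v′-def)) identify-v′)) unique-v
      unique (is-corner i b) with (i , corner b) ≟ᵛ (first , corner h) | (i , corner b) ≟ᵛ (last , corner h)
      ... | yes eq | _ = subst (λ y → ∃! _≡_ λ b → P ∋ b × BandIncident y b)
        (sym (trans (cong identify (trans eq (sym w-def))) identify-w)) unique-w
      ... | no _ | yes eq = subst (λ y → ∃! _≡_ λ b → P ∋ b × BandIncident y b)
        (sym (trans (cong identify (trans eq (sym w′-def))) identify-w′)) unique-w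
      ... | no n | no n′ = unique-ordinary {i} {b} ((λ { (refl , refl) → n refl }) , (λ { (refl , refl) → n′ refl }))

    covered-v : role last ≢ ex → Covered P v
    covered-v ne = (zero , edgeᵖ zero (role last)) , member last ,
      touches⇒incident zero (role last) (valid-below zero (role last) (λ _ → ne)) (inj₁ (sym v-def))

    covered-v′ : role last ≢ en → Covered P v′
    covered-v′ ne = (suc last , edge last (role last)) , member last ,
      touches⇒incident (suc last) (role last) (valid-above last (role last) (λ _ → ne))
        (inj₂ (trans (hi-fromℕ _) (sym v′-def)))

    covered-w : role last ≢ ex → Covered P w
    covered-w ne with role last in eq
    ... | th = (zero , edgeᵖ zero th) , subst (λ r → P ∋ cell last r) eq (member last) ,
      subst (λ x → Incident x (zero , edgeᵖ zero th)) (sym w-def)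
        (touches⇒incident zero th (valid-below zero th (λ _ ())) (touch-below zero th refl))
    ... | en = (suc zero , edge zero (role zero)) , member zero ,
      subst (λ x → Incident x (suc zero , edge zero (role zero))) (sym w-def)
        (touches⇒incident (suc zero) (role zero) (valid-above zero (role zero) (λ eq → contradiction eq first≢last))
          (touch-above zero (role zero) (lower≡not⇒foot≡ (hand zero) (role zero)
            (trans (sym (link-prev first)) (cong (upper h) eq)))))
    ... | ex = contradiction refl ne

    covered-w′ : role last ≢ en → Covered P w′
    covered-w′ ne with role last in eq
    ... | th = (suc last , edge last th) , subst (λ r → P ∋ cell last r) eq (member last) ,
      subst (λ x → Incident x (suc last , edge last th)) (sym w′-def)
        (touches⇒incident (suc last) th (valid-above last th (λ _ ())) (touch-above last th refl))
    ... | ex = (inject₁ last , edgeᵖ (inject₁ last) r) ,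
      subst (λ k → P ∋ cell k r) (sym (segment-inject₁ last)) (member (prev last)) ,
      subst (λ x → Incident x (inject₁ last , edgeᵖ (inject₁ last) r)) (sym w′-def)
        (touches⇒incident (inject₁ last) r (valid-below last r (λ eq → contradiction (sym eq) first≢last))
          (touch-below last r (trans (cong (λ k → upper (hand k) r) (segment-inject₁ last))
            (trans (link-prev last) (cong (lower h) eq)))))
      where r = role (prev last)
    ... | en = contradiction refl ne

    code⇒goodBandMatching : GoodBandMatching P
    code⇒goodBandMatching = code⇒bandMatching , good
      where
      good : P ∋ (last , τ) ⊎ AtFirst P ⊎ AtLast P
      good with role last ≟ʳ ex
      ... | no ne  = inj₂ (inj₁ (covered-v ne , covered-w ne))
      ... | yes eq = inj₂ (inj₂ (covered-v′ ne , covered-w′ ne))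
        where
        ne : role last ≢ en
        ne eq′ = case trans (sym eq) eq′ of λ ()

  module _ {P : Subset (#crossings ℕ.* 3)} (matching : BandMatching P) where

    One : Fin #crossings → Set
    One k = ∃[ r ] (P ∋ cell k r × ∀ r′ → P ∋ cell k r′ → r′ ≡ r)

    -- Uniqueness is recorded only among the sides above the diagonal, because the induction runs
    -- upwards.
    record Cover (i : Fin #crossings) (b : Bool) : Set where
      field
        exists    : (∃[ r ] (P ∋ cell (prev i) r × upper (hand (prev i)) r ≡ b))
                  ⊎ (∃[ r ] (P ∋ cell i r × foot (hand i) r ≡ b))
        exclusive : ∀ r r′ → P ∋ cell (prev i) r → upper (hand (prev i)) r ≡ b →
                    P ∋ cell i r′ → foot (hand i) r′ ≡ b → ⊥
        unique    : ∀ r r′ → P ∋ cell i r → foot (hand i) r ≡ b →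
                    P ∋ cell i r′ → foot (hand i) r′ ≡ b → r ≡ r′
    open Cover

    matching-at : ∀ {x y} → VertexView x → identify x ≡ y → ∃! _≡_ λ b → P ∋ b × BandIncident y b
    matching-at {_} {y} is-back eq = subst (λ y → ∃! _≡_ λ b → P ∋ b × BandIncident y b) eq (matching first back)
    matching-at {_} {y} is-front eq = subst (λ y → ∃! _≡_ λ b → P ∋ b × BandIncident y b)
      (trans (cong identify vertex-last-front) eq) (matching last front)
    matching-at {_} {y} (is-corner i b) eq = subst (λ y → ∃! _≡_ λ b → P ∋ b × BandIncident y b)
      (trans (cong identify (vertex-corner i b)) eq) (matching i (corner b))

    cover-ordinary : ∀ {i b} → Ordinary i b → Cover i b
    cover-ordinary {i} {b} o with matching-at (is-corner i b) refl
    ... | a , (p , inc) , u = record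
      { exists = exists′ p (bandIncident-ordinary⇒ o inc)
      ; exclusive = λ r r′ q e q′ e′ → prev≢ i (cong proj₁ (trans
          (sym (u (q , ⇒bandIncident-ordinary o (below r e))))
          (u (q′ , ⇒bandIncident-ordinary o (above r′ e′)))))
      ; unique = λ r r′ q e q′ e′ → cell-injectiveʳ (trans
          (sym (u (q , ⇒bandIncident-ordinary o (above r e))))
          (u (q′ , ⇒bandIncident-ordinary o (above r′ e′))))
      }
      where
      exists′ : ∀ {a} → P ∋ a → AtCorner i b a → (∃[ r ] (P ∋ cell (prev i) r × upper (hand (prev i)) r ≡ b))
                  ⊎ (∃[ r ] (P ∋ cell i r × foot (hand i) r ≡ b))
      exists′ p (above r f) = inj₂ (r , p , f)
      exists′ p (below r u) = inj₁ (r , p , u)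

    -- The sides at `v` are exactly those of the triangle at the cut, so covering `v` once selects
    -- one of them.
    one-last : One last
    one-last with matching-at is-back (trans (cong identify (sym v-def)) identify-v)
    ... | a , (p , inc) , u with bandIncident-v⇒ inc
    ...   | r , refl = r , p , λ r′ p′ → cell-injectiveʳ (sym (u (p′ , ⇒bandIncident-v r′)))

    -- The side below covers one end point of the diagonal, so a side above covers the other. A
    -- further side above would cover one of the two end points again.
    one-step : ∀ i → Cover i true → Cover i false → One (prev i) → One i
    one-step i ct cf (r , p , one) = above-one (exists (cover (not c)))
      where
      c = upper (hand (prev i)) r
      cover : ∀ b → Cover i b
      cover true  = ct
      cover false = cf
      above-one : (∃[ r ] (P ∋ cell (prev i) r × upper (hand (prev i)) r ≡ not c))
                  ⊎ (∃[ r ] (P ∋ cell i r × foot (hand i) r ≡ not c)) → One i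
      above-one (inj₁ (r′ , p′ , e)) with refl ← one r′ p′ = contradiction e (not-¬ refl)
      above-one (inj₂ (r′ , p′ , e)) = r′ , p′ , λ r″ p″ → case foot (hand i) r″ Bool.≟ c of λ where
        (yes e″) → ⊥-elim (exclusive (cover c) r r″ p refl p″ e″)
        (no ne)  → unique (cover (not c)) r″ r′ p″ (¬-not ne) p′ e

    w-unique : ∀ {a b} → P ∋ a → AtW a → P ∋ b → AtW b → a ≡ b
    w-unique p q p′ q′ with matching-at (is-corner first h) (trans (cong identify (sym w-def)) identify-w)
    ... | _ , _ , u = trans (sym (u (p , ⇒bandIncident-w q))) (u (p′ , ⇒bandIncident-w q′))

    -- Goodness in usable form: besides the side chosen at the cut, it names the side which then
    -- covers `w`.
    data Continued : Set where
      by-third : P ∋ cell last th → Continued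
      by-entry : P ∋ cell last en → ∀ r → P ∋ cell first r → foot (hand first) r ≡ h → Continued
      by-exit  : P ∋ cell last ex → ∀ r → P ∋ cell (prev last) r → upper (hand (prev last)) r ≡ h → Continued

    covered⇒ : ∀ {x} → Covered P x → ∃[ j ] ∃[ r ] (P ∋ cell (segment j) r × Valid j r × Touches x j r)
    covered⇒ {x} ((j , s) , p , inc) with edge-surjective (segment j) s
    ... | r , refl with incident⇒touches j r inc
    ...   | va , t = j , r , p , va , t

    good⇒continued : P ∋ (last , τ) ⊎ AtFirst P ⊎ AtLast P → Continued
    good⇒continued (inj₁ p) = by-third p
    good⇒continued (inj₂ (inj₁ (cv , cw))) with covered⇒ cv | covered⇒ cw
    ... | j , r , p , va , t | j′ , r′ , p′ , va′ , t′ with refl ← touches-v {j} {r} t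
      with r | touches-corner {first} {h} {j′} {r′} (subst (λ x → Touches x j′ r′) w-def t′)
    ... | th | _ = by-third p
    ... | ex | _ = contradiction refl (valid-first va)
    ... | en | inj₁ (refl , f) = by-entry p r′ p′ f
    ... | en | inj₂ (refl , u) with refl ← upper≡hand h r′ (valid-first va′) u = by-third p′
    good⇒continued (inj₂ (inj₂ (cv , cw))) with covered⇒ cv | covered⇒ cw
    ... | j , r , p , va , t | j′ , r′ , p′ , va′ , t′ with refl ← touches-v′ {j} {r} t
      with r | touches-corner {last} {h} {j′} {r′} (subst (λ x → Touches x j′ r′) w′-def t′)
    ... | th | _ = by-third p
    ... | en | _ = contradiction refl (valid-last va)
    ... | ex | inj₂ (refl , u) = by-exit p r′ (subst (λ k → P ∋ cell k r′) (segment-inject₁ last) p′)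
                                   (subst (λ k → upper (hand k) r′ ≡ h) (segment-inject₁ last) u)
    ... | ex | inj₁ (refl , f) with refl ← foot≡hand h r′ (valid-last va′) f = by-third p′

    prev-last≡first : prev last ≡ first → ∀ k → k ≡ first ⊎ k ≡ last
    prev-last≡first eq = next-induction (λ k → k ≡ first ⊎ k ≡ last) step first (inj₁ refl)
      where
      step : ∀ k → k ≡ first ⊎ k ≡ last → next k ≡ first ⊎ next k ≡ last
      step k (inj₁ refl) = inj₂ (trans (cong next (sym eq)) (next-prev last))
      step k (inj₂ refl) = inj₁ (next-fromℕ _)

    last-unique : ∀ r r′ → P ∋ cell last r → P ∋ cell last r′ → r ≡ r′
    last-unique _ _ p p′ with one-last
    ... | _ , _ , one = trans (one _ p) (sym (one _ p′))

    -- Goodness makes the cut invisible: `upper` assigns the exit side of the triangle at the cut to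
    -- this end point, although as an edge of the band graph it does not touch `w`.
    cover-first : Continued → Cover first h
    cover-first c = record
      { exists    = exists′ c
      ; exclusive = excl c
      ; unique    = λ r r′ q e q′ e′ → cell-injectiveʳ (w-unique q (atW-above r e) q′ (atW-above r′ e′))
      }
      where
      exists′ : Continued → (∃[ r ] (P ∋ cell last r × upper h r ≡ h))
                      ⊎ (∃[ r ] (P ∋ cell first r × foot (hand first) r ≡ h))
      exists′ (by-third p)        = inj₁ (th , p , refl)
      exists′ (by-entry p r q e) = inj₂ (r , q , e)
      exists′ (by-exit p r q e)  = inj₁ (ex , p , refl)
      excl : Continued → ∀ r r′ → P ∋ cell last r → upper h r ≡ h → P ∋ cell first r′ → foot (hand first) r′ ≡ h → ⊥
      excl (by-third p) _ r′ _ _ q′ e′ =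
        first≢last (sym (cong proj₁ (w-unique p atW-th q′ (atW-above r′ e′))))
      excl (by-entry p _ _ _) r _ q e _ _ with refl ← last-unique r en q p = not-¬ refl (sym e)
      -- Both sides cover `w`, hence coincide. This needs exactly two crossings, and the common side
      -- then makes both hands equal to `h`, against `hands-vary`.
      excl (by-exit p r₀ q₀ e₀) _ r′ _ _ q′ e′ = not-¬ refl
        (trans (sym (all (proj₁ (hands-vary (not h))))) (proj₂ (hands-vary (not h))))
        where
        same : cell (prev last) r₀ ≡ cell first r′
        same = w-unique q₀ (atW-below r₀ e₀) q′ (atW-above r′ e′)
        hand-first : hand first ≡ h
        hand-first = upper≡foot (hand first) r′
          (subst₂ (λ k r → upper (hand k) r ≡ h) (cong proj₁ same) (cell-injectiveʳ {r = r₀} {r′} same) e₀) e′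
        all : ∀ k → hand k ≡ h
        all k with prev-last≡first (cong proj₁ same) k
        ... | inj₁ refl = hand-first
        ... | inj₂ refl = refl

    one : Continued → ∀ k → One k
    one c = <-weakInduction One (one-step zero (cover true) (cover false) one-last) step
      where
      cover : ∀ b → Cover first b
      cover b with b Bool.≟ h
      ... | yes refl = cover-first c
      ... | no ne    = subst (Cover first) (sym (¬-not ne)) (cover-ordinary (ordinary-not first))
      step : ∀ i → One (inject₁ i) → One (suc i)
      -- At the last diagonal the end point `h` is merged into `w`, so no `Cover` is available; the
      -- triangle above it is the one settled by `v`.
      step i o with suc i Fin.≟ last
      ... | yes eq = subst One (sym eq) one-last
      ... | no ne  = one-step (suc i) (cover-ordinary (ordinary-inner (suc i) true (λ ()) ne))
                       (cover-ordinary (ordinary-inner (suc i) false (λ ()) ne)) o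

    -- One end point suffices to decide agreement, and `not h` is ordinary at every diagonal, so the
    -- cut needs no special case.
    one-link : ∀ i ((r , _) : One (prev i)) ((r′ , _) : One i) → upper (hand (prev i)) r ≡ lower (hand i) r′
    one-link i (r , p , o) (r′ , p′ , o′) = links (exists cover)
      where
      cover : Cover i (not h)
      cover = cover-ordinary (ordinary-not i)
      links : (∃[ r ] (P ∋ cell (prev i) r × upper (hand (prev i)) r ≡ not h))
              ⊎ (∃[ r ] (P ∋ cell i r × foot (hand i) r ≡ not h)) →
              upper (hand (prev i)) r ≡ lower (hand i) r′
      links (inj₁ (r₁ , p₁ , e₁)) with refl ← o r₁ p₁ = trans e₁ (sym (foot≡⇒lower≡not (hand i) r′
        (trans (¬-not (exclusive cover r r′ p e₁ p′)) (not-involutive h))))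
      links (inj₂ (r₁ , p₁ , e₁)) with refl ← o′ r₁ p₁ = trans (¬-not (λ e → exclusive cover r r′ p e p′ e₁))
        (sym (foot≡⇒lower≡not (hand i) r′ e₁))

    goodBandMatching⇒code : P ∋ (last , τ) ⊎ AtFirst P ⊎ AtLast P → Code P
    goodBandMatching⇒code good = record
      { role   = λ k → proj₁ (ones k)
      ; member = λ k → proj₁ (proj₂ (ones k))
      ; only   = λ k u p → case edge-surjective k u of λ where
          (r , refl) → cong (edge k) (proj₂ (proj₂ (ones k)) r p)
      ; link   = λ k → subst (λ l → upper (hand l) (proj₁ (ones l)) ≡ lower (hand (next k)) (proj₁ (ones (next k))))
          (prev-next k) (one-link (next k) (ones (prev (next k))) (ones (next k)))
      }
      where
      ones : ∀ k → One k
      ones = one (good⇒continued good)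

-- Finite subsets and their symmetric differences.

the-unique : ∀ {n} {P : Subset n → Set} (P? : Decidable P) {U} → P U → (∀ {V} → P V → V ≡ U) → the P? ≡ U
the-unique P? p unique with anySubset? P?
... | yes (V , q) = unique q
... | no ¬p       = contradiction (_ , p) ¬p

lookup-ext : ∀ {A : Set} {n} {xs ys : Vec A n} → (∀ i → lookup xs i ≡ lookup ys i) → xs ≡ ys
lookup-ext {xs = xs} {ys} eq = trans (sym (tabulate∘lookup xs)) (trans (tabulate-cong eq) (tabulate∘lookup ys))

has : ∀ {n} → Fin n → Fin 3 → Subset (n ℕ.* 3) → Bool
has k s P = lookup P (combine k s)

has-ext : ∀ {n} {P Q : Subset (n ℕ.* 3)} → (∀ (k : Fin n) s → has k s P ≡ has k s Q) → P ≡ Q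
has-ext {n} {P} {Q} eq = lookup-ext λ i → subst (λ i → lookup P i ≡ lookup Q i) (Fin.combine-remQuot {n} 3 i)
  (uncurry eq (remQuot {n} 3 i))

∋⇒has : ∀ {n} (k : Fin n) s (P : Subset (n ℕ.* 3)) → P ∋ (k , s) → has k s P ≡ true
∋⇒has k s P p = []=⇒lookup p

has⇒∋ : ∀ {n} (k : Fin n) s (P : Subset (n ℕ.* 3)) → has k s P ≡ true → P ∋ (k , s)
has⇒∋ k s P p = lookup⇒[]= (combine k s) P p

has-cells : ∀ {n} {P : Cell n → Set} (P? : Decidable P) k s → has k s (cells P?) ≡ does (P? (k , s))
has-cells P? k s = trans (lookup∘tabulate (does ∘ P? ∘ remQuot 3) (combine k s))
  (cong (does ∘ P?) (Fin.remQuot-combine k s))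

lookup-△ : ∀ {n} (P Q : Subset n) i → lookup (P △ Q) i ≡ lookup P i xor lookup Q i
lookup-△ (true  ∷ P) (true  ∷ Q) zero = refl
lookup-△ (true  ∷ P) (false ∷ Q) zero = refl
lookup-△ (false ∷ P) (true  ∷ Q) zero = refl
lookup-△ (false ∷ P) (false ∷ Q) zero = refl
lookup-△ (_ ∷ P) (_ ∷ Q) (suc i) = lookup-△ P Q i

module _ {n} (V : Subset n) {T : Fin n → Set} (dec : Dec (∃! _≡_ λ i → i ∈ V × T i)) where

  does-∃!-none : (∀ i → ¬ T i) → does dec ≡ false
  does-∃!-none none = dec-false dec λ (i , (_ , t) , _) → none i t

  does-∃!-one : ∀ i → T i → (∀ i′ → T i′ → i ≡ i′) → does dec ≡ lookup V i
  does-∃!-one i t u with lookup V i in eq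
  ... | true  = dec-true dec (i , (lookup⇒[]= i V eq , t) , λ (_ , t′) → u _ t′)
  ... | false = dec-false dec none
    where
    none : ¬ ∃! _≡_ λ i → i ∈ V × T i
    none (i′ , (m , t′) , _) with refl ← u i′ t′ = case trans (sym ([]=⇒lookup m)) eq of λ ()

  does-∃!-two : ∀ i i′ → i ≢ i′ → T i → T i′ → (∀ i″ → T i″ → i ≡ i″ ⊎ i′ ≡ i″) →
                does dec ≡ lookup V i xor lookup V i′
  does-∃!-two i i′ ne t t′ u with lookup V i in eq | lookup V i′ in eq′
  ... | true  | true  = dec-false dec λ (_ , _ , v) →
        ne (trans (sym (v (lookup⇒[]= i V eq , t))) (v (lookup⇒[]= i′ V eq′ , t′)))
  ... | true  | false = dec-true dec (i , (lookup⇒[]= i V eq , t) , only)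
    where
    only : ∀ {i″} → i″ ∈ V × T i″ → i ≡ i″
    only (m , t″) with u _ t″
    ... | inj₁ e = e
    ... | inj₂ refl = case trans (sym ([]=⇒lookup m)) eq′ of λ ()
  ... | false | true  = dec-true dec (i′ , (lookup⇒[]= i′ V eq′ , t′) , only)
    where
    only : ∀ {i″} → i″ ∈ V × T i″ → i′ ≡ i″
    only (m , t″) with u _ t″
    ... | inj₂ e = e
    ... | inj₁ refl = case trans (sym ([]=⇒lookup m)) eq of λ ()
  ... | false | false = dec-false dec none
    where
    none : ¬ ∃! _≡_ λ i → i ∈ V × T i
    none (i″ , (m , t″) , _) with u i″ t″
    ... | inj₁ refl = case trans (sym ([]=⇒lookup m)) eq of λ ()
    ... | inj₂ refl = case trans (sym ([]=⇒lookup m)) eq′ of λ ()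

-- Local tables for the minimal matchings.

infix 4 _≡ᵇ_
_≡ᵇ_ : Role → Role → Bool
r ≡ᵇ r′ = does (r ≟ʳ r′)

-- The side of a triangle which replaces a given one when the given one does not belong to
-- the snake graph.
dropEn dropEx : Role → Role
dropEn en = th
dropEn ex = ex
dropEn th = th
dropEx en = en
dropEx ex = th
dropEx th = th

dropEn≢en : ∀ r → dropEn r ≢ en
dropEn≢en en ()
dropEn≢en ex ()
dropEn≢en th ()

dropEx≢ex : ∀ r → dropEx r ≢ ex
dropEx≢ex en ()
dropEx≢ex ex ()
dropEx≢ex th ()

-- Replacing the exit side by the third one keeps the end point above, so completion preserves
-- agreement.
upper-dropEx : ∀ h r → upper h (dropEx r) ≡ upper h r
upper-dropEx h en = refl
upper-dropEx h ex = refl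
upper-dropEx h th = refl

lower-dropEn : ∀ h r → lower h (dropEn r) ≡ lower h r
lower-dropEn h en = refl
lower-dropEn h ex = refl
lower-dropEn h th = refl

-- Whether a side is a boundary edge of the union of some tiles, depending on
-- whether the tile in front of which and the tile behind which its triangle lies
-- belong to the union.
inBoundary : Role → Bool → Bool → Bool
inBoundary en l u = u
inBoundary ex l u = l
inBoundary th l u = l xor u

-- The local form of both y-monomials: one triangle contributes to the difference from the minimal
-- matching what the union of tiles with covered left end points prescribes, its two neighbouring
-- tiles being recorded by `lower` and `upper`.
differ-inner : ∀ h r r′ → (r′ ≡ᵇ minRole h) xor (r′ ≡ᵇ r) ≡ inBoundary r′ (lower h r) (upper h r)
differ-inner true  en en = refl
differ-inner true  en ex = refl
differ-inner true  en th = refl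
differ-inner true  ex en = refl
differ-inner true  ex ex = refl
differ-inner true  ex th = refl
differ-inner true  th en = refl
differ-inner true  th ex = refl
differ-inner true  th th = refl
differ-inner false en en = refl
differ-inner false en ex = refl
differ-inner false en th = refl
differ-inner false ex en = refl
differ-inner false ex ex = refl
differ-inner false ex th = refl
differ-inner false th en = refl
differ-inner false th ex = refl
differ-inner false th th = refl

differ-first : ∀ h r r′ → (r′ ≡ᵇ dropEx (minRole h)) xor (r′ ≡ᵇ dropEx r) ≡ inBoundary r′ false (upper h r)
differ-first true  en en = refl
differ-first true  en ex = refl
differ-first true  en th = refl
differ-first true  ex en = refl
differ-first true  ex ex = refl
differ-first true  ex th = refl
differ-first true  th en = refl
differ-first true  th ex = refl
differ-first true  th th = refl
differ-first false en en = refl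
differ-first false en ex = refl
differ-first false en th = refl
differ-first false ex en = refl
differ-first false ex ex = refl
differ-first false ex th = refl
differ-first false th en = refl
differ-first false th ex = refl
differ-first false th th = refl

differ-last : ∀ h r r′ → (r′ ≡ᵇ dropEn (minRole h)) xor (r′ ≡ᵇ dropEn r) ≡ inBoundary r′ (lower h r) false
differ-last true  en en = refl
differ-last true  en ex = refl
differ-last true  en th = refl
differ-last true  ex en = refl
differ-last true  ex ex = refl
differ-last true  ex th = refl
differ-last true  th en = refl
differ-last true  th ex = refl
differ-last true  th th = refl
differ-last false en en = refl
differ-last false en ex = refl
differ-last false en th = refl
differ-last false ex en = refl
differ-last false ex ex = refl
differ-last false ex th = refl
differ-last false th en = refl
differ-last false th ex = refl
differ-last false th th = refl

upper-minRole : ∀ h → upper h (minRole h) ≡ false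
upper-minRole true  = refl
upper-minRole false = refl

lower-minRole : ∀ h → lower h (minRole h) ≡ false
lower-minRole true  = refl
lower-minRole false = refl

minRole≢th : ∀ h → minRole h ≢ th
minRole≢th true  ()
minRole≢th false ()

foot-true⇒minRole : ∀ h r → r ≢ th → foot h r ≡ true → r ≡ minRole h
foot-true⇒minRole true  en ne f = refl
foot-true⇒minRole false ex ne f = refl
foot-true⇒minRole h     th ne f = contradiction refl ne

foot-true⇒dropEn : ∀ h r → r ≢ en → foot h r ≡ true → r ≡ dropEn (minRole h)
foot-true⇒dropEn h     en ne f = contradiction refl ne
foot-true⇒dropEn false ex ne f = refl
foot-true⇒dropEn true  th ne f = refl

prevR-ex-dropEx : ∀ h → prevR h ex ≡ dropEx (minRole h)
prevR-ex-dropEx true  = refl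
prevR-ex-dropEx false = refl

-- The minimal matching of angles and boundaries of unions of tiles.

module Coefficients {S : TriangulatedSurface} (ζ : EssentialLoop S) where
  open EssentialLoop ζ
  open Loop ζ
  open Turns ζ
  open Angles ζ
  open Snake ζ
  open Bands ζ

  Linked : (Fin #crossings → Role) → Set
  Linked ρ = ∀ k → upper (hand k) (ρ k) ≡ lower (hand (next k)) (ρ (next k))

  sides : ∀ {m} → (Fin m → Fin #crossings) → (Fin m → Role) → Subset (m ℕ.* 3)
  sides seg ρ = cells {P = λ (k , u) → u ≡ edge (seg k) (ρ k)} λ (k , u) → u Fin.≟ edge (seg k) (ρ k)

  roles : (Fin #crossings → Role) → Subset (#crossings ℕ.* 3)
  roles = sides id

  rolesᵖ : (Fin (suc #crossings) → Role) → Subset (suc #crossings ℕ.* 3)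
  rolesᵖ = sides segment

  edge-≡ᵇ : ∀ k r r′ → does (edge k r Fin.≟ edge k r′) ≡ (r ≡ᵇ r′)
  edge-≡ᵇ k r r′ = does-⇔ (mk⇔ (edge-injective k) (cong (edge k))) (edge k r Fin.≟ edge k r′) (r ≟ʳ r′)

  module _ {m} (seg : Fin m → Fin #crossings) (ρ : Fin m → Role) where

    has-sides′ : ∀ k u → has k u (sides seg ρ) ≡ does (u Fin.≟ edge (seg k) (ρ k))
    has-sides′ k u = has-cells (λ (k , u) → u Fin.≟ edge (seg k) (ρ k)) k u

    has-sides : ∀ k r → has k (edge (seg k) r) (sides seg ρ) ≡ (r ≡ᵇ ρ k)
    has-sides k r = trans (has-sides′ k (edge (seg k) r)) (edge-≡ᵇ (seg k) r (ρ k))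

    ∋sides : ∀ k → sides seg ρ ∋ (k , edge (seg k) (ρ k))
    ∋sides k = has⇒∋ k u (sides seg ρ) (trans (has-sides′ k u) (dec-true (u Fin.≟ u) refl))
      where u = edge (seg k) (ρ k)

    sides∋⇒ : ∀ k u → sides seg ρ ∋ (k , u) → u ≡ edge (seg k) (ρ k)
    sides∋⇒ k u p with u Fin.≟ edge (seg k) (ρ k) | trans (sym (has-sides′ k u)) (∋⇒has k u (sides seg ρ) p)
    ... | yes eq | _ = eq

    ≡sides : ∀ P → (∀ k → P ∋ (k , edge (seg k) (ρ k))) → (∀ k u → P ∋ (k , u) → u ≡ edge (seg k) (ρ k)) →
             P ≡ sides seg ρ
    ≡sides P member only = has-ext λ k s → trans (equal k s) (sym (has-sides′ k s))
      where
      equal : ∀ k s → has k s P ≡ does (s Fin.≟ edge (seg k) (ρ k))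
      equal k s with s Fin.≟ edge (seg k) (ρ k)
      ... | yes refl = ∋⇒has k s P (member k)
      ... | no ne    = ¬-not (ne ∘ only k s ∘ has⇒∋ k s P)

  minRoles : Fin #crossings → Role
  minRoles = minRole ∘ hand

  minRoles-linked : Linked minRoles
  minRoles-linked k = trans (upper-minRole (hand k)) (sym (lower-minRole (hand (next k))))

  AllMin : Subset (#crossings ℕ.* 3) → Set
  AllMin A = AngleMatching A × (∀ (a : Cell #crossings) → A ∋ a → MinCondition a)

  -- Only the angle of role `minRole` satisfies the min-condition in its triangle, and these roles
  -- agree because `lower` and `upper` are `false` on all of them.
  A₋≡ : A₋ ≡ roles minRoles
  A₋≡ = the-unique {P = AllMin}
    (λ A → angleMatching? A ×-dec every? anyᶜ λ a → (A ∋? a) →-dec minCondition? a)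
    (code⇒angleMatching code , min) unique
    where
    code : Code (roles minRoles)
    code = record { role = minRoles ; member = ∋sides id minRoles ; only = sides∋⇒ id minRoles ; link = minRoles-linked }
    min : ∀ a → roles minRoles ∋ a → MinCondition a
    min (k , u) p with refl ← sides∋⇒ id minRoles k u p = ⇒min k (minRoles k) (prevR-minRole (hand k))
    unique : ∀ {A} → AllMin A → A ≡ roles minRoles
    unique {A} (am , min) = ≡sides id minRoles A member only
      where
      only : ∀ k u → A ∋ (k , u) → u ≡ edge k (minRoles k)
      only k u p with edge-surjective k u
      ... | r , refl = cong (edge k) (prevR-th (hand k) r (min⇒ k r (min (cell k r) p)))
      member : ∀ k → A ∋ cell k (minRoles k)
      member k with proj₁ am k
      ... | u , p , _ with refl ← only k u p = p

  -- Whether the left end point of a diagonal is covered from below.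
  state : (Fin #crossings → Role) → Subset #crossings
  state ρ = tabulate λ d → lower (hand d) (ρ d)

  lookup-state : ∀ ρ d → lookup (state ρ) d ≡ lower (hand d) (ρ d)
  lookup-state ρ d = lookup∘tabulate (λ d → lower (hand d) (ρ d)) d

  exteriorAt-ex : ∀ k → ExteriorAt k (cell k ex)
  exteriorAt-ex k = third≢exit k ∘ sym , entry k , entry≢exit k , inj₁ (refl , refl)

  exteriorAt⇒ : ∀ {d} k r → ExteriorAt d (cell k r) → (r ≡ ex × d ≡ k) ⊎ (r ≡ en × d ≡ next k)
  exteriorAt⇒ k en (ne , s , s≢ , inj₁ (_ , refl)) = contradiction refl s≢
  exteriorAt⇒ k en (ne , s , s≢ , inj₂ (refl , refl)) = inj₂ (refl , refl)
  exteriorAt⇒ k ex (ne , s , s≢ , inj₁ (refl , refl)) = inj₁ (refl , refl)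
  exteriorAt⇒ k ex (ne , s , s≢ , inj₂ (_ , refl)) = contradiction refl s≢
  exteriorAt⇒ k th (ne , _) = contradiction refl ne

  module _ (ρ : Fin #crossings → Role) (linked : Linked ρ) where

    has-min△ : ∀ k r → has k (edge k r) (roles minRoles △ roles ρ)
                     ≡ inBoundary r (lower (hand k) (ρ k)) (upper (hand k) (ρ k))
    has-min△ k r = begin
      has k u (roles minRoles △ roles ρ)                         ≡⟨ lookup-△ (roles minRoles) (roles ρ) (combine k u) ⟩
      has k u (roles minRoles) xor has k u (roles ρ)
          ≡⟨ cong₂ _xor_ (has-sides id minRoles k r) (has-sides id ρ k r) ⟩
      (r ≡ᵇ minRoles k) xor (r ≡ᵇ ρ k)                           ≡⟨ differ-inner (hand k) (ρ k) r ⟩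
      inBoundary r (lower (hand k) (ρ k)) (upper (hand k) (ρ k)) ∎
      where
      open ≡-Reasoning
      u = edge k r

    -- A diagonal is seen by the exit angle of the triangle above it, which changes iff `lower` is
    -- true there, and by the entry angle of the triangle below, which changes iff `upper` is true
    -- there. Agreement makes these conditions equal.
    exteriorDiagonals-roles : exteriorDiagonals (roles ρ) ≡ state ρ
    exteriorDiagonals-roles = trans (cong diagonals A₋≡) (tabulate-cong λ d → equal d (lower (hand d) (ρ d)) refl)
      where
      Exterior : Subset (#crossings ℕ.* 3) → Fin #crossings → Cell #crossings → Set
      Exterior A d a = (A △ roles ρ) ∋ a × ExteriorAt d a
      exterior? : ∀ A d → Decidable (Exterior A d)
      exterior? A d a = ((A △ roles ρ) ∋? a) ×-dec exteriorAt? d a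
      diagonals : Subset (#crossings ℕ.* 3) → Subset #crossings
      diagonals A = tabulate λ d → does (anyᶜ (exterior? A d))
      equal : ∀ d b → lower (hand d) (ρ d) ≡ b →
              does (anyᶜ (exterior? (roles minRoles) d)) ≡ lower (hand d) (ρ d)
      equal d true eq = trans (dec-true (anyᶜ (exterior? (roles minRoles) d)) (cell d ex ,
        has⇒∋ d (edge d ex) (roles minRoles △ roles ρ) (trans (has-min△ d ex) eq) , exteriorAt-ex d)) (sym eq)
      equal d false eq = trans (dec-false (anyᶜ (exterior? (roles minRoles) d)) none) (sym eq)
        where
        none : ¬ ∃ (Exterior (roles minRoles) d)
        none ((k , u) , p , e) with edge-surjective k u
        ... | r , refl with exteriorAt⇒ k r e
                          | trans (sym (has-min△ k r)) (∋⇒has k (edge k r) (roles minRoles △ roles ρ) p)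
        ...   | inj₁ (refl , refl) | q = case trans (sym q) eq of λ ()
        ...   | inj₂ (refl , refl) | q = case trans (sym q) (trans (linked k) eq) of λ ()

  inTile⇒ : ∀ {i} j r → InTile i (j , edgeᵖ j r) → (j ≡ inject₁ i × r ≢ ex) ⊎ (j ≡ suc i × r ≢ en)
  inTile⇒ j r (inj₁ (refl , ne)) = inj₁ (refl , λ { refl → ne refl })
  inTile⇒ j r (inj₂ (refl , ne)) = inj₂ (refl , λ { refl → ne refl })

  unique-tile-en : ∀ i → ∃! _≡_ λ i′ → InTile i′ (inject₁ i , edgeᵖ (inject₁ i) en)
  unique-tile-en i = i , inj₁ (behind i en λ ()) , only
    where
    only : ∀ {i′} → InTile i′ (inject₁ i , edgeᵖ (inject₁ i) en) → i ≡ i′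
    only t with inTile⇒ (inject₁ i) en t
    ... | inj₁ (eq , _) = Fin.inject₁-injective eq
    ... | inj₂ (_ , ne) = contradiction refl ne

  unique-tile-ex : ∀ i → ∃! _≡_ λ i′ → InTile i′ (suc i , edge i ex)
  unique-tile-ex i = i , inj₂ (inFront i ex λ ()) , only
    where
    only : ∀ {i′} → InTile i′ (suc i , edge i ex) → i ≡ i′
    only t with inTile⇒ (suc i) ex t
    ... | inj₂ (eq , _) = Fin.suc-injective eq
    ... | inj₁ (_ , ne) = contradiction refl ne

  unique-tile-first : ∀ r → r ≢ ex → ∃! _≡_ λ i → InTile i (△₀ , edgeᵖ △₀ r)
  unique-tile-first r ne = first , inj₁ (behind first r ne) , only
    where
    only : ∀ {i} → InTile i (△₀ , edgeᵖ △₀ r) → first ≡ i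
    only {zero} t = refl
    only {suc i} t with inTile⇒ zero r t
    ... | inj₁ (() , _)
    ... | inj₂ (() , _)

  unique-tile-last : ∀ r → r ≢ en → ∃! _≡_ λ i → InTile i (suc last , edge last r)
  unique-tile-last r ne = last , inj₂ (inFront last r ne) , only
    where
    only : ∀ {i} → InTile i (suc last , edge last r) → last ≡ i
    only t with inTile⇒ (suc last) r t
    ... | inj₁ (eq , _) = contradiction eq Fin.fromℕ≢inject₁
    ... | inj₂ (eq , _) = Fin.suc-injective eq

  unique-tile-inner : ∀ i r → r ≢ th → ∃! _≡_ λ i′ → InTile i′ (suc (inject₁ i) , edge (inject₁ i) r)
  unique-tile-inner i en ne = unique-tile-en (suc i)
  unique-tile-inner i ex ne = unique-tile-ex (inject₁ i)
  unique-tile-inner i th ne = contradiction refl ne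

  module _ (V : Subset #crossings) where
    private
      only? : ∀ (e : Cell (suc #crossings)) → Dec (∃! _≡_ λ i → i ∈ V × InTile i e)
      only? e = unique? Fin.any? Fin._≟_ λ i → (i ∈? V) ×-dec inTile? i e

    opaque
      -- An opaque copy of `∂`, which keeps its decision procedure from unfolding.
      boundary : Subset (suc #crossings ℕ.* 3)
      boundary = ∂ V

      boundary≡∂ : boundary ≡ ∂ V
      boundary≡∂ = refl

      has-∂ : ∀ j s → has j s boundary ≡ does (only? (j , s))
      has-∂ j s = has-cells {P = λ e → ∃! _≡_ λ i → i ∈ V × InTile i e} only? j s

    ∂-none : ∀ j s → (∀ i → ¬ InTile i (j , s)) → has j s boundary ≡ false
    ∂-none j s none = trans (has-∂ j s) (does-∃!-none V (only? (j , s)) none)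

    ∂-one : ∀ j s ((i , _) : ∃! _≡_ λ i → InTile i (j , s)) → has j s boundary ≡ lookup V i
    ∂-one j s (i , t , u) = trans (has-∂ j s) (does-∃!-one V (only? (j , s)) i t (λ _ → u))

    ∂-two : ∀ j s i i′ → i ≢ i′ → InTile i (j , s) → InTile i′ (j , s) →
            (∀ i″ → InTile i″ (j , s) → i ≡ i″ ⊎ i′ ≡ i″) → has j s boundary ≡ lookup V i xor lookup V i′
    ∂-two j s i i′ ne t t′ u = trans (has-∂ j s) (does-∃!-two V (only? (j , s)) i i′ ne t t′ u)

    ∂-en : ∀ i → has (inject₁ i) (edgeᵖ (inject₁ i) en) boundary ≡ lookup V i
    ∂-en i = ∂-one (inject₁ i) (edgeᵖ (inject₁ i) en) (unique-tile-en i)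

    ∂-ex : ∀ i → has (suc i) (edge i ex) boundary ≡ lookup V i
    ∂-ex i = ∂-one (suc i) (edge i ex) (unique-tile-ex i)

    ∂-first : ∀ r → has △₀ (edgeᵖ △₀ r) boundary ≡ inBoundary r false (lookup V first)
    ∂-first en = ∂-en first
    ∂-first ex = ∂-none △₀ (edgeᵖ △₀ ex) λ i t → valid-first (i , t) refl
    ∂-first th = ∂-one △₀ (edgeᵖ △₀ th) (unique-tile-first th λ ())

    ∂-last : ∀ r → has (suc last) (edge last r) boundary ≡ inBoundary r (lookup V last) false
    ∂-last ex = ∂-ex last
    ∂-last en = ∂-none (suc last) (edge last en) λ i t → valid-last (i , t) refl
    ∂-last th = trans (∂-one (suc last) (edge last th) (unique-tile-last th λ ())) (sym (xor-identityʳ (lookup V last)))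

    ∂-inner : ∀ i r → has (suc (inject₁ i)) (edge (inject₁ i) r) boundary
                    ≡ inBoundary r (lookup V (inject₁ i)) (lookup V (suc i))
    ∂-inner i en = ∂-en (suc i)
    ∂-inner i ex = ∂-ex (inject₁ i)
    ∂-inner i th = ∂-two (suc (inject₁ i)) _ (inject₁ i) (suc i) (prev≢ (suc i))
      (inj₂ (inFront (inject₁ i) th λ ())) (inj₁ (behind (suc i) th λ ())) only
      where
      only : ∀ i′ → InTile i′ (suc (inject₁ i) , edge (inject₁ i) th) → inject₁ i ≡ i′ ⊎ suc i ≡ i′
      only i′ t with inTile⇒ (suc (inject₁ i)) th t
      ... | inj₁ (eq , _) = inj₂ (Fin.inject₁-injective {i = suc i} eq)
      ... | inj₂ (eq , _) = inj₁ (Fin.suc-injective eq)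

  -- The entry side of the triangle behind a diagonal lies in that tile alone, so membership of each
  -- tile can be read off from the boundary.
  boundary-injective : ∀ {U V} → boundary U ≡ boundary V → U ≡ V
  boundary-injective {U} {V} eq = lookup-ext λ i → trans (sym (∂-en U i))
    (trans (cong (has (inject₁ i) (edgeᵖ (inject₁ i) en)) eq) (∂-en V i))

  data PlaceInSnake : Fin (suc #crossings) → Set where
    is-first : PlaceInSnake zero
    is-last  : PlaceInSnake (suc last)
    is-inner : ∀ i → PlaceInSnake (suc (inject₁ i))

  placeInSnake : ∀ j → PlaceInSnake j
  placeInSnake zero = is-first
  placeInSnake (suc k) with view k
  ... | ‵fromℕ     = is-last
  ... | ‵inject₁ i = is-inner i

  complete : Fin (suc #crossings) → Role → Role
  complete j r with placeInSnake j
  ... | is-first   = dropEx r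
  ... | is-last    = dropEn r
  ... | is-inner _ = r

  complete-last : ∀ r → complete (suc last) r ≡ dropEn r
  complete-last r rewrite view-fromℕ #crossings-1 = refl

  complete-inner : ∀ i r → complete (suc (inject₁ i)) r ≡ r
  complete-inner i r rewrite view-inject₁ i = refl

  complete-valid : ∀ j r → Valid j (complete j r)
  complete-valid j r with placeInSnake j
  ... | is-first   = valid-below zero (dropEx r) (λ _ → dropEx≢ex r)
  ... | is-last    = valid-above last (dropEn r) (λ _ → dropEn≢en r)
  ... | is-inner i = valid-above (inject₁ i) r λ eq → contradiction (sym eq) Fin.fromℕ≢inject₁

  upper-complete : ∀ h i r → upper h (complete (inject₁ i) r) ≡ upper h r
  upper-complete h zero    r = upper-dropEx h r
  upper-complete h (suc i) r = cong (upper h) (complete-inner i r)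

  lower-complete : ∀ h i r → lower h (complete (suc i) r) ≡ lower h r
  lower-complete h i r with view i
  ... | ‵fromℕ     = lower-dropEn h r
  ... | ‵inject₁ _ = refl

-- The minimal matching of the snake graph and the enclosed tiles.

module Tiles {S : TriangulatedSurface} (ζ : EssentialLoop S) where
  open EssentialLoop ζ
  open Loop ζ
  open Turns ζ
  open Angles ζ
  open Snake ζ
  open Bands ζ
  open Coefficients ζ

  completed : (Fin #crossings → Role) → Fin (suc #crossings) → Role
  completed ρ j = complete j (ρ (segment j))

  module _ (ρ : Fin #crossings → Role) (linked : Linked ρ) where

    linked-prev : ∀ i → upper (hand (prev i)) (ρ (prev i)) ≡ lower (hand i) (ρ i)
    linked-prev i = trans (linked (prev i)) (cong (λ k → lower (hand k) (ρ k)) (next-prev i))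

    completed-linked : ∀ i → upper (handᵖ (inject₁ i)) (completed ρ (inject₁ i)) ≡ lower (hand i) (completed ρ (suc i))
    completed-linked i = trans (upper-complete (handᵖ (inject₁ i)) i (ρ (segment (inject₁ i))))
      (trans (cong (λ k → upper (hand k) (ρ k)) (segment-inject₁ i))
      (trans (linked-prev i) (sym (lower-complete (hand i) i (ρ i)))))

    private
      Q : Subset (suc #crossings ℕ.* 3)
      Q = rolesᵖ (completed ρ)

    -- At an end point of a diagonal, agreement selects exactly one of the two neighbouring
    -- triangles; the vertices `back` and `front` meet a single triangle.
    covered-once : ∀ {x} → VertexView x → ∃! _≡_ λ e → Q ∋ e × Incident x e
    covered-once is-back = (△₀ , edgeᵖ △₀ r) , (∋sides segment (completed ρ) zero ,
        touches⇒incident zero r (complete-valid zero (ρ last)) (inj₁ refl)) , only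
      where
      r = completed ρ zero
      only : ∀ {e} → Q ∋ e × Incident (first , back) e → (△₀ , edgeᵖ △₀ r) ≡ e
      only {j , u} (q , inc) with refl ← sides∋⇒ segment (completed ρ) j u q
        with incident⇒touches j (completed ρ j) inc
      ... | _ , inj₁ eq with refl ← lo-back {j} eq = refl
      ... | _ , inj₂ eq = contradiction eq (hi-back {j})
    covered-once is-front = (suc last , edge last r) , (∋sides segment (completed ρ) (suc last) ,
        touches⇒incident (suc last) r (complete-valid (suc last) (ρ last)) (inj₂ (hi-fromℕ _))) , only
      where
      r = completed ρ (suc last)
      only : ∀ {e} → Q ∋ e × Incident (last , front) e → (suc last , edge last r) ≡ e
      only {j , u} (q , inc) with refl ← sides∋⇒ segment (completed ρ) j u q
        with incident⇒touches j (completed ρ j) inc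
      ... | _ , inj₁ eq = contradiction eq (lo-front {j})
      ... | _ , inj₂ eq with refl ← hi-front {j} eq = refl
    covered-once (is-corner i b) with upper (handᵖ (inject₁ i)) (completed ρ (inject₁ i)) Bool.≟ b
    ... | yes up = (inject₁ i , edgeᵖ (inject₁ i) r) , (∋sides segment (completed ρ) (inject₁ i) ,
        touches⇒incident (inject₁ i) r (complete-valid (inject₁ i) (ρ (segment (inject₁ i))))
          (touch-below i r up)) , only
      where
      r = completed ρ (inject₁ i)
      only : ∀ {e} → Q ∋ e × Incident (i , corner b) e → (inject₁ i , edgeᵖ (inject₁ i) r) ≡ e
      only {j , u} (q , inc) with refl ← sides∋⇒ segment (completed ρ) j u q
        with touches-corner {j = j} {completed ρ j} (proj₂ (incident⇒touches j (completed ρ j) inc))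
      ... | inj₁ (refl , f) = contradiction (trans (sym up) (trans (completed-linked i)
              (foot≡⇒lower≡not (hand i) (completed ρ (suc i)) f))) (not-¬ refl)
      ... | inj₂ (refl , _) = refl
    ... | no ¬up = (suc i , edge i r) , (∋sides segment (completed ρ) (suc i) ,
        touches⇒incident (suc i) r (complete-valid (suc i) (ρ i)) (touch-above i r
          (lower≡not⇒foot≡ (hand i) r (trans (sym (completed-linked i)) (¬-not ¬up))))) , only
      where
      r = completed ρ (suc i)
      only : ∀ {e} → Q ∋ e × Incident (i , corner b) e → (suc i , edge i r) ≡ e
      only {j , u} (q , inc) with refl ← sides∋⇒ segment (completed ρ) j u q
        with touches-corner {j = j} {completed ρ j} (proj₂ (incident⇒touches j (completed ρ j) inc))
      ... | inj₁ (refl , _) = refl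
      ... | inj₂ (refl , up) = contradiction up ¬up

    completed-snakeMatching : SnakeMatching Q
    completed-snakeMatching = inTile , λ i x → covered-once (vertex-view i x)
      where
      inTile : ∀ e → Q ∋ e → ∃[ i ] InTile i e
      inTile (j , u) q with refl ← sides∋⇒ segment (completed ρ) j u q = complete-valid j (ρ (segment j))

  Q₋ : Subset (suc #crossings ℕ.* 3)
  Q₋ = rolesᵖ (completed minRoles)

  Q₋-minimal : IsMinimalSnake Q₋
  Q₋-minimal = completed-snakeMatching minRoles minRoles-linked , boundary-only , initial
    where
    boundary-only : ∀ (e : Cell (suc #crossings)) → Q₋ ∋ e → ∃! _≡_ λ i → InTile i e
    boundary-only (j , u) q with refl ← sides∋⇒ segment (completed minRoles) j u q with placeInSnake j
    ... | is-first   = unique-tile-first _ (dropEx≢ex (minRole (hand last)))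
    ... | is-last    = unique-tile-last _ (dropEn≢en (minRole (hand last)))
    ... | is-inner i = unique-tile-inner i _ (minRole≢th (hand (inject₁ i)))
    initial : Q₋ ∋ (△₀ , prev (exitᵖ △₀))
    initial = subst (λ u → Q₋ ∋ (△₀ , u))
      (sym (trans (prev-edge last ex) (cong (edge last) (prevR-ex-dropEx (hand last)))))
      (∋sides segment (completed minRoles) △₀)

  module _ {Q : Subset (suc #crossings ℕ.* 3)} (minimal : IsMinimalSnake Q) where
    private
      snake : SnakeMatching Q
      snake = proj₁ minimal

      valid : ∀ j r → Q ∋ (j , edgeᵖ j r) → Valid j r
      valid j r q = proj₁ snake (j , edgeᵖ j r) q

      at-corner : ∀ i b → ∃! _≡_ λ e → Q ∋ e × Incident (i , corner b) e
      at-corner i b = subst (λ x → ∃! _≡_ λ e → Q ∋ e × Incident x e) (vertex-corner i b) (proj₂ snake i (corner b))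

      at-corner-unique : ∀ i b j r j′ r′ → Q ∋ (j , edgeᵖ j r) → Touches (i , corner b) j r →
        Q ∋ (j′ , edgeᵖ j′ r′) → Touches (i , corner b) j′ r′ → (j , edgeᵖ j r) ≡ (j′ , edgeᵖ j′ r′)
      at-corner-unique i b j r j′ r′ q t q′ t′ with at-corner i b
      ... | _ , _ , u = trans (sym (u (q , touches⇒incident j r (valid j r q) t)))
                              (u (q′ , touches⇒incident j′ r′ (valid j′ r′ q′) t′))

      Determined : Fin (suc #crossings) → Set
      Determined j = Q ∋ (j , edgeᵖ j (completed minRoles j)) × (∀ r → Q ∋ (j , edgeᵖ j r) → r ≡ completed minRoles j)

      determined-first : Determined zero
      determined-first = initial , only
        where
        r₀ = completed minRoles △₀
        initial : Q ∋ (△₀ , edgeᵖ △₀ r₀)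
        initial = subst (λ u → Q ∋ (△₀ , u))
          (trans (prev-edge last ex) (cong (edge last) (prevR-ex-dropEx (hand last)))) (proj₂ (proj₂ minimal))
        only : ∀ r → Q ∋ (△₀ , edgeᵖ △₀ r) → r ≡ r₀
        only r q with proj₂ snake first back
        ... | _ , _ , u = edge-injective last (cong proj₂ (trans
          (sym (u (q , touches⇒incident zero r (valid zero r q) (inj₁ refl))))
          (u (initial , touches⇒incident zero r₀ (valid zero r₀ initial) (inj₁ refl)))))

      not-third : ∀ i r → Q ∋ (suc (inject₁ i) , edge (inject₁ i) r) → r ≢ th
      not-third i _ q refl with proj₁ (proj₂ minimal) _ q
      ... | _ , _ , u = prev≢ (suc i) (trans (sym (u (inj₂ (inFront (inject₁ i) th λ ()))))
                                             (u (inj₁ (behind (suc i) th λ ()))))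

      -- Third sides lie in two tiles and are no boundary edges. The last triangle is the exception:
      -- there the third side is a boundary edge and the entry side is no edge.
      foot-true : ∀ i r → Q ∋ (suc i , edge i r) → foot (hand i) r ≡ true → r ≡ completed minRoles (suc i)
      foot-true i r q f with view i | valid (suc i) r q | not-third
      ... | ‵fromℕ     | va | _ = foot-true⇒dropEn (hand last) r (valid-last va) f
      ... | ‵inject₁ j | _  | n = foot-true⇒minRole (hand (inject₁ j)) r (n j r q) f

      -- The side below covers the right end point of the diagonal. So the left one is covered from
      -- above, and another side above would cover the right one twice.
      determined-step : ∀ i → Determined (inject₁ i) → Determined (suc i)
      determined-step i (q₀ , only₀) = found (at-corner i true)
        where
        r₀ = completed minRoles (inject₁ i)
        upper-r₀ : upper (handᵖ (inject₁ i)) r₀ ≡ false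
        upper-r₀ = trans (upper-complete (handᵖ (inject₁ i)) i (minRoles (segment (inject₁ i))))
          (upper-minRole (handᵖ (inject₁ i)))
        only : ∀ r → Q ∋ (suc i , edge i r) → r ≡ completed minRoles (suc i)
        only r q with foot (hand i) r in f
        ... | true  = foot-true i r q f
        ... | false = contradiction (sym (cong proj₁ (at-corner-unique i false (suc i) r (inject₁ i) r₀
                q (touch-above i r f) q₀ (touch-below i r₀ upper-r₀)))) (inject₁≢suc i)
        found : (∃! _≡_ λ e → Q ∋ e × Incident (i , corner true) e) → Determined (suc i)
        found ((j , u) , (q , inc) , _) with edge-surjective (segment j) u
        ... | r , refl with touches-corner {j = j} {r} (proj₂ (incident⇒touches j r inc))
        ...   | inj₁ (refl , f) = subst (λ r → Q ∋ (suc i , edge i r)) (foot-true i r q f) q , only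
        ...   | inj₂ (refl , up) with refl ← only₀ r q = case trans (sym up) upper-r₀ of λ ()

      determined : ∀ j → Determined j
      determined = <-weakInduction Determined determined-first determined-step

    minimal-unique : Q ≡ Q₋
    minimal-unique = ≡sides segment (completed minRoles) Q (proj₁ ∘ determined) only
      where
      only : ∀ j u → Q ∋ (j , u) → u ≡ edgeᵖ j (completed minRoles j)
      only j u q with edge-surjective (segment j) u
      ... | r , refl = cong (edgeᵖ j) (proj₂ (determined j) r q)

  P₋≡ : P₋ ≡ Q₋
  P₋≡ = the-unique {P = IsMinimalSnake} isMinimalSnake? Q₋-minimal minimal-unique

  module _ {P : Subset (#crossings ℕ.* 3)} (code : Code P) where
    open Code code

    code≡roles : P ≡ roles role
    code≡roles = ≡sides id role P member only

    Completion : Cell (suc #crossings) → Set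
    Completion e = (∃[ i ] InTile i e)
      × (P ∋ glued e ⊎ (e ≡ (△₀ , τ) × AtLast P) ⊎ (e ≡ (△ₙ , τ) × AtFirst P))

    completion? : Decidable Completion
    completion? e = Fin.any? (λ i → inTile? i e)
      ×-dec ((P ∋? glued e)
        ⊎-dec (((e ≟ᶜ (△₀ , τ)) ×-dec atLast? P)
          ⊎-dec ((e ≟ᶜ (△ₙ , τ)) ×-dec atFirst? P)))

    -- Only the first copy of the triangle at the cut meets `v`, and its exit side is not an edge.
    covered-v⇒ : Covered P v → role last ≢ ex
    covered-v⇒ ((j , s) , p , inc) eq with edge-surjective (segment j) s
    ... | r , refl with incident⇒touches j r inc
    ...   | va , t with refl ← touches-v {j} {r} t =
      valid-first va (trans (edge-injective last {r} {role last} (only last (edge last r) p)) eq)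

    covered-v′⇒ : Covered P v′ → role last ≢ en
    covered-v′⇒ ((j , s) , p , inc) eq with edge-surjective (segment j) s
    ... | r , refl with incident⇒touches j r inc
    ...   | va , t with refl ← touches-v′ {j} {r} t =
      valid-last va (trans (edge-injective last {r} {role last} (only last (edge last r) p)) eq)

    dropEx-th : ∀ r → r ≢ en → dropEx r ≡ th
    dropEx-th en ne = contradiction refl ne
    dropEx-th ex ne = refl
    dropEx-th th ne = refl

    dropEn-th : ∀ r → r ≢ ex → dropEn r ≡ th
    dropEn-th en ne = refl
    dropEn-th ex ne = contradiction refl ne
    dropEn-th th ne = refl

    valid-complete : ∀ j r → Valid j r → complete j r ≡ r
    valid-complete j r va with placeInSnake j
    ... | is-inner i = refl
    valid-complete _ en va | is-first = refl
    valid-complete _ th va | is-first = refl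
    valid-complete _ ex va | is-first = contradiction refl (valid-first va)
    valid-complete _ ex va | is-last = refl
    valid-complete _ th va | is-last = refl
    valid-complete _ en va | is-last = contradiction refl (valid-last va)

    completion⇒ : ∀ j r → Completion (j , edgeᵖ j r) → r ≡ completed role j
    completion⇒ j r (va , inj₁ p)
      with refl ← edge-injective (segment j) {r} {role (segment j)} (only (segment j) (edgeᵖ j r) p) =
      sym (valid-complete j r va)
    completion⇒ j r (va , inj₂ (inj₁ (eq , (cv , _)))) with refl ← cong proj₁ eq =
      trans (edge-injective last {r} {th} (cong proj₂ eq)) (sym (dropEx-th (role last) (covered-v′⇒ cv)))
    completion⇒ j r (va , inj₂ (inj₂ (eq , (cv , _)))) with refl ← cong proj₁ eq =
      trans (edge-injective last {r} {th} (cong proj₂ eq))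
        (sym (trans (complete-last (role last)) (dropEn-th (role last) (covered-v⇒ cv))))

    ⇒completion : ∀ j → Completion (j , edgeᵖ j (completed role j))
    ⇒completion j = complete-valid j (role (segment j)) , belongs j
      where
      Belongs : Cell (suc #crossings) → Set
      Belongs e = P ∋ glued e ⊎ (e ≡ (△₀ , τ) × AtLast P) ⊎ (e ≡ (△ₙ , τ) × AtFirst P)
      belongs-first : Belongs (△₀ , edgeᵖ △₀ (dropEx (role last)))
      belongs-first with role last in eq
      ... | en = inj₁ (subst (λ r → P ∋ cell last r) eq (member last))
      ... | th = inj₁ (subst (λ r → P ∋ cell last r) eq (member last))
      ... | ex = inj₂ (inj₁ (refl , covered-v′ code ne , covered-w′ code ne))
        where
        ne : role last ≢ en
        ne eq′ = case trans (sym eq) eq′ of λ ()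
      belongs-last : Belongs (suc last , edge last (dropEn (role last)))
      belongs-last with role last in eq
      ... | ex = inj₁ (subst (λ r → P ∋ cell last r) eq (member last))
      ... | th = inj₁ (subst (λ r → P ∋ cell last r) eq (member last))
      ... | en = inj₂ (inj₂ (refl , covered-v code ne , covered-w code ne))
        where
        ne : role last ≢ ex
        ne eq′ = case trans (sym eq) eq′ of λ ()
      belongs : ∀ j → Belongs (j , edgeᵖ j (completed role j))
      belongs j with placeInSnake j
      ... | is-first   = belongs-first
      ... | is-last    = belongs-last
      ... | is-inner i = inj₁ (member (inject₁ i))

    completion≡ : completion P ≡ rolesᵖ (completed role)
    completion≡ = has-ext λ j s → trans (has-cells {P = Completion} completion? j s)
      (trans (does-⇔ (mk⇔ (to j s) (from j s)) (completion? (j , s)) (s Fin.≟ edgeᵖ j (completed role j)))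
        (sym (has-sides′ segment (completed role) j s)))
      where
      to : ∀ j s → Completion (j , s) → s ≡ edgeᵖ j (completed role j)
      to j s c with edge-surjective (segment j) s
      ... | r , refl = cong (edgeᵖ j) (completion⇒ j r c)
      from : ∀ j s → s ≡ edgeᵖ j (completed role j) → Completion (j , s)
      from j s refl = ⇒completion j

    -- Compared triangle by triangle with the local tables. Agreement turns `upper` of a triangle
    -- into the state of the next tile, also across the cut for the first one.
    boundary-state : boundary (state role) ≡ Q₋ △ rolesᵖ (completed role)
    boundary-state = has-ext equal
      where
      U = state role
      K = completed role

      has-△ : ∀ j r → has j (edgeᵖ j r) (Q₋ △ rolesᵖ K) ≡ (r ≡ᵇ completed minRoles j) xor (r ≡ᵇ K j)
      has-△ j r = trans (lookup-△ Q₋ (rolesᵖ K) (combine j (edgeᵖ j r)))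
        (cong₂ _xor_ (has-sides segment (completed minRoles) j r) (has-sides segment K j r))

      equal-first : ∀ r → has △₀ (edgeᵖ △₀ r) (boundary U) ≡ (r ≡ᵇ completed minRoles △₀) xor (r ≡ᵇ K △₀)
      equal-first r = trans (∂-first U r) (trans (cong (inBoundary r false)
        (trans (lookup-state role first) (sym (linked-prev role link first))))
        (sym (differ-first (hand last) (role last) r)))

      equal-last : ∀ r → has (suc last) (edge last r) (boundary U)
                       ≡ (r ≡ᵇ completed minRoles (suc last)) xor (r ≡ᵇ K (suc last))
      equal-last r = trans (∂-last U r) (trans (cong (λ l → inBoundary r l false) (lookup-state role last))
        (trans (sym (differ-last (hand last) (role last) r))
          (sym (cong₂ (λ r₁ r₂ → (r ≡ᵇ r₁) xor (r ≡ᵇ r₂)) (complete-last (minRoles last)) (complete-last (role last))))))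

      equal-inner : ∀ i r → has (suc (inject₁ i)) (edge (inject₁ i) r) (boundary U)
                          ≡ (r ≡ᵇ completed minRoles (suc (inject₁ i))) xor (r ≡ᵇ K (suc (inject₁ i)))
      equal-inner i r = trans (∂-inner U i r) (trans (cong₂ (inBoundary r) (lookup-state role (inject₁ i))
          (trans (lookup-state role (suc i)) (sym (linked-prev role link (suc i)))))
        (trans (sym (differ-inner (hand (inject₁ i)) (role (inject₁ i)) r))
          (sym (cong₂ (λ r₁ r₂ → (r ≡ᵇ r₁) xor (r ≡ᵇ r₂)) (complete-inner i (minRoles (inject₁ i)))
            (complete-inner i (role (inject₁ i)))))))

      equal-role : ∀ j r → PlaceInSnake j → has j (edgeᵖ j r) (boundary U) ≡ (r ≡ᵇ completed minRoles j) xor (r ≡ᵇ K j)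
      equal-role _ r is-first     = equal-first r
      equal-role _ r is-last      = equal-last r
      equal-role _ r (is-inner i) = equal-inner i r

      equal : ∀ j s → has j s (boundary U) ≡ has j s (Q₋ △ rolesᵖ K)
      equal j s with edge-surjective (segment j) s
      ... | r , refl = trans (equal-role j r (placeInSnake j)) (sym (has-△ j r))

    -- Abstracts `enclosedTiles` over the two matchings, so that both can be replaced by their
    -- explicit forms.
    tiles : Subset (suc #crossings ℕ.* 3) → Subset (suc #crossings ℕ.* 3) → Subset #crossings
    tiles Q R = the λ U → ≡-dec Bool._≟_ (∂ U) (Q △ R)

    enclosedTiles≡state : enclosedTiles P ≡ state role
    enclosedTiles≡state = trans (cong₂ tiles P₋≡ completion≡)
      (the-unique {P = λ U → ∂ U ≡ Q₋ △ rolesᵖ (completed role)}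
        (λ U → ≡-dec Bool._≟_ (∂ U) (Q₋ △ rolesᵖ (completed role)))
        ∂-state λ {V} eq → boundary-injective (trans (boundary≡∂ V) (trans eq (sym boundary-state))))
      where
      ∂-state : ∂ (state role) ≡ Q₋ △ rolesᵖ (completed role)
      ∂-state = trans (sym (boundary≡∂ (state role))) boundary-state

    enclosedTiles≡exteriorDiagonals : enclosedTiles P ≡ exteriorDiagonals P
    enclosedTiles≡exteriorDiagonals = trans enclosedTiles≡state
      (trans (sym (exteriorDiagonals-roles role link)) (cong exteriorDiagonals (sym code≡roles)))

-- The bijection and the equality of the two expansions.

module _ {S : TriangulatedSurface} (ζ : EssentialLoop S) where
  open EssentialLoop ζ using (#crossings)
  open Loop ζ
  open Angles ζ
  open Bands ζ
  open Tiles ζ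

  goodBandMatching⇒goodAngleMatching : ∀ {P} → GoodBandMatching P → GoodAngleMatching P
  goodBandMatching⇒goodAngleMatching (m , g) = code⇒goodAngleMatching (goodBandMatching⇒code m g)

  goodAngleMatching⇒goodBandMatching : ∀ {P} → GoodAngleMatching P → GoodBandMatching P
  goodAngleMatching⇒goodBandMatching (m , g) = code⇒goodBandMatching (goodAngleMatching⇒code m g)

  tiles≡diagonals : ∀ {P} → GoodBandMatching P → enclosedTiles P ≡ exteriorDiagonals P
  tiles≡diagonals (m , g) = enclosedTiles≡exteriorDiagonals (goodBandMatching⇒code m g)

  -- An edge of the band graph corresponds to the angle opposite to it.
  ψ : ℙg ζ ⤖ 𝔸g ζ
  ψ = mk⤖ {to = λ (P , [ p ]) → P , [ goodBandMatching⇒goodAngleMatching p ]}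
    ( (λ eq → value-injective (cong value eq))
    , λ (A , [ a ]) → (A , [ goodAngleMatching⇒goodBandMatching a ]) , λ { refl → refl } )

module _ {a ℓ} {S : TriangulatedSurface} (𝒮 : Seed a ℓ S) where
  open Seed 𝒮 hiding (refl)

  ∑⊆-cong : ∀ {m} {f g : Subset m → Carrier} → (∀ U → f U ≈ g U) → ∑⊆ f ≈ ∑⊆ g
  ∑⊆-cong {zero}  eq = eq []
  ∑⊆-cong {suc m} eq = +-cong (∑⊆-cong (eq ∘ (inside ∷_))) (∑⊆-cong (eq ∘ (outside ∷_)))

  ∑-cong : ∀ {m} {P Q : Subset m → Set} (P? : Decidable P) (Q? : Decidable Q) {f g : Subset m → Carrier} →
           (∀ {U} → P U → Q U) → (∀ {U} → Q U → P U) → (∀ {U} → P U → f U ≈ g U) → ∑[ P? ] f ≈ ∑[ Q? ] g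
  ∑-cong P? Q? {f} {g} to from eq = ∑⊆-cong term
    where
    term : ∀ U → (if does (P? U) then f U else 0#) ≈ (if does (Q? U) then g U else 0#)
    term U with P? U | Q? U
    ... | yes p | yes _ = eq p
    ... | no _  | no _  = Seed.refl 𝒮
    ... | yes p | no ¬q with () ← ¬q (to p)
    ... | no ¬p | yes q with () ← ¬p (from q)

module _ {a ℓ} {S : TriangulatedSurface} (𝒮 : Seed a ℓ S) (ζ : EssentialLoop S) where
  open Seed 𝒮 hiding (refl)
  open Weights 𝒮 ζ

  -- An angle has the weight of the side opposite to it, so the two products are the same term.
  xᴾ≈xᴬ : ∀ P → xᴾ P ≈ xᴬ P
  xᴾ≈xᴬ P = Seed.refl 𝒮

  yᴾ≈yᴬ : ∀ {P} → Loop.GoodBandMatching ζ P → yᴾ P ≈ yᴬ P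
  yᴾ≈yᴬ good = reflexive (cong (λ U → ∏[ U ] (y ∘ EssentialLoop.arc ζ)) (tiles≡diagonals ζ good))

  expansions : x[ζ] ≈ angleExpansion
  expansions = *-congˡ {cross⁻¹} {∑[ Loop.goodBandMatching? ζ ] (λ P → xᴾ P * yᴾ P)}
      {∑[ Loop.goodAngleMatching? ζ ] (λ A → xᴬ A * yᴬ A)}
    (∑-cong 𝒮 {P = Loop.GoodBandMatching ζ} {Loop.GoodAngleMatching ζ}
      (Loop.goodBandMatching? ζ) (Loop.goodAngleMatching? ζ)
      {λ P → xᴾ P * yᴾ P} {λ A → xᴬ A * yᴬ A}
      (goodBandMatching⇒goodAngleMatching ζ) (goodAngleMatching⇒goodBandMatching ζ)
      (λ {U} good → *-cong (xᴾ≈xᴬ U) (yᴾ≈yᴬ good)))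

theorem6p5 : ∀ {a ℓ} (S : TriangulatedSurface) (ζ : EssentialLoop S) →
    Σ[ ψ ∈ ℙg ζ ⤖ 𝔸g ζ ] ((𝒮 : Seed a ℓ S) →
    let open Seed 𝒮 using (_≈_)
        open Weights 𝒮 ζ
        ψ⟨_⟩ = λ P → value (Bijection.to ψ P)
    in (∀ P → xᴾ (value P) ≈ xᴬ (ψ⟨ P ⟩))
    × (∀ P → yᴾ (value P) ≈ yᴬ (ψ⟨ P ⟩))
    × x[ζ] ≈ angleExpansion)
theorem6p5 S ζ = ψ ζ , λ 𝒮 →
    (λ (P , _) → xᴾ≈xᴬ 𝒮 ζ P)
  -- The proof of goodness stored in `ℙg` is irrelevant; decidability allows it to be recovered.
  , (λ (P , [ p ]) → yᴾ≈yᴬ 𝒮 ζ {P} (recompute (Loop.goodBandMatching? ζ P) p))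
  , expansions 𝒮 ζ
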